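{- Let $k\in\{3,4,5,7\}$ and put $N(3)=6$, $N(4)=7$, $N(5)=24$, $N(7)=93$. If $n\ge N(k)$ and $\pi=(d_1,\ldots,d_n)$ is a graphic sequence with $\sigma(\pi)>(k-1)(n-1)$, then $\pi$ has a realization containing every 2-tree on $k$ vertices as a subgraph. Moreover, the lower bound $(k-1)(n-1)$ is best possible: (for infinitely many $n$) there exist graphic sequences $\pi$ of length $n$ with $\sigma(\pi)=(k-1)(n-1)$ having no realization that contains every 2-tree on $k$ vertices.
   Context: A simple graph $G$ is a 2-tree if $G=K_3$, or $G$ has a vertex $v$ of degree 2 whose two neighbors are adjacent and $G-v$ is a 2-tree. A non-increasing sequence $\pi=(d_1,\ldots,d_n)$ of nonnegative integers is graphic if it is the degree sequence of some simple graph on $n$ vertices, called a realization of $\pi$. We write $\sigma(\pi)=d_1+\cdots+d_n$. -}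

module Defs where

open import Data.Nat using (ℕ; zero; suc; _+_; _*_; _∸_; _≤_; _≥_; _>_)
open import Data.Bool using (Bool; true; false; if_then_else_)
open import Data.Fin using (Fin; punchIn)
open import Data.Fin.Properties using (punchInᵢ≢i; punchIn-injective)
open import Data.Vec using (Vec; lookup; tabulate; sum)
open import Data.Product using (Σ; ∃; _×_; _,_)
open import Relation.Binary.PropositionalEquality using (_≡_; _≢_; refl)
open import Relation.Nullary using (¬_)
open import Function.Definitions using (Injective)

record Graph (n : ℕ) : Set where
  field
    adj   : Fin n → Fin n → Bool
    sym   : ∀ i j → adj i j ≡ adj j i
    irrefl : ∀ i → adj i i ≡ false
open Graph public

deg : ∀ {n} → Graph n → Fin n → ℕ
deg {n} G i = sum (tabulate {n = n} (λ j → if adj G i j then 1 else 0))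

delete : ∀ {m} → Graph (suc m) → Fin (suc m) → Graph m
delete G v = record
  { adj = λ a b → adj G (punchIn v a) (punchIn v b)
  ; sym = λ a b → sym G (punchIn v a) (punchIn v b)
  ; irrefl = λ a → irrefl G (punchIn v a)
  }

data IsTwoTree : ∀ {m} → Graph m → Set where
  triangle : (G : Graph 3) → (∀ i j → i ≢ j → adj G i j ≡ true) → IsTwoTree G
  extend : ∀ {m} (G : Graph (suc m)) (v : Fin (suc m)) →
           deg G v ≡ 2 →
           (Σ (Fin (suc m)) λ u → Σ (Fin (suc m)) λ w →
              u ≢ w × adj G v u ≡ true × adj G v w ≡ true × adj G u w ≡ true) →
           IsTwoTree (delete G v) →
           IsTwoTree G

Contains : ∀ {n k} → Graph n → Graph k → Set
Contains {n} {k} G H = Σ (Fin k → Fin n) λ f →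
  Injective _≡_ _≡_ f × (∀ a b → adj H a b ≡ true → adj G (f a) (f b) ≡ true)

ContainsAllTwoTrees : ∀ {n} → (k : ℕ) → Graph n → Set
ContainsAllTwoTrees k G = (H : Graph k) → IsTwoTree H → Contains G H

NonIncreasing : ∀ {n} → Vec ℕ n → Set
NonIncreasing {n} π = ∀ (i j : Fin n) → Data.Fin._≤_ i j → lookup π j ≤ lookup π i

Realizes : ∀ {n} → Graph n → Vec ℕ n → Set
Realizes {n} G π = ∀ (i : Fin n) → deg G i ≡ lookup π i

Graphic : ∀ {n} → Vec ℕ n → Set
Graphic {n} π = NonIncreasing π × Σ (Graph n) λ G → Realizes G π

σ : ∀ {n} → Vec ℕ n → ℕ
σ = sum

data KN : ℕ → ℕ → Set where
  k3 : KN 3 6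
  k4 : KN 4 7
  k5 : KN 5 24
  k7 : KN 7 93

{-# OPTIONS --safe #-}
-- Every 2-tree on k vertices lies in a fixed host graph on k vertices: K₃, K₄ − e, K₂ ∨ (K₂ ∪ K₁) and
-- K₂ ∨ P₅ for k = 3, 4, 5, 7. So it suffices to put the host on the k vertices of largest degree (the core)
-- by degree-preserving edge switches. To create an edge uv one deletes ux and vy and adds uv and xy; if x = y
-- or xy is already an edge, a third edge zw is deleted and xz and yw are added instead, which is
-- possible unless every edge zw has z near x or w near y. If all degrees but the first one or two are
-- small, a count of edges shows that such a zw always exists. If two vertices (three for k = 7)
-- have large degree, then failure of all switches for a missing edge uv makes the neighbours of u and of v
-- completely joined, with one side a clique, and the host is found there; so the vertices of large degree
-- become adjacent to the whole core, and it remains to add at most two edges inside the core.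
-- In the near-regular cases with few vertices for k = 3, 4 the realizations are computed.
-- For sharpness take K₁ ∨ q K_{k−2}: the book K₂ ∨ (k − 2) K₁ needs two vertices of degree at least k − 1.
module Submission where

open import Defs renaming (sym to adj-sym)
open import Data.Bool using (Bool; true; false; if_then_else_; not; _∧_; _∨_)
open import Data.Bool.ListAction using (any)
open import Data.Bool.Properties using (¬-not; T-∧; T-∨; T-≡; ∧-comm; ∨-comm; ∨-zeroʳ)
open import Data.Empty using (⊥)
open import Data.Fin using (Fin; zero; suc; punchIn; punchOut; toℕ; _↑ˡ_; _↑ʳ_; splitAt; fromℕ<; inject≤; #_)
open import Data.Fin.Properties using (_≟_; any?; all?; ↑ˡ-injective; splitAt-↑ˡ; splitAt-↑ʳ; punchIn-punchOut; punchInᵢ≢i; punchIn-injective; punchOut-injective; punchOut-cong; suc-injective; 0≢1+n; toℕ-injective; toℕ-inject≤; toℕ-fromℕ<; toℕ<n; toℕ-↑ʳ; toℕ-↑ˡ)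
open import Data.List using (List; []; _∷_; _++_; length; map; filter; take; drop; allFin; concatMap; mapMaybe)
open import Data.List.Membership.Propositional using (_∈_; _∉_; find)
open import Data.List.Membership.Propositional.Properties using (∈-map⁺; ∈-++⁺ˡ; ∈-++⁺ʳ; ∈-filter⁺; ∈-filter⁻; ∈-allFin; ∈-tabulate⁺; ∈-lookup)
open import Data.List.Properties using (length-++; length-map; length-tabulate; length-take; length-drop; filter-notAll)
open import Data.List.Relation.Unary.All using (All; []; _∷_)
open import Data.List.Relation.Unary.AllPairs using (AllPairs; []; _∷_)
open import Data.List.Relation.Unary.Any using (Any; here; there)
open import Data.List.Relation.Unary.Unique.Propositional using (Unique)
open import Data.Maybe using (Maybe; just; nothing; from-just)
open import Data.Nat using (ℕ; zero; suc; _+_; _*_; _∸_; _≤_; _<_; _≥_; _>_; z≤n; s≤s; _≤?_; _<?_; s≤s⁻¹)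
open import Data.Nat.Divisibility using (_∣?_; divides)
open import Data.Nat.ListAction using (sum)
open import Data.Nat.Properties using (module ≤-Reasoning; ≤-refl; ≤-reflexive; ≤-trans; <-≤-trans; ≤-<-trans; <⇒≤; n≮n; <⇒≱; ≮⇒≥; ≰⇒>; n≤1+n; m≤m+n; m≤n+m; +-comm; +-assoc; +-suc; +-identityʳ; +-mono-≤; +-monoˡ-≤; +-monoʳ-≤; +-mono-<-≤; +-mono-≤-<; +-cancelʳ-≡; +-cancelˡ-≤; m≤n+m∸n; *-monoˡ-≤; *-monoʳ-≤; *-distribʳ-+; *-comm; *-zeroʳ; *-identityʳ; m≤n⇒m⊓n≡m; m+n∸m≡n; ≤⇒≯; m≤m*n; <⇒<ᵇ; <ᵇ⇒<; ≤-antisym; m≤n⇒m∸n≡0; *-distribˡ-+; ∸-monoˡ-≤; m≤n⇒∃[o]m+o≡n)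
open import Data.Nat.Tactic.RingSolver using (solve-∀)
open import Data.Product using (Σ; ∃; ∃₂; _×_; _,_; proj₁; proj₂)
open import Data.Sum using (_⊎_; inj₁; inj₂; [_,_]′)
open import Data.Unit using (⊤; tt)
open import Data.Vec using (Vec; []; _∷_; lookup)
open import Data.Vec.Properties using (lookup-replicate; lookup∘tabulate; tabulate∘lookup)
open import Function using (_∘_; id; case_of_)
open import Function.Bundles using (Equivalence)
open import Function.Definitions using (Injective)
open import Relation.Binary.PropositionalEquality using (_≡_; _≢_; refl; sym; trans; cong; cong₂; subst; subst₂; ≢-sym; module ≡-Reasoning)
open import Relation.Nullary using (¬_; Dec; yes; no; does; contradiction)
open import Relation.Nullary.Decidable using (toWitness; dec-true; dec-false; ¬?; _×-dec_; _⊎-dec_)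
import Data.Bool as Bool
import Data.List as List
import Data.List.Membership.DecPropositional
import Data.List.Relation.Unary.All as All
import Data.List.Relation.Unary.All.Properties as AllP
import Data.List.Relation.Unary.AllPairs as AllPairs
import Data.List.Relation.Unary.Any as Any
import Data.List.Relation.Unary.Unique.Propositional.Properties as Uniq
import Data.Maybe as Maybe
import Data.Nat as Nat
import Data.Sum as Sum
import Data.Vec as Vec

-- Finite sums and counting

-- The degree sum is used in three ways. Since the first degree is at most n - 1, the second is at
-- least k - 1, the degree of the second hub of the host. An inequality of Erdős-Gallai type makes
-- the k-th degree at least ⌊(k - 1)/2⌋ + 1, which is the largest degree of the host outside its two
-- hubs; the hosts are chosen to fit these two bounds. In the count of edges, finally, the excess of
-- a large degree is charged twice, nearly 2n for each such vertex, against a degree sum of about (k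
-- - 1)n: for large n two unrestricted degrees are affordable when k = 7, one when k = 4 or 5, none
-- when k = 3. Beyond this limit the obstacle is that the other end of a missing edge may have only
-- the few neighbours guaranteed by the lower bound. These then turn out to be adjacent to each
-- other and to all large vertices, and they take over the part of the hubs of the host. The edges
-- that must survive are collected in a graph T on the core; every switch deletes only edges outside
-- T, so the number of edges of T that are missing drops each time.

⟦_⟧ : Bool → ℕ
⟦ b ⟧ = if b then 1 else 0

⟦⟧≤1 : ∀ b → ⟦ b ⟧ ≤ 1
⟦⟧≤1 true  = ≤-refl
⟦⟧≤1 false = z≤n

∑ : ∀ {n} → (Fin n → ℕ) → ℕ
∑ f = Vec.sum (Vec.tabulate f)

∑-cong : ∀ {n} {f g : Fin n → ℕ} → (∀ i → f i ≡ g i) → ∑ f ≡ ∑ g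
∑-cong {zero}  _   = refl
∑-cong {suc n} f≡g = cong₂ _+_ (f≡g zero) (∑-cong (f≡g ∘ suc))

∑-distrib-+ : ∀ {n} (f g : Fin n → ℕ) → ∑ (λ i → f i + g i) ≡ ∑ f + ∑ g
∑-distrib-+ {zero}  f g = refl
∑-distrib-+ {suc n} f g =
  trans (cong (f zero + g zero +_) (∑-distrib-+ (f ∘ suc) (g ∘ suc))) (interchange (f zero) (g zero) _ _)
  where
  interchange : ∀ a b c d → a + b + (c + d) ≡ a + c + (b + d)
  interchange = solve-∀

∑-mono : ∀ {n} {f g : Fin n → ℕ} → (∀ i → f i ≤ g i) → ∑ f ≤ ∑ g
∑-mono {zero}  _   = z≤n
∑-mono {suc n} f≤g = +-mono-≤ (f≤g zero) (∑-mono (f≤g ∘ suc))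

∑-zero : ∀ {n} {f : Fin n → ℕ} → (∀ i → f i ≡ 0) → ∑ f ≡ 0
∑-zero {zero}  _   = refl
∑-zero {suc n} f≡0 = cong₂ _+_ (f≡0 zero) (∑-zero (f≡0 ∘ suc))

∑-const : ∀ n c → ∑ {n} (λ _ → c) ≡ n * c
∑-const zero    c = refl
∑-const (suc n) c = cong (c +_) (∑-const n c)

∑-comm : ∀ {m n} (f : Fin m → Fin n → ℕ) → ∑ (λ i → ∑ (f i)) ≡ ∑ (λ j → ∑ (λ i → f i j))
∑-comm {zero}  f = sym (∑-zero {f = λ j → ∑ (λ i → f i j)} (λ _ → refl))
∑-comm {suc m} f =
  trans (cong (∑ (f zero) +_) (∑-comm (f ∘ suc))) (sym (∑-distrib-+ (f zero) _))

∑-*ʳ : ∀ {n} (f : Fin n → ℕ) c → ∑ (λ i → f i * c) ≡ ∑ f * c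
∑-*ʳ {zero}  f c = refl
∑-*ʳ {suc n} f c = trans (cong (f zero * c +_) (∑-*ʳ (f ∘ suc) c)) (sym (*-distribʳ-+ c (f zero) _))

∑-split : ∀ k {m} (f : Fin (k + m) → ℕ) → ∑ f ≡ ∑ (λ i → f (i ↑ˡ m)) + ∑ (λ j → f (k ↑ʳ j))
∑-split zero    f = refl
∑-split (suc k) f = trans (cong (f zero +_) (∑-split k (f ∘ suc))) (sym (+-assoc (f zero) _ _))

∑-≟ : ∀ {n} (j : Fin n) → ∑ (λ i → ⟦ does (i ≟ j) ⟧) ≡ 1
∑-≟ {suc n} zero    = cong suc (∑-zero {n} λ _ → refl)
∑-≟ {suc n} (suc j) = ∑-≟ j

does-sym : ∀ {n} (i j : Fin n) → does (i ≟ j) ≡ does (j ≟ i)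
does-sym i j with i ≟ j
... | yes refl = sym (dec-true (j ≟ i) refl)
... | no  i≢j  = sym (dec-false (j ≟ i) (≢-sym i≢j))

-- Changing one value of a summand, stated without subtraction.
∑-update : ∀ {n} {f g : Fin n → ℕ} j → (∀ i → i ≢ j → f i ≡ g i) → ∑ g + f j ≡ ∑ f + g j
∑-update {suc n} {f} {g} zero eq
  rewrite ∑-cong {f = f ∘ suc} {g = g ∘ suc} (λ i → eq (suc i) λ ()) = lemma (g zero) (∑ (g ∘ suc)) (f zero)
  where
  lemma : ∀ a b c → a + b + c ≡ c + b + a
  lemma = solve-∀
∑-update {suc n} {f} {g} (suc j) eq rewrite eq zero (λ ()) =
  trans (+-assoc (g zero) _ _)
    (trans (cong (g zero +_) (∑-update j (λ i i≢j → eq (suc i) (i≢j ∘ suc-injective)))) (sym (+-assoc (g zero) _ _)))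

∑-<⇒∃ : ∀ {n} (f g : Fin n → ℕ) → ∑ f < ∑ g → ∃ λ i → f i < g i
∑-<⇒∃ f g f<g with any? (λ i → f i <? g i)
... | yes found = found
... | no ¬found = contradiction (∑-mono λ i → ≮⇒≥ (¬found ∘ (i ,_))) (<⇒≱ f<g)

module _ {n : ℕ} where
  open Data.List.Membership.DecPropositional (_≟_ {n}) using (_∈?_) public

  occ : List (Fin n) → Fin n → ℕ
  occ xs i = ⟦ does (i ∈? xs) ⟧

  occ-∈ : ∀ {xs i} → i ∈ xs → occ xs i ≡ 1
  occ-∈ {xs} {i} i∈ rewrite dec-true (i ∈? xs) i∈ = refl

  occ-∉ : ∀ {xs i} → i ∉ xs → occ xs i ≡ 0
  occ-∉ {xs} {i} i∉ rewrite dec-false (i ∈? xs) i∉ = refl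

  occ-∷ : ∀ x xs i → occ (x ∷ xs) i ≤ ⟦ does (i ≟ x) ⟧ + occ xs i
  occ-∷ x xs i with i ≟ x | i ∈? xs
  ... | yes _ | _     = s≤s z≤n
  ... | no _  | yes _ = ≤-refl
  ... | no _  | no _  = ≤-refl

  ∑-occ≤length : ∀ xs → ∑ (occ xs) ≤ length xs
  ∑-occ≤length []       = ≤-reflexive (∑-zero {f = occ []} λ _ → refl)
  ∑-occ≤length (x ∷ xs) = begin
    ∑ (occ (x ∷ xs))                                ≤⟨ ∑-mono (occ-∷ x xs) ⟩
    ∑ (λ i → ⟦ does (i ≟ x) ⟧ + occ xs i)        ≡⟨ ∑-distrib-+ (λ i → ⟦ does (i ≟ x) ⟧) (occ xs) ⟩
    ∑ (λ i → ⟦ does (i ≟ x) ⟧) + ∑ (occ xs)        ≡⟨ cong (_+ ∑ (occ xs)) (∑-≟ x) ⟩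
    suc (∑ (occ xs))                                ≤⟨ s≤s (∑-occ≤length xs) ⟩
    suc (length xs)                                 ∎
    where open ≤-Reasoning

  unique⇒length≤∑-occ : ∀ {xs} → Unique xs → length xs ≤ ∑ (occ xs)
  unique⇒length≤∑-occ []                           = z≤n
  unique⇒length≤∑-occ {x ∷ xs} (x≢xs ∷ xs!) = begin
    suc (length xs)                                 ≤⟨ s≤s (unique⇒length≤∑-occ xs!) ⟩
    suc (∑ (occ xs))                                ≡⟨ cong (_+ ∑ (occ xs)) (∑-≟ x) ⟨
    ∑ (λ i → ⟦ does (i ≟ x) ⟧) + ∑ (occ xs)        ≡⟨ ∑-distrib-+ (λ i → ⟦ does (i ≟ x) ⟧) (occ xs) ⟨
    ∑ (λ i → ⟦ does (i ≟ x) ⟧ + occ xs i)        ≤⟨ ∑-mono pointwise ⟩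
    ∑ (occ (x ∷ xs))                                ∎
    where
    open ≤-Reasoning
    pointwise : ∀ i → ⟦ does (i ≟ x) ⟧ + occ xs i ≤ occ (x ∷ xs) i
    pointwise i with i ≟ x
    ... | yes refl rewrite occ-∉ (λ x∈ → All.lookup x≢xs x∈ refl) = ≤-refl
    ... | no _ with i ∈? xs
    ... | yes _ = ≤-refl
    ... | no _  = ≤-refl

  pigeonhole : ∀ {xs ys} → Unique xs → All (_∈ ys) xs → length xs ≤ length ys
  pigeonhole {xs} {ys} xs! xs⊆ys =
    ≤-trans (unique⇒length≤∑-occ xs!) (≤-trans (∑-mono pointwise) (∑-occ≤length ys))
    where
    pointwise : ∀ i → occ xs i ≤ occ ys i
    pointwise i with i ∈? xs
    ... | yes i∈ = ≤-reflexive (sym (occ-∈ (All.lookup xs⊆ys i∈)))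
    ... | no _   = z≤n

-- Edge switches

Adj : ∀ {n} → Graph n → Fin n → Fin n → Set
Adj G i j = adj G i j ≡ true

adj? : ∀ {n} (G : Graph n) i j → Dec (Adj G i j)
adj? G i j = adj G i j Bool.≟ true

module _ {n : ℕ} where

  Adj-sym : (G : Graph n) → ∀ {i j} → Adj G i j → Adj G j i
  Adj-sym G {i} {j} = trans (adj-sym G j i)

  Adj⇒≢ : (G : Graph n) → ∀ {i j} → Adj G i j → i ≢ j
  Adj⇒≢ G {i} i~i refl = contradiction (trans (sym i~i) (irrefl G i)) λ ()

  ¬Adj⇒false : (G : Graph n) → ∀ {i j} → ¬ Adj G i j → adj G i j ≡ false
  ¬Adj⇒false G = ¬-not

  SameDeg : Graph n → Graph n → Set
  SameDeg G G′ = ∀ i → deg G′ i ≡ deg G i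

  private
    same : (p q i j : Fin n) → Bool
    same p q i j = (does (p ≟ i) ∧ does (q ≟ j)) ∨ (does (p ≟ j) ∧ does (q ≟ i))

    Same : (p q i j : Fin n) → Set
    Same p q i j = (p ≡ i × q ≡ j) ⊎ (p ≡ j × q ≡ i)

    same-flip : ∀ p q i j → same p q i j ≡ same q p i j
    same-flip p q i j = bool (does (p ≟ i)) (does (q ≟ j)) (does (p ≟ j)) (does (q ≟ i))
      where
      bool : ∀ a b c d → (a ∧ b) ∨ (c ∧ d) ≡ (d ∧ c) ∨ (b ∧ a)
      bool a b c d = trans (∨-comm (a ∧ b) _) (cong₂ _∨_ (∧-comm c d) (∧-comm a b))

    same-hit : ∀ i j → same i j i j ≡ true
    same-hit i j rewrite dec-true (i ≟ i) refl | dec-true (j ≟ j) refl = refl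

    same-miss : ∀ {p q i j} → ¬ Same p q i j → same p q i j ≡ false
    same-miss {p} {q} {i} {j} miss with p ≟ i | q ≟ j | p ≟ j | q ≟ i
    ... | yes a | yes b | _     | _     = contradiction (inj₁ (a , b)) miss
    ... | _     | _     | yes c | yes d = contradiction (inj₂ (c , d)) miss
    ... | no _  | _     | no _  | _     = refl
    ... | no _  | _     | yes _ | no _  = refl
    ... | yes _ | no _  | no _  | _     = refl
    ... | yes _ | no _  | yes _ | no _  = refl

  abstract
    setEdge : Graph n → (i j : Fin n) → i ≢ j → Bool → Graph n
    setEdge G i j i≢j b = record
      { adj    = λ p q → if same p q i j then b else adj G p q
      ; sym    = λ p q → cong₂ (if_then b else_) (same-flip p q i j) (adj-sym G p q)
      ; irrefl = λ p → trans (cong (if_then b else adj G p p) (same-miss (diagonal p))) (irrefl G p)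
      }
      where
      diagonal : ∀ p → ¬ Same p p i j
      diagonal p (inj₁ (refl , refl)) = i≢j refl
      diagonal p (inj₂ (refl , refl)) = i≢j refl

    setEdge-hit : ∀ G {i j} (i≢j : i ≢ j) b → adj (setEdge G i j i≢j b) i j ≡ b
    setEdge-hit G {i} {j} i≢j b rewrite same-hit i j = refl

    setEdge-miss : ∀ G {i j} (i≢j : i ≢ j) b {p q} → ¬ Same p q i j → adj (setEdge G i j i≢j b) p q ≡ adj G p q
    setEdge-miss G i≢j b miss rewrite same-miss miss = refl

    addEdge-keeps : ∀ G {i j} (i≢j : i ≢ j) {p q} → Adj G p q → Adj (setEdge G i j i≢j true) p q
    addEdge-keeps G {i} {j} i≢j {p} {q} p~q with same p q i j
    ... | true  = refl
    ... | false = p~q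

  module _ (G : Graph n) {i j : Fin n} (i≢j : i ≢ j) where

    private
      ends : Fin n → ℕ
      ends v = ⟦ does (v ≟ i) ⟧ + ⟦ does (v ≟ j) ⟧

    -- Free of subtraction and uniform in b: adding and deleting an edge are the cases in which the
    -- old value of the pair is false and true.
    deg-setEdge : ∀ b v → deg (setEdge G i j i≢j b) v + ends v * ⟦ adj G i j ⟧ ≡ deg G v + ends v * ⟦ b ⟧
    deg-setEdge b v = by-cases (v ≟ i) (v ≟ j)
      where
      G′ = setEdge G i j i≢j b
      at-end : ends v ≡ 1 → deg G′ v + ⟦ adj G i j ⟧ ≡ deg G v + ⟦ b ⟧ →
               deg G′ v + ends v * ⟦ adj G i j ⟧ ≡ deg G v + ends v * ⟦ b ⟧
      at-end ends≡1 eq = subst (λ e → deg G′ v + e * ⟦ adj G i j ⟧ ≡ deg G v + e * ⟦ b ⟧) (sym ends≡1)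
        (trans (cong (deg G′ v +_) (+-identityʳ _)) (trans eq (cong (deg G v +_) (sym (+-identityʳ _)))))
      by-cases : Dec (v ≡ i) → Dec (v ≡ j) → deg G′ v + ends v * ⟦ adj G i j ⟧ ≡ deg G v + ends v * ⟦ b ⟧
      by-cases (no v≢i) (no v≢j) =
        subst (λ e → deg G′ v + e * ⟦ adj G i j ⟧ ≡ deg G v + e * ⟦ b ⟧)
          (sym (cong₂ (λ c d → ⟦ c ⟧ + ⟦ d ⟧) (dec-false (v ≟ i) v≢i) (dec-false (v ≟ j) v≢j)))
          (cong (_+ 0) (∑-cong λ q → cong ⟦_⟧ (setEdge-miss G i≢j b (miss q))))
        where
        miss : ∀ q → ¬ Same v q i j
        miss q (inj₁ (v≡i , _)) = v≢i v≡i
        miss q (inj₂ (v≡j , _)) = v≢j v≡j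
      by-cases (yes refl) _ =
        at-end (cong₂ (λ c d → ⟦ c ⟧ + ⟦ d ⟧) (dec-true (v ≟ v) refl) (dec-false (v ≟ j) i≢j))
          (trans (∑-update j λ q q≢j → cong ⟦_⟧ (sym (setEdge-miss G i≢j b (miss q q≢j))))
            (cong (λ c → deg G v + ⟦ c ⟧) (setEdge-hit G i≢j b)))
        where
        miss : ∀ q → q ≢ j → ¬ Same v q v j
        miss q q≢j (inj₁ (_ , q≡j)) = q≢j q≡j
        miss q q≢j (inj₂ (v≡j , _)) = i≢j v≡j
      by-cases (no v≢i) (yes refl) =
        at-end (cong₂ (λ c d → ⟦ c ⟧ + ⟦ d ⟧) (dec-false (v ≟ i) v≢i) (dec-true (v ≟ v) refl))
          (trans (cong (λ c → deg G′ v + ⟦ c ⟧) (adj-sym G i v))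
            (trans (∑-update i λ q q≢i → cong ⟦_⟧ (sym (setEdge-miss G i≢j b (miss q q≢i))))
              (cong (λ c → deg G v + ⟦ c ⟧) (trans (adj-sym G′ v i) (setEdge-hit G i≢j b)))))
        where
        miss : ∀ q → q ≢ i → ¬ Same v q i v
        miss q q≢i (inj₁ (v≡i , _)) = i≢j (sym v≡i)
        miss q q≢i (inj₂ (_ , q≡i)) = q≢i q≡i

    deg-addEdge : ¬ Adj G i j → ∀ v → deg (setEdge G i j i≢j true) v ≡ deg G v + ends v
    deg-addEdge i≁j v = begin
      deg G⁺ v                           ≡⟨ +-identityʳ _ ⟨
      deg G⁺ v + 0                       ≡⟨ cong (deg G⁺ v +_) (*-zeroʳ (ends v)) ⟨
      deg G⁺ v + ends v * 0              ≡⟨ cong (λ c → deg G⁺ v + ends v * ⟦ c ⟧) (¬Adj⇒false G i≁j) ⟨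
      deg G⁺ v + ends v * ⟦ adj G i j ⟧  ≡⟨ deg-setEdge true v ⟩
      deg G v + ends v * 1               ≡⟨ cong (deg G v +_) (*-identityʳ (ends v)) ⟩
      deg G v + ends v                   ∎
      where
      open ≡-Reasoning
      G⁺ = setEdge G i j i≢j true

    deg-delEdge : Adj G i j → ∀ v → deg G v ≡ deg (setEdge G i j i≢j false) v + ends v
    deg-delEdge i~j v = begin
      deg G v                            ≡⟨ +-identityʳ _ ⟨
      deg G v + 0                        ≡⟨ cong (deg G v +_) (*-zeroʳ (ends v)) ⟨
      deg G v + ends v * 0               ≡⟨ deg-setEdge false v ⟨
      deg G⁻ v + ends v * ⟦ adj G i j ⟧  ≡⟨ cong (λ c → deg G⁻ v + ends v * ⟦ c ⟧) i~j ⟩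
      deg G⁻ v + ends v * 1              ≡⟨ cong (deg G⁻ v +_) (*-identityʳ (ends v)) ⟩
      deg G⁻ v + ends v                  ∎
      where
      open ≡-Reasoning
      G⁻ = setEdge G i j i≢j false

  -- T marks the edges of G that must survive.
  Gain : Graph n → Graph n → Fin n → Fin n → Set
  Gain T G u v = Σ (Graph n) λ G′ →
    SameDeg G G′ × (∀ {p q} → Adj T p q → Adj G p q → Adj G′ p q) × Adj G′ u v

  gain-sym : ∀ {T G u v} → Gain T G u v → Gain T G v u
  gain-sym (G′ , same , kept , u~v) = G′ , same , (λ {p} {q} → kept {p} {q}) , Adj-sym G′ u~v

  private
    avoids : (T : Graph n) → ∀ {i j p q} → ¬ Adj T i j → Adj T p q → ¬ Same p q i j
    avoids T i≁j p~q (inj₁ (refl , refl)) = i≁j p~q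
    avoids T i≁j p~q (inj₂ (refl , refl)) = i≁j (Adj-sym T p~q)

  module _ (T G : Graph n) {u v x y : Fin n} (u≢v : u ≢ v) (u≁v : ¬ Adj G u v)
    (u~x : Adj G u x) (ux∉T : ¬ Adj T u x) (v~y : Adj G v y) (vy∉T : ¬ Adj T v y) where

    private
      u≢x = Adj⇒≢ G u~x
      v≢y = Adj⇒≢ G v~y
      G₁ = setEdge G u x u≢x false
      G₂ = setEdge G₁ v y v≢y false
      vy≠ux : ¬ Same v y u x
      vy≠ux (inj₁ (v≡u , _))     = u≢v (sym v≡u)
      vy≠ux (inj₂ (refl , refl)) = u≁v u~x
      v~y₁ : Adj G₁ v y
      v~y₁ = trans (setEdge-miss G u≢x false vy≠ux) v~y

    switch₂ : x ≢ y → ¬ Adj G x y → Gain T G u v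
    switch₂ x≢y x≁y = G₄ , degrees , kept , addEdge-keeps G₃ x≢y (setEdge-hit G₂ u≢v true)
      where
      G₃ = setEdge G₂ u v u≢v true
      G₄ = setEdge G₃ x y x≢y true
      uv≠ux : ¬ Same u v u x
      uv≠ux (inj₁ (_ , refl)) = u≁v u~x
      uv≠ux (inj₂ (u≡x , _))  = u≢x u≡x
      uv≠vy : ¬ Same u v v y
      uv≠vy (inj₁ (u≡v , _))  = u≢v u≡v
      uv≠vy (inj₂ (refl , _)) = u≁v (Adj-sym G v~y)
      xy≠ux : ¬ Same x y u x
      xy≠ux (inj₁ (x≡u , _)) = u≢x (sym x≡u)
      xy≠ux (inj₂ (_ , refl)) = u≁v (Adj-sym G v~y)
      xy≠vy : ¬ Same x y v y
      xy≠vy (inj₁ (refl , _)) = u≁v u~x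
      xy≠vy (inj₂ (x≡y , _)) = x≢y x≡y
      xy≠uv : ¬ Same x y u v
      xy≠uv (inj₁ (x≡u , _))  = u≢x (sym x≡u)
      xy≠uv (inj₂ (refl , _)) = u≁v u~x
      u≁v₂ : ¬ Adj G₂ u v
      u≁v₂ = u≁v ∘ trans (sym (trans (setEdge-miss G₁ v≢y false uv≠vy) (setEdge-miss G u≢x false uv≠ux)))
      x≁y₃ : ¬ Adj G₃ x y
      x≁y₃ = x≁y ∘ trans (sym (trans (setEdge-miss G₂ u≢v true xy≠uv)
        (trans (setEdge-miss G₁ v≢y false xy≠vy) (setEdge-miss G u≢x false xy≠ux))))
      degrees : SameDeg G G₄
      -- Both degrees are expressed through G₂, the graph after all deletions, so that only
      -- additions remain to be compared.
      degrees i
        rewrite deg-addEdge G₃ x≢y x≁y₃ i | deg-addEdge G₂ u≢v u≁v₂ i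
              | deg-delEdge G u≢x u~x i | deg-delEdge G₁ v≢y v~y₁ i =
        rearrange (deg G₂ i) ⟦ does (i ≟ u) ⟧ ⟦ does (i ≟ v) ⟧ ⟦ does (i ≟ x) ⟧ ⟦ does (i ≟ y) ⟧
        where
        rearrange : ∀ d a b c e → d + (a + b) + (c + e) ≡ d + (b + e) + (a + c)
        rearrange = solve-∀
      kept : ∀ {p q} → Adj T p q → Adj G p q → Adj G₄ p q
      kept pq∈T p~q = addEdge-keeps G₃ x≢y (addEdge-keeps G₂ u≢v
        (trans (setEdge-miss G₁ v≢y false (avoids T vy∉T pq∈T))
          (trans (setEdge-miss G u≢x false (avoids T ux∉T pq∈T)) p~q)))

    switch₃ : ∀ {z w} → Adj G z w → ¬ Adj T z w → z ≢ x → ¬ Adj G x z → w ≢ y → ¬ Adj G y w → Gain T G u v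
    switch₃ {z} {w} z~w zw∉T z≢x x≁z w≢y y≁w =
      G₆ , degrees , kept ,
      addEdge-keeps G₅ (≢-sym w≢y) (addEdge-keeps G₄ (≢-sym z≢x) (setEdge-hit G₃ u≢v true))
      where
      z≢w = Adj⇒≢ G z~w
      G₃ = setEdge G₂ z w z≢w false
      G₄ = setEdge G₃ u v u≢v true
      G₅ = setEdge G₄ x z (≢-sym z≢x) true
      G₆ = setEdge G₅ y w (≢-sym w≢y) true
      untouched₃ : ∀ {p q} → ¬ Same p q u x → ¬ Same p q v y → ¬ Same p q z w → adj G₃ p q ≡ adj G p q
      untouched₃ ≠ux ≠vy ≠zw = trans (setEdge-miss G₂ z≢w false ≠zw)
        (trans (setEdge-miss G₁ v≢y false ≠vy) (setEdge-miss G u≢x false ≠ux))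
      zw≠ux : ¬ Same z w u x
      zw≠ux (inj₁ (refl , _)) = x≁z (Adj-sym G u~x)
      zw≠ux (inj₂ (z≡x , _))  = z≢x z≡x
      zw≠vy : ¬ Same z w v y
      zw≠vy (inj₁ (_ , w≡y))  = w≢y w≡y
      zw≠vy (inj₂ (_ , refl)) = y≁w (Adj-sym G v~y)
      -- The three deleted pairs are edges of G, so no non-edge of G is among them.
      untouched : ∀ {p q} → ¬ Adj G p q → ¬ Adj G₃ p q
      untouched p≁q p~q = absurd _ _ p≁q p~q
        where
        absurd : ∀ p q → ¬ Adj G p q → ¬ Adj G₃ p q
        absurd p q p≁q p~q = p≁q (trans (sym (untouched₃ ≠ux ≠vy ≠zw)) p~q)
          where
          ≠ux : ¬ Same p q u x
          ≠ux (inj₁ (refl , refl)) = p≁q u~x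
          ≠ux (inj₂ (refl , refl)) = p≁q (Adj-sym G u~x)
          ≠vy : ¬ Same p q v y
          ≠vy (inj₁ (refl , refl)) = p≁q v~y
          ≠vy (inj₂ (refl , refl)) = p≁q (Adj-sym G v~y)
          ≠zw : ¬ Same p q z w
          ≠zw (inj₁ (refl , refl)) = p≁q z~w
          ≠zw (inj₂ (refl , refl)) = p≁q (Adj-sym G z~w)
      xz≠uv : ¬ Same x z u v
      xz≠uv (inj₁ (x≡u , _))  = u≢x (sym x≡u)
      xz≠uv (inj₂ (refl , _)) = u≁v u~x
      yw≠uv : ¬ Same y w u v
      yw≠uv (inj₁ (refl , _)) = u≁v (Adj-sym G v~y)
      yw≠uv (inj₂ (y≡v , _))  = v≢y (sym y≡v)
      yw≠xz : ¬ Same y w x z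
      yw≠xz (inj₁ (_ , w≡z))     = z≢w (sym w≡z)
      yw≠xz (inj₂ (refl , refl)) = y≁w z~w
      z~w₂ : Adj G₂ z w
      z~w₂ = trans (setEdge-miss G₁ v≢y false zw≠vy) (trans (setEdge-miss G u≢x false zw≠ux) z~w)
      x≁z₄ : ¬ Adj G₄ x z
      x≁z₄ = untouched x≁z ∘ trans (sym (setEdge-miss G₃ u≢v true xz≠uv))
      y≁w₅ : ¬ Adj G₅ y w
      y≁w₅ = untouched y≁w ∘ trans (sym (trans (setEdge-miss G₄ (≢-sym z≢x) true yw≠xz) (setEdge-miss G₃ u≢v true yw≠uv)))
      degrees : SameDeg G G₆
      degrees i
        rewrite deg-addEdge G₅ (≢-sym w≢y) y≁w₅ i | deg-addEdge G₄ (≢-sym z≢x) x≁z₄ i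
              | deg-addEdge G₃ u≢v (untouched u≁v) i
              | deg-delEdge G u≢x u~x i | deg-delEdge G₁ v≢y v~y₁ i | deg-delEdge G₂ z≢w z~w₂ i =
        rearrange (deg G₃ i) ⟦ does (i ≟ u) ⟧ ⟦ does (i ≟ v) ⟧ ⟦ does (i ≟ x) ⟧ ⟦ does (i ≟ y) ⟧
                  ⟦ does (i ≟ z) ⟧ ⟦ does (i ≟ w) ⟧
        where
        rearrange : ∀ d a b c e f g →
          d + (a + b) + (c + f) + (e + g) ≡ d + (f + g) + (b + e) + (a + c)
        rearrange = solve-∀
      kept : ∀ {p q} → Adj T p q → Adj G p q → Adj G₆ p q
      kept pq∈T p~q = addEdge-keeps G₅ (≢-sym w≢y) (addEdge-keeps G₄ (≢-sym z≢x) (addEdge-keeps G₃ u≢v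
        (trans (untouched₃ (avoids T ux∉T pq∈T) (avoids T vy∉T pq∈T) (avoids T zw∉T pq∈T)) p~q)))

-- Neighbourhood counting

_>>=_ : {R A B : Set} → R ⊎ A → (A → R ⊎ B) → R ⊎ B
inj₁ r >>= f = inj₁ r
inj₂ a >>= f = f a

∑-mono-< : ∀ {n} {f g : Fin n → ℕ} j → (∀ i → f i ≤ g i) → f j < g j → ∑ f < ∑ g
∑-mono-< zero    f≤g f<g = +-mono-<-≤ f<g (∑-mono (f≤g ∘ suc))
∑-mono-< (suc j) f≤g f<g = +-mono-≤-< (f≤g zero) (∑-mono-< j (f≤g ∘ suc) f<g)

module _ {n : ℕ} (G : Graph n) where

  Near : Fin n → Fin n → Set
  Near y w = w ≡ y ⊎ Adj G y w

  near? : ∀ y w → Dec (Near y w)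
  near? y w = (w ≟ y) ⊎-dec (adj? G y w)

  near : Fin n → Fin n → ℕ
  near y w = ⟦ does (w ≟ y) ⟧ + ⟦ adj G y w ⟧

  near-pos : ∀ {y w} → Near y w → 1 ≤ near y w
  near-pos {y} (inj₁ refl) rewrite dec-true (y ≟ y) refl = s≤s z≤n
  near-pos {y} {w} (inj₂ y~w) rewrite y~w = m≤n+m 1 _

  near≤1 : ∀ y w → near y w ≤ 1
  near≤1 y w with w ≟ y
  ... | yes refl rewrite irrefl G y = ≤-refl
  ... | no _ = ⟦⟧≤1 _

  ∑-near : ∀ y → ∑ (near y) ≡ suc (deg G y)
  ∑-near y = trans (∑-distrib-+ (λ w → ⟦ does (w ≟ y) ⟧) _) (cong (_+ deg G y) (∑-≟ y))

  abstract
    -- ws and ws′ list vertices of E and of the closed neighbourhood of y that cannot be needed to cover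
    -- the neighbours of a.
    escape : ∀ a y {E ws ws′} → Unique ws → Unique ws′ →
      All (λ w → w ∈ E × ¬ Adj G a w) ws →
      All (λ w → Near y w × (¬ Adj G a w ⊎ w ∈ E)) ws′ →
      length E + suc (deg G y) < deg G a + (length ws + length ws′) →
      ∃ λ w → Adj G a w × w ∉ E × ¬ Near y w
    escape a y {E} {ws} {ws′} ws! ws′! inE inN bound = i , a~i , i∉E , i∉N
      where
      total : ∑ (λ i → occ E i + near y i) < ∑ (λ i → ⟦ adj G a i ⟧ + (occ ws i + occ ws′ i))
      total = begin-strict
        ∑ (λ i → occ E i + near y i)                          ≡⟨ ∑-distrib-+ (occ E) _ ⟩
        ∑ (occ E) + ∑ (near y)                                ≤⟨ +-mono-≤ (∑-occ≤length E) (≤-reflexive (∑-near y)) ⟩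
        length E + suc (deg G y)                              <⟨ bound ⟩
        deg G a + (length ws + length ws′)
          ≤⟨ +-monoʳ-≤ (deg G a) (+-mono-≤ (unique⇒length≤∑-occ ws!) (unique⇒length≤∑-occ ws′!)) ⟩
        deg G a + (∑ (occ ws) + ∑ (occ ws′))                  ≡⟨ cong (deg G a +_) (∑-distrib-+ (occ ws) _) ⟨
        deg G a + ∑ (λ i → occ ws i + occ ws′ i)              ≡⟨ ∑-distrib-+ (λ i → ⟦ adj G a i ⟧) _ ⟨
        ∑ (λ i → ⟦ adj G a i ⟧ + (occ ws i + occ ws′ i))      ∎
        where open ≤-Reasoning
      witness : ∃ λ i → occ E i + near y i < ⟦ adj G a i ⟧ + (occ ws i + occ ws′ i)
      witness = ∑-<⇒∃ _ _ total
      i : Fin n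
      i = proj₁ witness
      i< : occ E i + near y i < ⟦ adj G a i ⟧ + (occ ws i + occ ws′ i)
      i< = proj₂ witness
      occ-ws≤ : occ ws i ≤ occ E i
      occ-ws≤ with i ∈? ws
      ... | yes i∈ = ≤-reflexive (sym (occ-∈ (proj₁ (All.lookup inE i∈))))
      ... | no _   = z≤n
      occ-ws′≤ : occ ws′ i ≤ near y i
      occ-ws′≤ with i ∈? ws′
      ... | yes i∈ = near-pos (proj₁ (All.lookup inN i∈))
      ... | no _   = z≤n
      a~i : Adj G a i
      a~i with adj G a i in eq
      ... | true  = refl
      -- Without adjacency to a, only `ws` and `ws′` would count on the right, and their terms are
      -- dominated by those of E and of N[y].
      ... | false = contradiction (+-mono-≤ occ-ws≤ occ-ws′≤)
                      (<⇒≱ (subst (λ b → occ E i + near y i < ⟦ b ⟧ + (occ ws i + occ ws′ i)) eq i<))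
      i∉ws : i ∉ ws
      i∉ws i∈ = proj₂ (All.lookup inE i∈) a~i
      i<′ : occ E i + near y i < 1 + occ ws′ i
      i<′ = subst₂ (λ b o → occ E i + near y i < ⟦ b ⟧ + (o + occ ws′ i)) a~i (occ-∉ i∉ws) i<
      i∉E : i ∉ E
      i∉E i∈E = contradiction (+-monoʳ-≤ 1 occ-ws′≤) (<⇒≱ (subst (λ o → o + near y i < 1 + occ ws′ i) (occ-∈ i∈E) i<′))
      i∉ws′ : i ∉ ws′
      i∉ws′ i∈ with proj₂ (All.lookup inN i∈)
      ... | inj₁ a≁i = a≁i a~i
      ... | inj₂ i∈E = i∉E i∈E
      i∉N : ¬ Near y i
      i∉N i∈N = contradiction (≤-trans (near-pos i∈N) (m≤n+m _ (occ E i)))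
        (<⇒≱ (subst (λ o → occ E i + near y i < 1 + o) (occ-∉ i∉ws′) i<′))

    -- At most length E - length ws neighbours of u can lie in E, because `ws` lists members of E
    -- that are not adjacent to u.
    pick : ∀ u {E ws} → Unique ws → All (λ w → w ∈ E × ¬ Adj G u w) ws →
      length E < deg G u + length ws → ∃ λ x → Adj G u x × x ∉ E
    pick u {E} {ws} ws! inE bound = i , u~i , i∉E
      where
      total : ∑ (occ E) < ∑ (λ i → ⟦ adj G u i ⟧ + occ ws i)
      total = begin-strict
        ∑ (occ E)                              ≤⟨ ∑-occ≤length E ⟩
        length E                               <⟨ bound ⟩
        deg G u + length ws                    ≤⟨ +-monoʳ-≤ (deg G u) (unique⇒length≤∑-occ ws!) ⟩
        deg G u + ∑ (occ ws)                   ≡⟨ ∑-distrib-+ (λ i → ⟦ adj G u i ⟧) _ ⟨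
        ∑ (λ i → ⟦ adj G u i ⟧ + occ ws i)     ∎
        where open ≤-Reasoning
      witness : ∃ λ i → occ E i < ⟦ adj G u i ⟧ + occ ws i
      witness = ∑-<⇒∃ _ _ total
      i : Fin n
      i = proj₁ witness
      i< : occ E i < ⟦ adj G u i ⟧ + occ ws i
      i< = proj₂ witness
      occ-ws≤ : occ ws i ≤ occ E i
      occ-ws≤ with i ∈? ws
      ... | yes i∈ = ≤-reflexive (sym (occ-∈ (proj₁ (All.lookup inE i∈))))
      ... | no _   = z≤n
      u~i : Adj G u i
      u~i with adj G u i in eq
      ... | true  = refl
      ... | false = contradiction occ-ws≤ (<⇒≱ (subst (λ b → occ E i < ⟦ b ⟧ + occ ws i) eq i<))
      i∉E : i ∉ E
      i∉E i∈E = contradiction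
        (subst₂ (λ b o → 1 < ⟦ b ⟧ + o) u~i (occ-∉ λ i∈ → proj₂ (All.lookup inE i∈) u~i)
          (subst (_< ⟦ adj G u i ⟧ + occ ws i) (occ-∈ i∈E) i<))
        (n≮n 1)

    picks : ∀ c u {E ws} → Unique ws → All (λ w → w ∈ E × ¬ Adj G u w) ws →
      length E + c ≤ deg G u + length ws →
      ∃ λ xs → length xs ≡ c × Unique xs × All (Adj G u) xs × All (_∉ E) xs
    picks zero    u ws! inE bound = [] , refl , [] , [] , []
    picks (suc c) u {E} ws! inE bound =
      let x , u~x , x∉E = pick u ws! inE (≤-trans (≤-trans (s≤s (m≤m+n (length E) c)) (≤-reflexive (sym (+-suc _ c)))) bound)
          xs , len , xs! , u~xs , xs∉ = picks c u ws! (All.map (λ (w∈ , u≁w) → there w∈ , u≁w) inE)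
            (≤-trans (≤-reflexive (sym (+-suc (length E) c))) bound)
      in x ∷ xs , cong suc len , All.map (λ z∉ x≡z → z∉ (here (sym x≡z))) xs∉ ∷ xs! , u~x ∷ u~xs ,
         x∉E ∷ All.map (_∘ there) xs∉

  near-unique : ∀ y {zs} → Unique zs → All (Near y) zs → length zs ≤ suc (deg G y)
  near-unique y {zs} zs! near-zs =
    ≤-trans (unique⇒length≤∑-occ zs!) (≤-trans (∑-mono pointwise) (≤-reflexive (∑-near y)))
    where
    pointwise : ∀ i → occ zs i ≤ near y i
    pointwise i with i ∈? zs
    ... | yes i∈ = near-pos (All.lookup near-zs i∈)
    ... | no _   = z≤n

  unique⇒≤deg : ∀ y {zs} → Unique zs → All (Adj G y) zs → length zs ≤ deg G y
  unique⇒≤deg y zs! y~zs with near-unique y {y ∷ _} (All.map (Adj⇒≢ G) y~zs ∷ zs!) (inj₁ refl ∷ All.map inj₂ y~zs)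
  ... | s≤s le = le

  clique? : ∀ {xs} → Unique xs →
    AllPairs (Adj G) xs ⊎ (∃₂ λ x x′ → x ∈ xs × x′ ∈ xs × x ≢ x′ × ¬ Adj G x x′)
  clique? [] = inj₁ []
  clique? {x ∷ xs} (x≢ ∷ xs!) with clique? xs! | All.all? (adj? G x) xs
  ... | inj₂ (p , q , p∈ , q∈ , rest) | _ = inj₂ (p , q , there p∈ , there q∈ , rest)
  ... | inj₁ clique | yes x~xs = inj₁ (x~xs ∷ clique)
  ... | inj₁ clique | no ¬x~xs with find (AllP.¬All⇒Any¬ (adj? G x) xs ¬x~xs)
  ... | z , z∈ , x≁z = inj₂ (x , z , here refl , there z∈ , All.lookup x≢ z∈ , x≁z)

  -- A subgraph K_c ∨ z K_1 inside Q.
  record Join (Q : Fin n → Set) (c z : ℕ) : Set where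
    constructor join
    field
      centre rim  : List (Fin n)
      ∣centre∣    : length centre ≡ c
      ∣rim∣       : length rim ≡ z
      clique      : AllPairs (Adj G) centre
      rim!        : Unique rim
      joined      : All (λ r → All (Adj G r) centre) rim
      Q-centre    : All Q centre
      Q-rim       : All Q rim

clique-adj : ∀ {n} (G : Graph n) {xs p q} → AllPairs (Adj G) xs → p ∈ xs → q ∈ xs → p ≢ q → Adj G p q
clique-adj G (x~ ∷ _) (here refl) (here refl) p≢q = contradiction refl p≢q
clique-adj G (x~ ∷ _) (here refl) (there q∈)  p≢q = All.lookup x~ q∈
clique-adj G (x~ ∷ _) (there p∈)  (here refl) p≢q = Adj-sym G (All.lookup x~ p∈)
clique-adj G (_ ∷ cl) (there p∈)  (there q∈)  p≢q = clique-adj G cl p∈ q∈ p≢q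

pairwise : ∀ {n} {R : Fin n → Fin n → Set} {xs} → Unique xs →
  (∀ {p q} → p ∈ xs → q ∈ xs → p ≢ q → R p q) → AllPairs R xs
pairwise []          r = []
pairwise (x≢ ∷ xs!) r =
  All.tabulate (λ q∈ → r (here refl) (there q∈) (All.lookup x≢ q∈)) ∷ pairwise xs! (λ p∈ q∈ → r (there p∈) (there q∈))

∈-take : {A : Set} → ∀ k {x : A} (zs : List A) → x ∈ take k zs → x ∈ zs
∈-take (suc k) (z ∷ zs) (here eq)  = here eq
∈-take (suc k) (z ∷ zs) (there x∈) = there (∈-take k zs x∈)
∈-drop : {A : Set} → ∀ k {x : A} (zs : List A) → x ∈ drop k zs → x ∈ zs
∈-drop zero    zs       x∈ = x∈
∈-drop (suc k) (z ∷ zs) x∈ = there (∈-drop k zs x∈)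
∣take∣ : {A : Set} → ∀ k (zs : List A) → k ≤ length zs → length (take k zs) ≡ k
∣take∣ k zs le = trans (length-take k zs) (m≤n⇒m⊓n≡m le)

∈-take-drop : {A : Set} → ∀ k {zs} {p q : A} → Unique zs → p ∈ drop k zs → q ∈ take k zs → p ≢ q
∈-take-drop (suc k) {z ∷ zs} (z≢ ∷ _)  p∈ (here refl) p≡q = All.lookup z≢ (∈-drop k zs p∈) (sym p≡q)
∈-take-drop (suc k) {z ∷ zs} (_ ∷ zs!) p∈ (there q∈)      = ∈-take-drop k zs! p∈ q∈

-- Any c vertices of the clique form the centre; the other e are independent of the choice and serve
-- as rim vertices together with u and y.
clique-join : ∀ {n} {G : Graph n} {Q : Fin n → Set} c e {xs u y} → length xs ≡ c + e → Unique xs → AllPairs (Adj G) xs →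
  All (Adj G u) xs → y ∉ xs → u ≢ y → All (Adj G y) xs → Q u → All Q xs → Q y → Join G Q c (2 + e)
clique-join {G = G} c e {xs} {u} {y} ∣xs∣ xs! clique u~xs y∉xs u≢y y~xs Qu Qxs Qy = record
  { centre   = take c xs
  ; rim      = u ∷ y ∷ drop c xs
  ; ∣centre∣ = ∣take∣ c xs (≤-trans (m≤m+n c e) (≤-reflexive (sym ∣xs∣)))
  ; ∣rim∣    = cong (2 +_) (trans (length-drop c xs) (trans (cong (_∸ c) ∣xs∣) (m+n∸m≡n c e)))
  ; clique   = pairwise (Uniq.take⁺ c xs!) λ p∈ q∈ → clique-adj G clique (∈-take c xs p∈) (∈-take c xs q∈)
  ; rim!     = (u≢y ∷ All.tabulate (λ x∈ → Adj⇒≢ G (All.lookup u~xs (∈-drop c xs x∈))))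
               ∷ All.tabulate (λ x∈ y≡x → y∉xs (subst (_∈ xs) (sym y≡x) (∈-drop c xs x∈)))
               ∷ Uniq.drop⁺ c xs!
  ; joined   = All.tabulate (λ x∈ → All.lookup u~xs (∈-take c xs x∈))
               ∷ All.tabulate (λ x∈ → All.lookup y~xs (∈-take c xs x∈))
               ∷ All.tabulate (λ p∈ → All.tabulate λ q∈ →
                   clique-adj G clique (∈-drop c xs p∈) (∈-take c xs q∈) (∈-take-drop c xs! p∈ q∈))
  ; Q-centre = All.tabulate (λ x∈ → All.lookup Qxs (∈-take c xs x∈))
  ; Q-rim    = Qu ∷ Qy ∷ All.tabulate (λ x∈ → All.lookup Qxs (∈-drop c xs x∈))
  }

all-try : {R : Set} {A : Set} {P : A → Set} (xs : List A) → (∀ {x} → x ∈ xs → R ⊎ P x) → R ⊎ All P xs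
all-try []       f = inj₂ []
all-try (x ∷ xs) f = f (here refl) >>= λ px → all-try xs (f ∘ there) >>= λ pxs → inj₂ (px ∷ pxs)

-- Neighbourhoods of a non-adjacent pair when every switch fails

module Dense {n : ℕ} (T G : Graph n) {u v : Fin n} (u≢v : u ≢ v) (u≁v : ¬ Adj G u v)
  {R : Set} (gain : Gain T G u v → R) where

  Complete : List (Fin n) → List (Fin n) → Set
  Complete xs ys = ∀ {x y} → x ∈ xs → y ∈ ys → x ≡ y ⊎ Adj G x y

  -- A missing pair x y allows `switch₂`. If both lists contain non-adjacent pairs x, x′ and y, y′,
  -- the edge x′y′ is the third edge of `switch₃`. As x′y′ must be outside T as well, the members of
  -- `xs` have to avoid T altogether, while for `ys` only the edges from v matter.
  complete-clique : ∀ {xs ys} → Unique xs → Unique ys → All (Adj G u) xs → All (Adj G v) ys →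
    All (λ x → ∀ q → ¬ Adj T x q) xs → All (λ y → ¬ Adj T v y) ys →
    R ⊎ (Complete xs ys × (AllPairs (Adj G) xs ⊎ AllPairs (Adj G) ys))
  complete-clique {xs} {ys} xs! ys! u~xs v~ys xs-free ys-free =
    all-try xs (λ x∈ → all-try ys (λ y∈ → matched x∈ y∈)) >>= λ m →
      let complete = λ {x} {y} (x∈ : x ∈ xs) (y∈ : y ∈ ys) → All.lookup (All.lookup m x∈) y∈
      in case (clique? G xs! , clique? G ys!) of λ where
        (inj₁ cl , _)      → inj₂ (complete , inj₁ cl)
        (inj₂ _ , inj₁ cl) → inj₂ (complete , inj₂ cl)
        (inj₂ (x , x′ , x∈ , x′∈ , x≢x′ , x≁x′) , inj₂ (y , y′ , y∈ , y′∈ , y≢y′ , y≁y′)) →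
          inj₁ (gain (twoPairs complete x∈ x′∈ x≢x′ x≁x′ y∈ y′∈ y≢y′ y≁y′))
    where
    ux-free : ∀ {x} → x ∈ xs → ¬ Adj T u x
    ux-free x∈ = All.lookup xs-free x∈ u ∘ Adj-sym T
    matched : ∀ {x y} → x ∈ xs → y ∈ ys → R ⊎ (x ≡ y ⊎ Adj G x y)
    matched {x} {y} x∈ y∈ with x ≟ y | adj? G x y
    ... | yes x≡y | _       = inj₂ (inj₁ x≡y)
    ... | no _    | yes x~y = inj₂ (inj₂ x~y)
    ... | no x≢y  | no x≁y  = inj₁ (gain (switch₂ T G u≢v u≁v (All.lookup u~xs x∈) (ux-free x∈)
            (All.lookup v~ys y∈) (All.lookup ys-free y∈) x≢y x≁y))
    twoPairs : Complete xs ys → ∀ {x x′ y y′} → x ∈ xs → x′ ∈ xs → x ≢ x′ → ¬ Adj G x x′ →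
      y ∈ ys → y′ ∈ ys → y ≢ y′ → ¬ Adj G y y′ → Gain T G u v
    twoPairs complete {x} {x′} {y} {y′} x∈ x′∈ x≢x′ x≁x′ y∈ y′∈ y≢y′ y≁y′ =
      switch₃ T G u≢v u≁v (All.lookup u~xs x∈) (ux-free x∈) (All.lookup v~ys y∈) (All.lookup ys-free y∈)
        x′~y′ (All.lookup xs-free x′∈ y′) (≢-sym x≢x′) x≁x′ (≢-sym y≢y′) y≁y′
      where
      -- If x′ = y′, completeness applied to x and y′ would give x = x′ or make x adjacent to x′.
      x′~y′ : Adj G x′ y′
      x′~y′ with complete x′∈ y′∈ | complete x∈ y′∈
      ... | inj₂ adjacent | _         = adjacent
      ... | inj₁ refl     | inj₁ x≡x′ = contradiction x≡x′ x≢x′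
      ... | inj₁ refl     | inj₂ x~x′ = contradiction x~x′ x≁x′

  -- If `ys` lies in `xs`, it is a clique in either case and is the centre, with u, v and e members
  -- of `xs` outside `ys` as rim. Otherwise some y lies outside `xs`. If `xs` is the clique, y and u
  -- are both joined to all of it. If `ys` is, then at most c - 1 members of `xs` are in `ys`, and
  -- the e + 1 remaining ones form the rim together with v.
  dense : ∀ {Q : Fin n → Set} c e {xs ys} → length xs ≡ c + e → length ys ≡ c →
    Unique xs → Unique ys → All (Adj G u) xs → All (Adj G v) ys →
    All (λ x → ∀ q → ¬ Adj T x q) xs → All (λ y → ¬ Adj T v y) ys →
    Q u → Q v → All Q xs → All Q ys → R ⊎ Join G Q c (2 + e)
  dense {Q} c e {xs} {ys} ∣xs∣ ∣ys∣ xs! ys! u~xs v~ys xs-free ys-free Qu Qv Qxs Qys =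
    complete-clique xs! ys! u~xs v~ys xs-free ys-free >>= λ where
      (complete , cl) → inj₂ (found complete cl (All.all? (_∈? xs) ys))
    where
    u∉ys : u ∉ ys
    u∉ys u∈ = u≁v (Adj-sym G (All.lookup v~ys u∈))
    v∉xs : v ∉ xs
    v∉xs v∈ = u≁v (All.lookup u~xs v∈)
    u≢xs : All (u ≢_) xs
    u≢xs = All.map (Adj⇒≢ G) u~xs
    spare : List (Fin n)
    spare = filter (λ x → ¬? (x ∈? ys)) xs
    spare! : Unique spare
    spare! = Uniq.filter⁺ (λ x → ¬? (x ∈? ys)) xs!
    spare⊆ : ∀ {x} → x ∈ spare → x ∈ xs × x ∉ ys
    spare⊆ = ∈-filter⁻ (λ x → ¬? (x ∈? ys))
    spare-size : ∀ {ws} → All (λ x → x ∈ ys → x ∈ ws) xs → c + e ≤ length spare + length ws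
    spare-size {ws} covers = begin
      c + e                     ≡⟨ ∣xs∣ ⟨
      length xs                 ≤⟨ pigeonhole {ys = spare ++ ws} xs! (All.tabulate place) ⟩
      length (spare ++ ws)      ≡⟨ length-++ spare ⟩
      length spare + length ws  ∎
      where
      open ≤-Reasoning
      place : ∀ {x} → x ∈ xs → x ∈ spare ++ ws
      place {x} x∈ with x ∈? ys
      ... | yes x∈ys = ∈-++⁺ʳ spare (All.lookup covers x∈ x∈ys)
      ... | no x∉ys  = ∈-++⁺ˡ (∈-filter⁺ (λ x → ¬? (x ∈? ys)) x∈ x∉ys)

    found : Complete xs ys → AllPairs (Adj G) xs ⊎ AllPairs (Adj G) ys → Dec (All (_∈ xs) ys) → Join G Q c (2 + e)
    found complete cl (yes ys⊆xs) = record
      { centre   = ys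
      ; rim      = u ∷ v ∷ take e spare
      ; ∣centre∣ = ∣ys∣
      ; ∣rim∣    = cong (2 +_) (∣take∣ e spare e≤)
      ; clique   = ys-clique cl
      ; rim!     = (u≢v ∷ All.tabulate (λ x∈ u≡x → All.lookup u≢xs (proj₁ (rest x∈)) u≡x))
                   ∷ All.tabulate (λ x∈ v≡x → v∉xs (subst (_∈ xs) (sym v≡x) (proj₁ (rest x∈))))
                   ∷ Uniq.take⁺ e spare!
      ; joined   = All.map (All.lookup u~xs) ys⊆xs ∷ v~ys ∷ All.tabulate (λ x∈ → beside (rest x∈))
      ; Q-centre = Qys
      ; Q-rim    = Qu ∷ Qv ∷ All.tabulate (λ x∈ → All.lookup Qxs (proj₁ (rest x∈)))
      }
      where
      e≤ : e ≤ length spare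
      e≤ = +-cancelˡ-≤ c _ _ (≤-trans (spare-size {ys} (All.tabulate λ _ y∈ → y∈))
             (≤-reflexive (trans (cong (length spare +_) ∣ys∣) (+-comm _ c))))
      rest : ∀ {x} → x ∈ take e spare → x ∈ xs × x ∉ ys
      rest x∈ = spare⊆ (∈-take e spare x∈)
      ys-clique : AllPairs (Adj G) xs ⊎ AllPairs (Adj G) ys → AllPairs (Adj G) ys
      ys-clique (inj₁ xs-clique) =
        pairwise ys! λ p∈ q∈ → clique-adj G xs-clique (All.lookup ys⊆xs p∈) (All.lookup ys⊆xs q∈)
      ys-clique (inj₂ clique) = clique
      beside : ∀ {x} → x ∈ xs × x ∉ ys → All (Adj G x) ys
      beside (x∈ , x∉) = All.tabulate λ y∈ → case complete x∈ y∈ of λ where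
        (inj₁ refl) → contradiction y∈ x∉
        (inj₂ x~y)  → x~y
    found complete cl (no ¬ys⊆xs) with find (AllP.¬All⇒Any¬ (_∈? xs) ys ¬ys⊆xs)
    found complete (inj₁ clique) (no _) | y , y∈ , y∉xs =
      clique-join c e ∣xs∣ xs! clique u~xs y∉xs (λ u≡y → u∉ys (subst (_∈ ys) (sym u≡y) y∈)) y~xs Qu Qxs (All.lookup Qys y∈)
      where
      y~xs : All (Adj G y) xs
      y~xs = All.tabulate λ x∈ → case complete x∈ y∈ of λ where
        (inj₁ refl) → contradiction x∈ y∉xs
        (inj₂ x~y)  → Adj-sym G x~y
    found complete (inj₂ clique) (no _) | y , y∈ , y∉xs = record
      { centre   = ys
      ; rim      = v ∷ take (suc e) spare
      ; ∣centre∣ = ∣ys∣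
      ; ∣rim∣    = cong suc (∣take∣ (suc e) spare e<)
      ; clique   = clique
      ; rim!     = All.tabulate (λ x∈ v≡x → v∉xs (subst (_∈ xs) (sym v≡x) (proj₁ (rest x∈)))) ∷ Uniq.take⁺ (suc e) spare!
      ; joined   = v~ys ∷ All.tabulate (λ x∈ → beside (rest x∈))
      ; Q-centre = Qys
      ; Q-rim    = Qv ∷ All.tabulate (λ x∈ → All.lookup Qxs (proj₁ (rest x∈)))
      }
      where
      -- Removing y from `ys` loses nothing of its intersection with `xs`, which gains the one extra
      -- rim vertex.
      others : List (Fin n)
      others = filter (λ z → ¬? (z ≟ y)) ys
      ∣others∣ : length others < c
      ∣others∣ = ≤-trans (filter-notAll (λ z → ¬? (z ≟ y)) ys (Any.map (λ y≡z z≢y → z≢y (sym y≡z)) y∈)) (≤-reflexive ∣ys∣)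
      e< : e < length spare
      e< = +-cancelˡ-≤ c _ _ (begin
        c + suc e                       ≡⟨ +-suc c e ⟩
        suc (c + e)                     ≤⟨ s≤s (spare-size {others} (All.tabulate λ {x} x∈ x∈ys →
                                             ∈-filter⁺ (λ z → ¬? (z ≟ y)) x∈ys λ x≡y → y∉xs (subst (_∈ xs) x≡y x∈))) ⟩
        suc (length spare + length others)  ≡⟨ +-suc _ _ ⟨
        length spare + suc (length others)  ≤⟨ +-monoʳ-≤ (length spare) ∣others∣ ⟩
        length spare + c                ≡⟨ +-comm _ c ⟩
        c + length spare                ∎)
        where open ≤-Reasoning
      rest : ∀ {x} → x ∈ take (suc e) spare → x ∈ xs × x ∉ ys
      rest x∈ = spare⊆ (∈-take (suc e) spare x∈)
      beside : ∀ {x} → x ∈ xs × x ∉ ys → All (Adj G x) ys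
      beside (x∈ , x∉) = All.tabulate λ y∈ → case complete x∈ y∈ of λ where
        (inj₁ refl) → contradiction y∈ x∉
        (inj₂ x~y)  → x~y

-- Here Out is the complement of the vertex set of T, and the neighbours of u and of v inside that set
-- are c and vertices satisfying As. If the switches creating uv all fail, a vertex x ∈ Out adjacent to u
-- is adjacent to all neighbours of v except possibly c; as it has no larger degree than v, it is
-- not adjacent to c, and the same holds with u and v exchanged. An edge from c to Out can then be used in a
-- switch.
module Final {n : ℕ} (T G : Graph n) {R : Set} (Out As : Fin n → Set)
  (free : ∀ {x} → Out x → ∀ q → ¬ Adj T x q) (c : Fin n) (c∉Out : ¬ Out c) where

  record Side (r : Fin n) : Set where
    field
      r∉Out : ¬ Out r
      r~c   : Adj G r c
      split : ∀ p → Adj G r p → (As p ⊎ p ≡ c) ⊎ Out p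
      small : ∀ x → Out x → deg G x ≤ deg G r
      As-adj : ∀ x p → Out x → Adj G r x → As p → R ⊎ Adj G x p

  free′ : ∀ {x} → Out x → ∀ q → ¬ Adj T q x
  free′ x∈ q = free x∈ q ∘ Adj-sym T

  -- N[y] contains three vertices that are no use for covering the neighbours of r other than c: g,
  -- v, and e, which is r if y ~ r and y otherwise. As deg y ≤ deg r, a neighbour p ≠ c of r escapes
  -- from N[y]. It is not in `As`, whose neighbours of r are adjacent to y, so it is in `Out` and
  -- allows a two-edge switch.
  excess : ∀ {r v} → r ≢ v → ¬ Adj G r v → (Gain T G r v → R) → Side r → Side v →
    ∀ {y g} → Out y → Adj G v y → Adj G y g → (¬ Adj G r g ⊎ g ≡ c) → g ≢ v → g ≢ r → R
  excess {r} {v} r≢v r≁v gain sr sv {y} {g} y∈ v~y y~g rg g≢v g≢r =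
    case escape G r y {E = c ∷ []} {ws = []} [] ws! []
           ((inj₂ y~g , Sum.map id here rg) ∷ (inj₂ (Adj-sym G v~y) , inj₁ r≁v) ∷ e-near ∷ []) bound of λ where
      (p , r~p , p∉c , ¬near) → case Side.split sr p r~p of λ where
        (inj₁ (inj₁ p∈As)) → case Side.As-adj sv y p y∈ v~y p∈As of λ where
          (inj₁ win) → win
          (inj₂ y~p) → contradiction (inj₂ y~p) ¬near
        (inj₁ (inj₂ p≡c)) → contradiction (here p≡c) p∉c
        (inj₂ p∈) → gain (switch₂ T G r≢v r≁v r~p (free′ p∈ r) v~y (free′ y∈ v)
          (¬near ∘ inj₁) (¬near ∘ inj₂ ∘ Adj-sym G))
    where
    e : Fin n
    e = if adj G y r then r else y
    e≢v : e ≢ v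
    e≢v with adj G y r
    ... | true  = r≢v
    ... | false = ≢-sym (Adj⇒≢ G v~y)
    e≢g : g ≢ e
    e≢g with adj G y r
    ... | true  = g≢r
    ... | false = ≢-sym (Adj⇒≢ G y~g)
    e-near : Near G y e × (¬ Adj G r e ⊎ e ∈ c ∷ [])
    e-near with adj G y r in eq
    ... | true  = inj₂ eq , inj₁ λ r~r → Adj⇒≢ G r~r refl
    ... | false = inj₁ refl , inj₁ λ r~y → contradiction (trans (sym (Adj-sym G r~y)) eq) λ ()
    ws! : Unique (g ∷ v ∷ e ∷ [])
    ws! = (g≢v ∷ e≢g ∷ []) ∷ (≢-sym e≢v ∷ []) ∷ [] ∷ []
    bound : 1 + suc (deg G y) < deg G r + 3
    bound = ≤-trans (s≤s (s≤s (s≤s (Side.small sr y y∈)))) (≤-reflexive (+-comm 3 (deg G r)))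

  final : ∀ {r v} → r ≢ v → ¬ Adj G r v → (Gain T G r v → R) → Side r → Side v →
    ∀ {x y w} → Out x → Adj G r x → Out y → Adj G v y → Out w → Adj G c w → R
  final {r} {v} r≢v r≁v gain sr sv {x} {y} {w} x∈ r~x y∈ v~y w∈ c~w
    with adj? G y c | adj? G x c | near? G y w
  ... | yes y~c | _ | _ =
    excess r≢v r≁v gain sr sv y∈ v~y y~c (inj₂ refl) (Adj⇒≢ G (Adj-sym G (Side.r~c sv))) (Adj⇒≢ G (Adj-sym G (Side.r~c sr)))
  ... | no _ | yes x~c | _ =
    excess (≢-sym r≢v) (r≁v ∘ Adj-sym G) (λ g → gain (gain-sym {T = T} {G} g)) sv sr x∈ r~x x~c (inj₂ refl)
      (Adj⇒≢ G (Adj-sym G (Side.r~c sr))) (Adj⇒≢ G (Adj-sym G (Side.r~c sv)))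
  ... | no y≁c | no _ | yes (inj₁ refl) = contradiction (Adj-sym G c~w) y≁c
  ... | no y≁c | no x≁c | no ¬near =
    gain (switch₃ T G r≢v r≁v r~x (free′ x∈ r) v~y (free′ y∈ v) c~w (free′ w∈ c)
      (λ c≡x → c∉Out (subst Out (sym c≡x) x∈)) x≁c (¬near ∘ inj₁) (¬near ∘ inj₂))
  -- The edge y w blocks the three-edge switch. If w is not adjacent to r, it is a surplus neighbour
  -- of y; if it is, then w itself is a neighbour of r in `Out` that is adjacent to c.
  ... | no y≁c | no _ | yes (inj₂ y~w) with adj? G r w
  ... | no r≁w = excess r≢v r≁v gain sr sv y∈ v~y y~w (inj₁ r≁w)
    (λ w≡v → Side.r∉Out sv (subst Out w≡v w∈)) (λ w≡r → Side.r∉Out sr (subst Out w≡r w∈))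
  ... | yes r~w =
    excess (≢-sym r≢v) (r≁v ∘ Adj-sym G) (λ g → gain (gain-sym {T = T} {G} g)) sv sr w∈ r~w (Adj-sym G c~w) (inj₂ refl)
      (Adj⇒≢ G (Adj-sym G (Side.r~c sr))) (Adj⇒≢ G (Adj-sym G (Side.r~c sv)))

-- Iterated improvement towards a target graph

module _ {n : ℕ} (T : Graph n) where

  Improve : Graph n → Set
  Improve G = ∃₂ λ u v → Adj T u v × ¬ Adj G u v × Gain T G u v

  private
    missing : Graph n → ℕ
    missing G = ∑ λ p → ∑ λ q → ⟦ adj T p q ∧ not (adj G p q) ⟧

    missing-< : ∀ {G} ((_ , _ , _ , _ , G′ , _) : Improve G) → missing G′ < missing G
    missing-< {G} (u , v , uv∈T , u≁v , G′ , _ , kept , u~v) =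
      ∑-mono-< u (λ p → ∑-mono (λ q → pointwise p q)) (∑-mono-< v (pointwise u) strict)
      where
      pointwise : ∀ p q → ⟦ adj T p q ∧ not (adj G′ p q) ⟧ ≤ ⟦ adj T p q ∧ not (adj G p q) ⟧
      pointwise p q with adj T p q in pq∈T | adj G p q in p~q
      ... | false | _     = z≤n
      ... | true  | false = ⟦⟧≤1 _
      ... | true  | true  rewrite kept pq∈T p~q = z≤n
      strict : ⟦ adj T u v ∧ not (adj G′ u v) ⟧ < ⟦ adj T u v ∧ not (adj G u v) ⟧
      strict rewrite uv∈T | u~v | ¬Adj⇒false G u≁v = ≤-refl

  -- Terminates because each improvement lowers the number of ordered pairs of T missing in G. D is
  -- the exit for a step that finds the host elsewhere instead of improving.
  improve* : {D : Set} (d : Fin n → ℕ) →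
    (∀ G → (∀ i → deg G i ≡ d i) → ∀ u v → Adj T u v → ¬ Adj G u v → D ⊎ Improve G) →
    ∀ G → (∀ i → deg G i ≡ d i) → D ⊎ Σ (Graph n) λ G′ → (∀ i → deg G′ i ≡ d i) × (∀ {u v} → Adj T u v → Adj G′ u v)
  improve* {D} d step G real = go (suc (missing G)) G ≤-refl real
    where
    go : ∀ fuel G → missing G < fuel → (∀ i → deg G i ≡ d i) →
         D ⊎ Σ (Graph n) λ G′ → (∀ i → deg G′ i ≡ d i) × (∀ {u v} → Adj T u v → Adj G′ u v)
    go (suc fuel) G (s≤s bound) real
      with any? (λ u → any? λ v → adj? T u v ×-dec ¬? (adj? G u v))
    ... | no none = inj₂ (G , real , λ {u} {v} → present u v)
      where
      present : ∀ u v → Adj T u v → Adj G u v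
      present u v uv∈T with adj? G u v
      ... | yes u~v = u~v
      ... | no u≁v  = contradiction (u , v , uv∈T , u≁v) none
    ... | yes (u , v , uv∈T , u≁v) with step G real u v uv∈T u≁v
    ... | inj₁ done = inj₁ done
    ... | inj₂ better@(_ , _ , _ , _ , G′ , same , _) =
      go fuel G′ (<-≤-trans (missing-< {G} better) bound) (λ i → trans (same i) (real i))

-- Sequences without large degrees

∑deg : ∀ {n} → Graph n → ℕ
∑deg H = ∑ (deg H)

module _ {n : ℕ} (T G : Graph n) where

  -- Counts the ordered edges zw: if none can be used in the second kind of switch, then each of them has
  -- z near x, or w near y, or is shared with T.
  sparse-switch : ∀ {u v x y} t → Adj T u v → ¬ Adj G u v →
    Adj G u x → ¬ Adj T u x → Adj G v y → ¬ Adj T v y → deg G x ≤ t → deg G y ≤ t →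
    2 * (suc t * t + ∑ (λ z → deg G z ∸ t)) + ∑deg T < 2 + ∑deg G → Gain T G u v
  sparse-switch {u} {v} {x} {y} t uv∈T u≁v u~x ux∉T v~y vy∉T dx dy bound
    with any? (λ z → any? λ w → adj? G z w ×-dec ¬? (adj? T z w) ×-dec ¬? (near? G x z) ×-dec ¬? (near? G y w))
  ... | yes (z , w , z~w , zw∉T , x-z , y-w) =
    switch₃ T G (Adj⇒≢ T uv∈T) u≁v u~x ux∉T v~y vy∉T z~w zw∉T (x-z ∘ inj₁) (x-z ∘ inj₂) (y-w ∘ inj₁) (y-w ∘ inj₂)
  ... | no none = contradiction bound (≤⇒≯ (begin
    2 + ∑deg G                                        ≤⟨ +-monoʳ-≤ 2 (∑-mono λ z → ∑-mono λ w → covered z w) ⟩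
    2 + ∑ (λ z → ∑ λ w → a z w + b z w + ⟦ shared z w ⟧)
      ≡⟨ cong (2 +_) (∑-cong λ z → trans (∑-distrib-+ (λ w → a z w + b z w) _)
           (cong (_+ ∑ (λ w → ⟦ shared z w ⟧)) (∑-distrib-+ (a z) (b z)))) ⟩
    2 + ∑ (λ z → ∑ (a z) + ∑ (b z) + ∑ (λ w → ⟦ shared z w ⟧))
      ≡⟨ cong (2 +_) (trans (∑-distrib-+ (λ z → ∑ (a z) + ∑ (b z)) _)
           (cong (_+ ∑ (λ z → ∑ λ w → ⟦ shared z w ⟧)) (∑-distrib-+ (λ z → ∑ (a z)) _))) ⟩
    2 + (∑ (λ z → ∑ (a z)) + ∑ (λ z → ∑ (b z)) + ∑ (λ z → ∑ λ w → ⟦ shared z w ⟧))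
      ≡⟨ rearrange (∑ (λ z → ∑ (a z))) (∑ (λ z → ∑ (b z))) _ ⟩
    ∑ (λ z → ∑ (a z)) + ∑ (λ z → ∑ (b z)) + (∑ (λ z → ∑ λ w → ⟦ shared z w ⟧) + 2)
      ≤⟨ +-mono-≤ (+-mono-≤ a≤ b≤) shared≤ ⟩
    weight + weight + ∑deg T
      ≡⟨ cong (λ s → weight + s + ∑deg T) (+-identityʳ weight) ⟨
    2 * weight + ∑deg T                               ∎))
    where
    open ≤-Reasoning
    rearrange : ∀ p q r → 2 + (p + q + r) ≡ p + q + (r + 2)
    rearrange = solve-∀
    weight : ℕ
    weight = suc t * t + ∑ (λ z → deg G z ∸ t)
    a b : Fin n → Fin n → ℕ
    a z w = ⟦ adj G z w ⟧ * near G x z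
    b z w = ⟦ adj G z w ⟧ * near G y w
    shared : Fin n → Fin n → Bool
    shared z w = adj T z w ∧ adj G z w
    covered : ∀ z w → ⟦ adj G z w ⟧ ≤ a z w + b z w + ⟦ shared z w ⟧
    covered z w with adj? G z w | adj? T z w | near? G x z | near? G y w
    ... | no z≁w | _ | _ | _ rewrite ¬Adj⇒false G z≁w = z≤n
    ... | yes z~w | yes zw∈T | _ | _ rewrite z~w | zw∈T = m≤n+m 1 _
    ... | yes z~w | no _ | yes xz | _ rewrite z~w =
      ≤-trans (near-pos G xz) (≤-trans (m≤m+n (near G x z) (0 + (1 * near G y w + ⟦ adj T z w ∧ true ⟧)))
        (≤-reflexive (shift (near G x z) (near G y w) _)))
      where
      shift : ∀ p q r → p + (0 + (1 * q + r)) ≡ 1 * p + 1 * q + r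
      shift = solve-∀
    ... | yes z~w | no _ | no _ | yes yw rewrite z~w =
      ≤-trans (near-pos G yw) (≤-trans (m≤m+n (near G y w) (1 * near G x z + ⟦ adj T z w ∧ true ⟧))
        (≤-reflexive (shift (near G x z) (near G y w) _)))
      where
      shift : ∀ p q r → q + (1 * p + r) ≡ 1 * p + 1 * q + r
      shift = solve-∀
    ... | yes z~w | no zw∉T | no ¬xz | no ¬yw = contradiction (z , w , z~w , zw∉T , ¬xz , ¬yw) none
    -- The ordered edges with one end fixed in N[y] are counted by the sum of the degrees over N[y]:
    -- at most t for each of its members, plus the total excess over t of all vertices.
    charge : ∀ {y} → deg G y ≤ t → ∑ (λ z → deg G z * near G y z) ≤ weight
    charge {y} dy = begin
      ∑ (λ z → deg G z * near G y z)                     ≤⟨ ∑-mono pointwise ⟩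
      ∑ (λ z → near G y z * t + (deg G z ∸ t))           ≡⟨ ∑-distrib-+ (λ z → near G y z * t) _ ⟩
      ∑ (λ z → near G y z * t) + ∑ (λ z → deg G z ∸ t)   ≡⟨ cong (_+ _) (∑-*ʳ (near G y) t) ⟩
      ∑ (near G y) * t + ∑ (λ z → deg G z ∸ t)           ≡⟨ cong (λ s → s * t + _) (∑-near G y) ⟩
      suc (deg G y) * t + ∑ (λ z → deg G z ∸ t)          ≤⟨ +-monoˡ-≤ _ (*-monoˡ-≤ t (s≤s dy)) ⟩
      weight                                             ∎
      where
      pointwise : ∀ z → deg G z * near G y z ≤ near G y z * t + (deg G z ∸ t)
      pointwise z with near G y z | near≤1 G y z
      ... | zero  | _ = ≤-trans (≤-reflexive (*-zeroʳ (deg G z))) z≤n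
      ... | suc zero | _ = ≤-trans (≤-reflexive (*-identityʳ (deg G z)))
              (≤-trans (m≤n+m∸n (deg G z) t) (≤-reflexive (cong (_+ (deg G z ∸ t)) (sym (+-identityʳ t)))))
      ... | suc (suc _) | s≤s ()
    a≤ : ∑ (λ z → ∑ (a z)) ≤ weight
    a≤ = ≤-trans (≤-reflexive (∑-cong λ z → ∑-*ʳ (λ w → ⟦ adj G z w ⟧) (near G x z))) (charge dx)
    b≤ : ∑ (λ z → ∑ (b z)) ≤ weight
    b≤ = ≤-trans (≤-reflexive (trans (∑-comm b) (∑-cong λ w →
      trans (∑-*ʳ (λ z → ⟦ adj G z w ⟧) (near G y w)) (cong (_* near G y w) (∑-cong λ z → cong ⟦_⟧ (adj-sym G z w))))))
      (charge dy)
    row : ∀ z → ∑ (λ w → ⟦ shared z w ⟧) ≤ deg T z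
    row z = ∑-mono λ w → keep (adj T z w) (adj G z w)
      where
      keep : ∀ p q → ⟦ p ∧ q ⟧ ≤ ⟦ p ⟧
      keep true  q = ⟦⟧≤1 q
      keep false q = z≤n
    row-< : ∀ {z p} → Adj T z p → ¬ Adj G z p → ∑ (λ w → ⟦ shared z w ⟧) < deg T z
    row-< {z} {p} zp∈T z≁p = ∑-mono-< p (λ w → keep (adj T z w) (adj G z w)) fewer
      where
      keep : ∀ p q → ⟦ p ∧ q ⟧ ≤ ⟦ p ⟧
      keep true  q = ⟦⟧≤1 q
      keep false q = z≤n
      fewer : ⟦ shared z p ⟧ < ⟦ adj T z p ⟧
      fewer rewrite zp∈T | ¬Adj⇒false G z≁p = ≤-refl
    ends : Fin n → ℕ
    ends z = ⟦ does (z ≟ u) ⟧ + ⟦ does (z ≟ v) ⟧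
    row+ends : ∀ z → ∑ (λ w → ⟦ shared z w ⟧) + ends z ≤ deg T z
    row+ends z with z ≟ u | z ≟ v
    ... | yes refl | yes refl = contradiction refl (Adj⇒≢ T uv∈T)
    ... | yes refl | no _     = ≤-trans (≤-reflexive (+-comm _ 1)) (row-< uv∈T u≁v)
    ... | no _     | yes refl = ≤-trans (≤-reflexive (+-comm _ 1)) (row-< (Adj-sym T uv∈T) (u≁v ∘ Adj-sym G))
    ... | no _     | no _     = ≤-trans (≤-reflexive (+-identityʳ _)) (row z)
    -- Both ordered pairs uv and vu are in T and not in G; this is the 2 in the hypothesis.
    shared≤ : ∑ (λ z → ∑ λ w → ⟦ shared z w ⟧) + 2 ≤ ∑deg T
    shared≤ = begin
      ∑ (λ z → ∑ λ w → ⟦ shared z w ⟧) + 2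
        ≡⟨ cong (∑ (λ z → ∑ λ w → ⟦ shared z w ⟧) +_)
             (trans (∑-distrib-+ (λ z → ⟦ does (z ≟ u) ⟧) _) (cong₂ _+_ (∑-≟ u) (∑-≟ v))) ⟨
      ∑ (λ z → ∑ λ w → ⟦ shared z w ⟧) + ∑ ends
        ≡⟨ ∑-distrib-+ (λ z → ∑ λ w → ⟦ shared z w ⟧) ends ⟨
      ∑ (λ z → ∑ (λ w → ⟦ shared z w ⟧) + ends z)   ≤⟨ ∑-mono row+ends ⟩
      ∑deg T                                         ∎

  -- The neighbour v of u in T is not one in G, so a degree at least as large in G has to be made up
  -- by a neighbour outside T.
  unshared-neighbour : ∀ {u v} → Adj T u v → ¬ Adj G u v → deg T u ≤ deg G u → ∃ λ x → Adj G u x × ¬ Adj T u x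
  unshared-neighbour {u} {v} uv∈T u≁v le = i , u~i , ui∉T
    where
    total : deg T u < ∑ (λ i → ⟦ adj G u i ⟧ + ⟦ does (i ≟ v) ⟧)
    total = ≤-trans (s≤s le) (≤-reflexive (sym
      (trans (∑-distrib-+ (λ i → ⟦ adj G u i ⟧) _) (trans (cong (deg G u +_) (∑-≟ v)) (+-comm _ 1)))))
    witness = ∑-<⇒∃ (λ i → ⟦ adj T u i ⟧) _ total
    i = proj₁ witness
    both : Adj G u i × ¬ Adj T u i
    both with i ≟ v | adj T u i in ti | adj G u i in gi | proj₂ witness
    ... | _        | false | true  | _ = refl , λ ()
    ... | yes i≡v  | false | false | _ = contradiction (trans (sym (subst (Adj T u) (sym i≡v) uv∈T)) ti) λ ()
    ... | no _     | false | false | ()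
    ... | yes i≡v  | true  | true  | _ = contradiction (subst (Adj G u) i≡v gi) u≁v
    ... | yes _    | true  | false | s≤s ()
    ... | no _     | true  | true  | s≤s ()
    ... | no _     | true  | false | ()
    u~i = proj₁ both
    ui∉T = proj₂ both

module _ {n : ℕ} (T : Graph n) (d : Fin n → ℕ) where

  -- The bound t is asked only of vertices that can occur as x or y in a switch. A vertex joined in
  -- T to the whole core never has to serve a core vertex in this way, so the hubs may have any
  -- degree, at the price of their excess in the count.
  realize-sparse : ∀ t → (∀ i → deg T i ≤ d i) →
    (∀ {u v x} → Adj T u v → x ≢ u → ¬ Adj T u x → d x ≤ t) →
    2 * (suc t * t + ∑ (λ z → d z ∸ t)) + ∑deg T < 2 + ∑ d →
    ∀ G → (∀ i → deg G i ≡ d i) → Σ (Graph n) λ G′ → (∀ i → deg G′ i ≡ d i) × (∀ {u v} → Adj T u v → Adj G′ u v)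
  realize-sparse t T≤d small bound G real = case improve* T {⊥} d step G real of λ where
      (inj₁ ())
      (inj₂ found) → found
    where
    step : ∀ G → (∀ i → deg G i ≡ d i) → ∀ u v → Adj T u v → ¬ Adj G u v → ⊥ ⊎ Improve T G
    step G real u v uv∈T u≁v =
      let vu∈T = Adj-sym T uv∈T
          x , u~x , ux∉T = unshared-neighbour T G uv∈T u≁v (subst (deg T u ≤_) (sym (real u)) (T≤d u))
          y , v~y , vy∉T = unshared-neighbour T G vu∈T (u≁v ∘ Adj-sym G) (subst (deg T v ≤_) (sym (real v)) (T≤d v))
          dx = subst (_≤ t) (sym (real x)) (small uv∈T (≢-sym (Adj⇒≢ G u~x)) ux∉T)
          dy = subst (_≤ t) (sym (real y)) (small vu∈T (≢-sym (Adj⇒≢ G v~y)) vy∉T)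
      in inj₂ (u , v , uv∈T , u≁v , sparse-switch T G t uv∈T u≁v u~x ux∉T v~y vy∉T dx dy
           (subst₂ (λ p q → 2 * (suc t * t + p) + ∑deg T < 2 + q)
             (∑-cong λ z → cong (_∸ t) (sym (real z))) (∑-cong λ z → sym (real z)) bound))

-- Disjoint unions, and hosts padded by isolated vertices

module _ {k m : ℕ} (H : Graph k) (K : Graph m) where

  private
    link : Fin k ⊎ Fin m → Fin k ⊎ Fin m → Bool
    link (inj₁ i) (inj₁ j) = adj H i j
    link (inj₂ i) (inj₂ j) = adj K i j
    link _        _        = false

    link-sym : ∀ p q → link p q ≡ link q p
    link-sym (inj₁ i) (inj₁ j) = adj-sym H i j
    link-sym (inj₁ _) (inj₂ _) = refl
    link-sym (inj₂ _) (inj₁ _) = refl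
    link-sym (inj₂ i) (inj₂ j) = adj-sym K i j

    link-irrefl : ∀ p → link p p ≡ false
    link-irrefl (inj₁ i) = irrefl H i
    link-irrefl (inj₂ i) = irrefl K i

  abstract
    union : Graph (k + m)
    union = record
      { adj    = λ p q → link (splitAt k p) (splitAt k q)
      ; sym    = λ p q → link-sym (splitAt k p) (splitAt k q)
      ; irrefl = λ p → link-irrefl (splitAt k p)
      }

    union-ˡˡ : ∀ i j → adj union (i ↑ˡ m) (j ↑ˡ m) ≡ adj H i j
    union-ˡˡ i j rewrite splitAt-↑ˡ k i m | splitAt-↑ˡ k j m = refl

    union-ʳʳ : ∀ i j → adj union (k ↑ʳ i) (k ↑ʳ j) ≡ adj K i j
    union-ʳʳ i j rewrite splitAt-↑ʳ k m i | splitAt-↑ʳ k m j = refl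

    union-ʳˡ : ∀ i j → adj union (k ↑ʳ i) (j ↑ˡ m) ≡ false
    union-ʳˡ i j rewrite splitAt-↑ʳ k m i | splitAt-↑ˡ k j m = refl

  union-ˡʳ : ∀ i j → adj union (i ↑ˡ m) (k ↑ʳ j) ≡ false
  union-ˡʳ i j = trans (adj-sym union _ _) (union-ʳˡ j i)

  deg-union-ˡ : ∀ i → deg union (i ↑ˡ m) ≡ deg H i
  deg-union-ˡ i = trans (∑-split k (λ q → ⟦ adj union (i ↑ˡ m) q ⟧)) (trans
    (cong₂ _+_ (∑-cong λ j → cong ⟦_⟧ (union-ˡˡ i j)) (∑-zero λ j → cong ⟦_⟧ (union-ˡʳ i j))) (+-identityʳ _))

  deg-union-ʳ : ∀ j → deg union (k ↑ʳ j) ≡ deg K j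
  deg-union-ʳ j = trans (∑-split k (λ q → ⟦ adj union (k ↑ʳ j) q ⟧))
    (cong₂ _+_ (∑-zero λ i → cong ⟦_⟧ (union-ʳˡ j i)) (∑-cong λ i → cong ⟦_⟧ (union-ʳʳ j i)))

empty : ∀ m → Graph m
empty m = record { adj = λ _ _ → false ; sym = λ _ _ → refl ; irrefl = λ _ → refl }

deg-empty : ∀ m j → deg (empty m) j ≡ 0
deg-empty m j = ∑-zero {m} {λ _ → 0} λ _ → refl

pad : ∀ {k} → Graph k → ∀ m → Graph (k + m)
pad H m = union H (empty m)

data Place (k : ℕ) {m : ℕ} : Fin (k + m) → Set where
  inner : (i : Fin k) → Place k (i ↑ˡ m)
  outer : (j : Fin m) → Place k (k ↑ʳ j)

place : ∀ k {m} (p : Fin (k + m)) → Place k p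
place zero    p       = outer p
place (suc k) zero    = inner zero
place (suc k) (suc p) with place k p
... | inner i = inner (suc i)
... | outer j = outer j

module _ {k : ℕ} (H : Graph k) (m : ℕ) where

  pad-outer : ∀ j q → ¬ Adj (pad H m) (k ↑ʳ j) q
  pad-outer j q j~q with place k q
  ... | inner i = contradiction (trans (sym j~q) (union-ʳˡ H (empty m) j i)) λ ()
  ... | outer i = contradiction (trans (sym j~q) (union-ʳʳ H (empty m) j i)) λ ()

  pad-adj : ∀ {i j} → Adj H i j → Adj (pad H m) (i ↑ˡ m) (j ↑ˡ m)
  pad-adj = trans (union-ˡˡ H (empty m) _ _)

  pad-adj⁻ : ∀ {i j} → Adj (pad H m) (i ↑ˡ m) (j ↑ˡ m) → Adj H i j
  pad-adj⁻ = trans (sym (union-ˡˡ H (empty m) _ _))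

  ∑deg-pad : ∑deg (pad H m) ≡ ∑deg H
  ∑deg-pad = trans (∑-split k (deg (pad H m))) (trans
    (cong₂ _+_ (∑-cong (deg-union-ˡ H (empty m)))
      (∑-zero λ j → trans (deg-union-ʳ H (empty m) j) (deg-empty m j))) (+-identityʳ _))

  pad⊆⇒Contains : ∀ {G} → (∀ {u v} → Adj (pad H m) u v → Adj G u v) → Contains G H
  pad⊆⇒Contains sub = _↑ˡ m , (λ {i} {j} → ↑ˡ-injective m i j) , λ i j i~j → sub (pad-adj {i} {j} i~j)

  host-sparse : (d : Fin (k + m) → ℕ) → ∀ t → (∀ i → deg H i ≤ d (i ↑ˡ m)) →
    (∀ i j → i ≢ j → ¬ Adj H i j → d (j ↑ˡ m) ≤ t) → (∀ j → d (k ↑ʳ j) ≤ t) →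
    2 * (suc t * t + ∑ (λ z → d z ∸ t)) + ∑deg H < 2 + ∑ d →
    ∀ G → (∀ i → deg G i ≡ d i) → Σ (Graph (k + m)) λ G′ → (∀ i → deg G′ i ≡ d i) × Contains G′ H
  host-sparse d t H≤d smallˡ smallʳ bound G real =
    let G′ , real′ , sub = realize-sparse (pad H m) d t pad≤d small
          (subst (λ s → 2 * (suc t * t + ∑ (λ z → d z ∸ t)) + s < 2 + ∑ d) (sym ∑deg-pad) bound) G real
    in G′ , real′ , pad⊆⇒Contains {G′} (λ {u} {v} → sub {u} {v})
    where
    pad≤d : ∀ p → deg (pad H m) p ≤ d p
    pad≤d p with place k p
    ... | inner i = ≤-trans (≤-reflexive (deg-union-ˡ H (empty m) i)) (H≤d i)
    ... | outer j = ≤-trans (≤-reflexive (trans (deg-union-ʳ H (empty m) j) (deg-empty m j))) z≤n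
    small : ∀ {u v x} → Adj (pad H m) u v → x ≢ u → ¬ Adj (pad H m) u x → d x ≤ t
    small {u} {v} {x} u~v x≢u u≁x with place k u | place k x
    ... | outer j | _       = contradiction u~v (pad-outer j v)
    ... | inner i | outer j = smallʳ j
    ... | inner i | inner j = smallˡ i j (λ i≡j → x≢u (cong (_↑ˡ m) (sym i≡j))) (u≁x ∘ pad-adj {i} {j})

-- Hosts of all 2-trees

Contains-trans : ∀ {a b c} (A : Graph a) (B : Graph b) (C : Graph c) → Contains A B → Contains B C → Contains A C
Contains-trans A B C (f , f-inj , f-adj) (g , g-inj , g-adj) = f ∘ g , g-inj ∘ f-inj , λ i j → f-adj (g i) (g j) ∘ g-adj i j

module _ {c : ℕ} (C : Graph c) where

  private
    new : (i j k : Fin c) → Bool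
    new i j k = does (k ≟ i) ∨ does (k ≟ j)

    attach-adj : Fin c → Fin c → Fin (suc c) → Fin (suc c) → Bool
    attach-adj i j zero    zero    = false
    attach-adj i j zero    (suc q) = new i j q
    attach-adj i j (suc p) zero    = new i j p
    attach-adj i j (suc p) (suc q) = adj C p q

    attach-sym : ∀ i j p q → attach-adj i j p q ≡ attach-adj i j q p
    attach-sym i j zero    zero    = refl
    attach-sym i j zero    (suc q) = refl
    attach-sym i j (suc p) zero    = refl
    attach-sym i j (suc p) (suc q) = adj-sym C p q

    attach-irrefl : ∀ i j p → attach-adj i j p p ≡ false
    attach-irrefl i j zero    = refl
    attach-irrefl i j (suc p) = irrefl C p

  attach : Fin c → Fin c → Graph (suc c)
  attach i j = record { adj = attach-adj i j ; sym = attach-sym i j ; irrefl = attach-irrefl i j }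

  attach-newˡ : ∀ i j → Adj (attach i j) zero (suc i)
  attach-newˡ i j rewrite dec-true (i ≟ i) refl = refl

  attach-newʳ : ∀ i j → Adj (attach i j) zero (suc j)
  attach-newʳ i j rewrite dec-true (j ≟ j) refl = ∨-zeroʳ _

  -- As v has degree 2, it has no neighbours besides u and w; the embedding of `delete H v`
  -- therefore extends by sending v to the vertex attached to the images of u and w.
  Contains-attach : ∀ (H : Graph (suc c)) v {u w} → deg H v ≡ 2 → u ≢ w → Adj H v u → Adj H v w → Adj H u w →
    Contains C (delete H v) → ∃₂ λ i j → Adj C i j × Contains (attach i j) H
  Contains-attach H v {u} {w} deg≡2 u≢w v~u v~w u~w (f , f-inj , f-adj) =
    f u′ , f w′ , f-adj u′ w′ u′~w′ , g , (λ {p} {q} → g-inj p q) , g-adj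
    where
    v≢u = Adj⇒≢ H v~u
    v≢w = Adj⇒≢ H v~w
    u′ = punchOut v≢u
    w′ = punchOut v≢w
    u′~w′ : Adj (delete H v) u′ w′
    u′~w′ = trans (cong₂ (adj H) (punchIn-punchOut v≢u) (punchIn-punchOut v≢w)) u~w
    D′ = attach (f u′) (f w′)
    g′ : ∀ p → Dec (v ≡ p) → Fin (suc c)
    g′ p (yes _)   = zero
    g′ p (no v≢p) = suc (f (punchOut v≢p))
    g : Fin (suc c) → Fin (suc c)
    g p = g′ p (v ≟ p)
    g-inj : ∀ p q → g p ≡ g q → p ≡ q
    g-inj p q eq with v ≟ p | v ≟ q
    ... | yes refl | yes refl = refl
    ... | yes _    | no _     = contradiction eq λ ()
    ... | no _     | yes _    = contradiction eq λ ()
    ... | no v≢p   | no v≢q   = punchOut-injective v≢p v≢q (f-inj (suc-injective eq))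
    only : ∀ p → Adj H v p → p ≡ u ⊎ p ≡ w
    only p v~p with p ≟ u | p ≟ w
    ... | yes p≡u | _       = inj₁ p≡u
    ... | no _    | yes p≡w = inj₂ p≡w
    ... | no p≢u  | no p≢w  =
      contradiction (subst (3 ≤_) deg≡2 (unique⇒≤deg H v ((p≢u ∷ p≢w ∷ []) ∷ (u≢w ∷ []) ∷ [] ∷ []) (v~p ∷ v~u ∷ v~w ∷ [])))
        (<⇒≱ ≤-refl)
    touches : ∀ q (v≢q : v ≢ q) → Adj H v q → Adj D′ zero (suc (f (punchOut v≢q)))
    touches q v≢q v~q with only q v~q
    ... | inj₁ refl rewrite punchOut-cong v {i≢j = v≢q} {i≢k = v≢u} refl = attach-newˡ (f u′) (f w′)
    ... | inj₂ refl rewrite punchOut-cong v {i≢j = v≢q} {i≢k = v≢w} refl = attach-newʳ (f u′) (f w′)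
    g-adj : ∀ p q → Adj H p q → Adj D′ (g p) (g q)
    g-adj p q p~q with v ≟ p | v ≟ q
    ... | yes refl | yes refl = contradiction refl (Adj⇒≢ H p~q)
    ... | yes refl | no v≢q   = touches q v≢q p~q
    ... | no v≢p   | yes refl = Adj-sym D′ {zero} {suc (f (punchOut v≢p))} (touches p v≢p (Adj-sym H p~q))
    ... | no v≢p   | no v≢q   = f-adj (punchOut v≢p) (punchOut v≢q)
      (trans (cong₂ (adj H) (punchIn-punchOut v≢p) (punchIn-punchOut v≢q)) p~q)

all-maybe : ∀ {n} {P : Fin n → Set} → (∀ i → Maybe (P i)) → Maybe (∀ i → P i)
all-maybe {zero}  f = just λ ()
all-maybe {suc n} f with f zero | all-maybe (f ∘ suc)
... | just p | just ps = just λ { zero → p ; (suc i) → ps i }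
... | _      | _       = nothing

any-maybe : {A : Set} {P : A → Set} → (∀ x → Maybe (P x)) → ∀ xs → Maybe (Any P xs)
any-maybe f []       = nothing
any-maybe f (x ∷ xs) with f x
... | just p  = just (here p)
... | nothing = Maybe.map there (any-maybe f xs)

module _ {h : ℕ} (D : Graph h) where

  private
    extend-at : ∀ {c} (C : Graph (suc c)) → Contains D (delete C zero) → Fin h → Maybe (Contains D C)
    extend-at {c} C (f , f-inj , f-adj) p
      with all? (λ j → ¬? (p ≟ f j)) | all? (λ j → ¬? (adj? C zero (suc j)) ⊎-dec adj? D p (f j))
    ... | no _      | _     = nothing
    ... | yes _     | no _  = nothing
    ... | yes fresh | yes p~ = just (g , (λ {i} {j} → g-inj i j) , g-adj)
      where
      g : Fin (suc c) → Fin h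
      g zero    = p
      g (suc i) = f i
      g-inj : ∀ i j → g i ≡ g j → i ≡ j
      g-inj zero    zero    eq = refl
      g-inj zero    (suc j) eq = contradiction eq (fresh j)
      g-inj (suc i) zero    eq = contradiction (sym eq) (fresh i)
      g-inj (suc i) (suc j) eq = cong suc (f-inj eq)
      linked : ∀ j → Adj C zero (suc j) → Adj D p (f j)
      linked j 0~j with p~ j
      ... | inj₁ 0≁j = contradiction 0~j 0≁j
      ... | inj₂ p~f = p~f
      g-adj : ∀ i j → Adj C i j → Adj D (g i) (g j)
      g-adj zero    zero    i~j = contradiction refl (Adj⇒≢ C i~j)
      g-adj zero    (suc j) i~j = linked j i~j
      g-adj (suc i) zero    i~j = Adj-sym D (linked i (Adj-sym C i~j))
      g-adj (suc i) (suc j) i~j = f-adj i j i~j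

  -- Backtracking in which vertex 0 is placed last. Each result carries its proofs, so a finite
  -- check amounts to the list being nonempty.
  embeddings : ∀ {c} (C : Graph c) → List (Contains D C)
  embeddings {zero}  C = ((λ ()) , (λ { {()} }) , λ ()) ∷ []
  embeddings {suc c} C = concatMap (λ e → mapMaybe (extend-at C e) (allFin h)) (embeddings (delete C zero))

Covers : ∀ {c d} → List (Graph c) → Graph d → Set
Covers Ds G = Any (λ D → Contains D G) Ds

covers-extensions? : ∀ {c} (Cs : List (Graph c)) (Ds : List (Graph (suc c))) →
  Maybe (All (λ C → ∀ i j → Adj C i j → Covers Ds (attach C i j)) Cs)
covers-extensions? []       Ds = just []
covers-extensions? (C ∷ Cs) Ds with all-maybe (λ i → all-maybe (one i)) | covers-extensions? Cs Ds
  where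
  one : ∀ i j → Maybe (Adj C i j → Covers Ds (attach C i j))
  one i j with adj? C i j
  ... | yes _  = Maybe.map (λ cov _ → cov) (any-maybe (λ D → List.head (embeddings D (attach C i j))) Ds)
  ... | no i≁j = just λ i~j → contradiction i~j i≁j
... | just p | just ps = just (p ∷ ps)
... | _      | _       = nothing

-- If the smaller 2-tree lies in C, the larger one lies in the attachment of a vertex to an edge of
-- C. Covering the attachments of all listed C thus covers all 2-trees of the next size, without any
-- sorting by isomorphism.
twoTree-step : ∀ {c} (Cs : List (Graph (3 + c))) (Ds : List (Graph (4 + c))) →
  All (λ C → ∀ i j → Adj C i j → Covers Ds (attach C i j)) Cs →
  (∀ G → IsTwoTree {3 + c} G → Covers Cs G) → ∀ G → IsTwoTree {4 + c} G → Covers Ds G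
twoTree-step Cs Ds ext ih G (extend G v deg≡2 (u , w , u≢w , v~u , v~w , u~w) tree) =
  let C , C∈ , C⊇ = find (ih (delete G v) tree)
      i , j , i~j , attached = Contains-attach C G v deg≡2 u≢w v~u v~w u~w C⊇
  in Any.map (λ {D} D⊇ → Contains-trans D (attach C i j) G D⊇ attached) (All.lookup ext C∈ i j i~j)

complete : ∀ c → Graph c
complete c = record
  { adj    = λ i j → not (does (i ≟ j))
  ; sym    = λ i j → cong not (does-sym i j)
  ; irrefl = λ i → cong not (dec-true (i ≟ i) refl)
  }

twoTrees₃ : List (Graph 3)
twoTrees₃ = complete 3 ∷ []

twoTrees₄ : List (Graph 4)
twoTrees₄ = attach (complete 3) (# 0) (# 1) ∷ []

twoTrees₅ : List (Graph 5)
twoTrees₅ = map (λ D → attach D (# 0) (# 1)) twoTrees₄ ++ map (λ D → attach D (# 1) (# 2)) twoTrees₄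

-- The five 2-trees on six vertices. The first four extend the fan K₁ ∨ P₄, one for each orbit of
-- its edges; the last extends the book along its spine, and the other extension of the book already
-- arises from the fan.
twoTrees₆ : List (Graph 6)
twoTrees₆ =
  let fan  = attach (attach (attach (complete 3) (# 0) (# 1)) (# 0) (# 1))
      book = attach (attach (attach (complete 3) (# 0) (# 1)) (# 1) (# 2))
  in fan (# 0) (# 1) ∷ fan (# 0) (# 2) ∷ fan (# 1) (# 2) ∷ fan (# 1) (# 3) ∷ book (# 2) (# 3) ∷ []

covers₃ : ∀ G → IsTwoTree {3} G → Covers twoTrees₃ G
covers₃ G _ = here (id , id , λ i j i~j → cong not (dec-false (i ≟ j) (Adj⇒≢ G i~j)))

covers₄ : ∀ G → IsTwoTree {4} G → Covers twoTrees₄ G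
covers₄ = twoTree-step _ _ (from-just (covers-extensions? twoTrees₃ twoTrees₄)) covers₃

covers₅ : ∀ G → IsTwoTree {5} G → Covers twoTrees₅ G
covers₅ = twoTree-step _ _ (from-just (covers-extensions? twoTrees₄ twoTrees₅)) covers₄

covers₆ : ∀ G → IsTwoTree {6} G → Covers twoTrees₆ G
covers₆ = twoTree-step _ _ (from-just (covers-extensions? twoTrees₅ twoTrees₆)) covers₅

-- K_β ∨ (k − β) K_1 together with the edges es.
hub : ∀ k (β : ℕ) → List (Fin k × Fin k) → Graph k
hub k β es = record
  { adj    = λ i j → not (does (i ≟ j)) ∧ (linked i j ∨ linked j i)
  ; sym    = λ i j → cong₂ _∧_ (cong not (does-sym i j)) (∨-comm (linked i j) _)
  ; irrefl = λ i → cong (λ b → not b ∧ (linked i i ∨ linked i i)) (dec-true (i ≟ i) refl)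
  }
  where
  linked : Fin k → Fin k → Bool
  linked i j = (toℕ i Nat.<ᵇ β) ∨ any (λ (p , q) → does (i ≟ p) ∧ does (j ≟ q)) es

host : ∀ z → List (Fin z × Fin z) → Graph (2 + z)
host z es = hub (2 + z) 2 (map (λ (p , q) → suc (suc p) , suc (suc q)) es)

-- The hosts are K₃, K₄ − e, K₂ ∨ (K₂ ∪ K₁) and K₂ ∨ P₅.
host₃ : Graph 3
host₃ = host 1 []

host₄ : Graph 4
host₄ = host 2 []

host₅ : Graph 5
host₅ = host 3 ((# 0 , # 1) ∷ [])

path₅ : List (Fin 5 × Fin 5)
path₅ = (# 0 , # 1) ∷ (# 1 , # 2) ∷ (# 2 , # 3) ∷ (# 3 , # 4) ∷ []

host₇ : Graph 7
host₇ = host 5 path₅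

singleton-cover : ∀ {c d} (D : Graph c) (G : Graph d) → Covers (D ∷ []) G → Contains D G
singleton-cover D G (here D⊇G) = D⊇G

all-in-host₃ : ContainsAllTwoTrees 3 host₃
all-in-host₃ G tree =
  Contains-trans host₃ (complete 3) G (from-just (List.head (embeddings host₃ (complete 3))))
    (singleton-cover (complete 3) G (covers₃ G tree))

all-in-host₄ : ContainsAllTwoTrees 4 host₄
all-in-host₄ G tree = singleton-cover host₄ G
  (twoTree-step _ _ (from-just (covers-extensions? twoTrees₃ (host₄ ∷ []))) covers₃ G tree)

all-in-host₅ : ContainsAllTwoTrees 5 host₅
all-in-host₅ G tree = singleton-cover host₅ G
  (twoTree-step _ _ (from-just (covers-extensions? twoTrees₄ (host₅ ∷ []))) covers₄ G tree)

-- The host is not itself a 2-tree (it has 15 edges instead of 11), so the last step goes from the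
-- five graphs on six vertices directly to this one graph.
all-in-host₇ : ContainsAllTwoTrees 7 host₇
all-in-host₇ G tree = singleton-cover host₇ G
  (twoTree-step _ _ (from-just (covers-extensions? twoTrees₆ (host₇ ∷ []))) covers₆ G tree)

-- Sharpness

deg-complete : ∀ c (i : Fin (suc c)) → deg (complete (suc c)) i ≡ c
deg-complete c i = +-cancelʳ-≡ 1 _ _ (begin
  deg (complete (suc c)) i + 1                                  ≡⟨ cong (deg (complete (suc c)) i +_) (∑-≟ i) ⟨
  deg (complete (suc c)) i + ∑ (λ j → ⟦ does (j ≟ i) ⟧)         ≡⟨ ∑-distrib-+ (λ j → ⟦ not (does (i ≟ j)) ⟧) (λ j → ⟦ does (j ≟ i) ⟧) ⟨
  ∑ (λ j → ⟦ not (does (i ≟ j)) ⟧ + ⟦ does (j ≟ i) ⟧)           ≡⟨ ∑-cong (λ j → one j) ⟩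
  ∑ {suc c} (λ _ → 1)                                           ≡⟨ ∑-const (suc c) 1 ⟩
  suc c * 1                                                     ≡⟨ *-identityʳ (suc c) ⟩
  suc c                                                         ≡⟨ +-comm 1 c ⟩
  c + 1                                                         ∎)
  where
  open ≡-Reasoning
  one : ∀ j → ⟦ not (does (i ≟ j)) ⟧ + ⟦ does (j ≟ i) ⟧ ≡ 1
  one j rewrite does-sym j i with does (i ≟ j)
  ... | true  = refl
  ... | false = refl

copies : ∀ q c → Graph (q * c)
copies zero    c = empty 0
copies (suc q) c = union (complete c) (copies q c)

deg-copies : ∀ q c i → deg (copies q (suc c)) i ≡ c
deg-copies (suc q) c i with place (suc c) i
... | inner i = trans (deg-union-ˡ (complete (suc c)) (copies q (suc c)) i) (deg-complete c i)
... | outer j = trans (deg-union-ʳ (complete (suc c)) (copies q (suc c)) j) (deg-copies q c j)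

cone : ∀ {m} → Graph m → Graph (suc m)
cone {m} K = record { adj = cone-adj ; sym = cone-sym ; irrefl = cone-irrefl }
  where
  cone-adj : Fin (suc m) → Fin (suc m) → Bool
  cone-adj zero    zero    = false
  cone-adj zero    (suc j) = true
  cone-adj (suc i) zero    = true
  cone-adj (suc i) (suc j) = adj K i j
  cone-sym : ∀ i j → cone-adj i j ≡ cone-adj j i
  cone-sym zero    zero    = refl
  cone-sym zero    (suc j) = refl
  cone-sym (suc i) zero    = refl
  cone-sym (suc i) (suc j) = adj-sym K i j
  cone-irrefl : ∀ i → cone-adj i i ≡ false
  cone-irrefl zero    = refl
  cone-irrefl (suc i) = irrefl K i

windmill : ∀ q c → Graph (suc (q * suc c))
windmill q c = cone (copies q (suc c))

windmill-sequence : ∀ q c → Vec ℕ (suc (q * suc c))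
windmill-sequence q c = q * suc c ∷ Vec.replicate _ (suc c)

windmill-graphic : ∀ q c → Graphic (windmill-sequence (suc q) c)
windmill-graphic q c = nonIncreasing , windmill (suc q) c , realizes
  where
  nonIncreasing : NonIncreasing (windmill-sequence (suc q) c)
  nonIncreasing zero    zero    _ = ≤-refl
  nonIncreasing zero    (suc j) _ = ≤-trans (≤-reflexive (lookup-replicate j (suc c))) (m≤m+n (suc c) _)
  nonIncreasing (suc i) (suc j) _ = ≤-reflexive (trans (lookup-replicate j (suc c)) (sym (lookup-replicate i (suc c))))
  realizes : Realizes (windmill (suc q) c) (windmill-sequence (suc q) c)
  realizes zero    = trans (∑-const (suc q * suc c) 1) (*-identityʳ _)
  realizes (suc i) = trans (cong suc (deg-copies (suc q) c i)) (sym (lookup-replicate i (suc c)))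

σ-windmill : ∀ q c → σ (windmill-sequence q c) ≡ (2 + c) * (q * suc c)
σ-windmill q c = cong (q * suc c +_) (trans (sum-replicate (q * suc c) (suc c)) (*-comm (q * suc c) (suc c)))
  where
  sum-replicate : ∀ m x → Vec.sum (Vec.replicate m x) ≡ m * x
  sum-replicate zero    x = refl
  sum-replicate (suc m) x = cong (x +_) (sum-replicate m x)

twoTree-attach : ∀ {c} (C : Graph (suc c)) {i j} → Adj C i j → IsTwoTree C → IsTwoTree (attach C i j)
twoTree-attach C {i} {j} i~j tree =
  extend (attach C i j) zero two (suc i , suc j , (λ eq → Adj⇒≢ C i~j (suc-injective eq)) , attach-newˡ C i j , attach-newʳ C i j , i~j) tree
  where
  disjoint : ∀ p → ⟦ does (p ≟ i) ∨ does (p ≟ j) ⟧ ≡ ⟦ does (p ≟ i) ⟧ + ⟦ does (p ≟ j) ⟧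
  disjoint p with p ≟ i | p ≟ j
  ... | yes refl | yes refl = contradiction refl (Adj⇒≢ C i~j)
  ... | yes _    | no _     = refl
  ... | no _     | yes _    = refl
  ... | no _     | no _     = refl
  two : deg (attach C i j) zero ≡ 2
  two = trans (∑-cong disjoint) (trans (∑-distrib-+ (λ p → ⟦ does (p ≟ i) ⟧) (λ p → ⟦ does (p ≟ j) ⟧)) (cong₂ _+_ (∑-≟ i) (∑-≟ j)))

-- Every attachment puts the new vertex at 0 and shifts the others by one; this follows two vertices
-- of the initial triangle through the shifts.
spine : ∀ c → Fin 2 → Fin (3 + c)
spine zero    s = s ↑ˡ 1
spine (suc c) s = suc (spine c s)

book : ∀ c → Graph (3 + c)
book zero    = complete 3
book (suc c) = attach (book c) (spine c (# 0)) (spine c (# 1))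

spine-universal : ∀ c s p → p ≢ spine c s → Adj (book c) (spine c s) p
spine-universal zero    s          p       p≢s = cong not (dec-false (s ↑ˡ 1 ≟ p) (≢-sym p≢s))
spine-universal (suc c) zero       zero    p≢s = attach-newˡ (book c) (spine c (# 0)) (spine c (# 1))
spine-universal (suc c) (suc zero) zero    p≢s = attach-newʳ (book c) (spine c (# 0)) (spine c (# 1))
spine-universal (suc c) s          (suc p) p≢s = spine-universal c s p (p≢s ∘ cong suc)

spine-injective : ∀ c {s t} → spine c s ≡ spine c t → s ≡ t
spine-injective zero    eq = ↑ˡ-injective 1 _ _ eq
spine-injective (suc c) eq = spine-injective c (suc-injective eq)

book-twoTree : ∀ c → IsTwoTree (book c)
book-twoTree zero    = triangle (complete 3) λ i j i≢j → cong not (dec-false (i ≟ j) i≢j)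
book-twoTree (suc c) = twoTree-attach (book c) (spine-universal c (# 0) _ λ eq → 0≢1+n (sym (spine-injective c eq))) (book-twoTree c)

-- The spine vertices of the book on 3 + c vertices have degree 2 + c, but only one entry of the sequence exceeds 1 + c.
windmill-avoids-book : ∀ q c (G : Graph _) → Realizes G (windmill-sequence q c) → ¬ ContainsAllTwoTrees (3 + c) G
windmill-avoids-book q c G real all with all (book c) (book-twoTree c)
... | f , f-inj , f-adj = 0≢1+n (spine-injective c (f-inj (trans (at-centre (# 0)) (sym (at-centre (# 1))))))
  where
  at-centre : ∀ s → f (spine c s) ≡ zero
  at-centre s with f (spine c s) in eq | large
    where
    others : List (Fin (3 + c))
    others = map (punchIn (spine c s)) (allFin (2 + c))
    large : 2 + c ≤ deg G (f (spine c s))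
    large = subst (_≤ deg G (f (spine c s))) (trans (length-map f others) (trans (length-map _ (allFin (2 + c))) (length-tabulate {n = 2 + c} id)))
      (unique⇒≤deg G (f (spine c s))
        (Uniq.map⁺ f-inj (Uniq.map⁺ (λ {i} {j} → punchIn-injective (spine c s) i j) (Uniq.allFin⁺ (2 + c))))
        (AllP.map⁺ (AllP.map⁺ (All.tabulate λ {i} _ →
          f-adj _ _ (spine-universal c s (punchIn (spine c s) i) (punchInᵢ≢i (spine c s) i))))))
  ... | zero  | _ = refl
  ... | suc p | large = contradiction (≤-trans large (≤-reflexive (trans (real (suc p)) (lookup-replicate p (suc c))))) (n≮n (suc c))

sharpness : ∀ c n₀ → Σ ℕ λ n → n ≥ n₀ × Σ (Vec ℕ n) λ π → Graphic π × σ π ≡ (2 + c) * (n ∸ 1) ×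
  ((G : Graph n) → Realizes G π → ¬ ContainsAllTwoTrees (3 + c) G)
sharpness c n₀ = suc (suc n₀ * suc c) , ≤-trans (≤-trans (n≤1+n n₀) (m≤m*n (suc n₀) (suc c))) (n≤1+n _) ,
  windmill-sequence (suc n₀) c , windmill-graphic n₀ c , σ-windmill (suc n₀) c , windmill-avoids-book (suc n₀) c

-- Completing the joins of the vertices of large degree

hub-adj : ∀ k β es {i j : Fin k} → i ≢ j → toℕ i < β → Adj (hub k β es) i j
hub-adj k β es {i} {j} i≢j i<β rewrite dec-false (i ≟ j) i≢j | Equivalence.to T-≡ (<⇒<ᵇ i<β) = refl

hub-adj⁻ : ∀ k β es {i j : Fin k} → Adj (hub k β es) i j → (toℕ i < β ⊎ toℕ j < β) ⊎ ((i , j) ∈ es ⊎ (j , i) ∈ es)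
hub-adj⁻ k β es {i} {j} i~j =
  [ Sum.map inj₁ inj₁ ∘ cases i j , Sum.map inj₂ inj₂ ∘ cases j i ]′
    (Equivalence.to T-∨ (proj₂ (Equivalence.to T-∧ (Equivalence.from T-≡ i~j))))
  where
  listed : ∀ i j es → Bool.T (any (λ (p , q) → does (i ≟ p) ∧ does (j ≟ q)) es) → (i , j) ∈ es
  listed i j ((p , q) ∷ es) holds with i ≟ p | j ≟ q
  ... | yes refl | yes refl = here refl
  ... | yes _    | no _     = there (listed i j es holds)
  ... | no _     | _        = there (listed i j es holds)
  cases : ∀ i j → Bool.T ((toℕ i Nat.<ᵇ β) ∨ any (λ (p , q) → does (i ≟ p) ∧ does (j ≟ q)) es) → toℕ i < β ⊎ (i , j) ∈ es
  cases i j = Sum.map (<ᵇ⇒< _ _) (listed i j es) ∘ Equivalence.to T-∨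

hub-embed : ∀ {n k} (G : Graph n) β es (f : Fin k → Fin n) → Injective _≡_ _≡_ f →
  (∀ i j → toℕ i < β → i ≢ j → Adj G (f i) (f j)) → All (λ (i , j) → Adj G (f i) (f j)) es → Contains G (hub k β es)
hub-embed {k = k} G β es f f-inj f-hub f-es = f , f-inj , f-adj
  where
  f-adj : ∀ i j → Adj (hub k β es) i j → Adj G (f i) (f j)
  f-adj i j i~j with Adj⇒≢ (hub k β es) {i} {j} i~j | hub-adj⁻ k β es {i} {j} i~j
  ... | i≢j | inj₁ (inj₁ i<β) = f-hub i j i<β i≢j
  ... | i≢j | inj₁ (inj₂ j<β) = Adj-sym G (f-hub j i j<β (≢-sym i≢j))
  ... | _   | inj₂ (inj₁ ij∈) = All.lookup f-es ij∈
  ... | _   | inj₂ (inj₂ ji∈) = Adj-sym G (All.lookup f-es ji∈)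

lookup-injective : ∀ {A : Set} {xs : List A} → Unique xs → ∀ i j → List.lookup xs i ≡ List.lookup xs j → i ≡ j
lookup-injective (x≢ ∷ xs!) zero    zero    eq = refl
lookup-injective (x≢ ∷ xs!) zero    (suc j) eq = contradiction eq (All.lookup x≢ (∈-lookup j))
lookup-injective (x≢ ∷ xs!) (suc i) zero    eq = contradiction (sym eq) (All.lookup x≢ (∈-lookup i))
lookup-injective (x≢ ∷ xs!) (suc i) (suc j) eq = cong suc (lookup-injective xs! i j eq)

host-embed : ∀ {n} (G : Graph n) a b zs es → Adj G a b → All (Adj G a) zs → All (Adj G b) zs → Unique zs →
  All (λ (p , q) → Adj G (List.lookup zs p) (List.lookup zs q)) es → Contains G (host (length zs) es)
host-embed {n} G a b zs es a~b a~zs b~zs zs! edges = hub-embed G 2 _ f (λ {i} {j} → f-inj i j) f-hub (AllP.map⁺ edges)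
  where
  f : Fin (2 + length zs) → Fin n
  f zero          = a
  f (suc zero)    = b
  f (suc (suc i)) = List.lookup zs i
  a~ : ∀ i → Adj G a (List.lookup zs i)
  a~ i = All.lookup a~zs (∈-lookup i)
  b~ : ∀ i → Adj G b (List.lookup zs i)
  b~ i = All.lookup b~zs (∈-lookup i)
  f-inj : ∀ i j → f i ≡ f j → i ≡ j
  f-inj zero          zero          eq = refl
  f-inj zero          (suc zero)    eq = contradiction eq (Adj⇒≢ G a~b)
  f-inj zero          (suc (suc j)) eq = contradiction eq (Adj⇒≢ G (a~ j))
  f-inj (suc zero)    zero          eq = contradiction (sym eq) (Adj⇒≢ G a~b)
  f-inj (suc zero)    (suc zero)    eq = refl
  f-inj (suc zero)    (suc (suc j)) eq = contradiction eq (Adj⇒≢ G (b~ j))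
  f-inj (suc (suc i)) zero          eq = contradiction (sym eq) (Adj⇒≢ G (a~ i))
  f-inj (suc (suc i)) (suc zero)    eq = contradiction (sym eq) (Adj⇒≢ G (b~ i))
  f-inj (suc (suc i)) (suc (suc j)) eq = cong suc (cong suc (lookup-injective zs! i j eq))
  f-hub : ∀ i j → toℕ i < 2 → i ≢ j → Adj G (f i) (f j)
  f-hub zero          zero          _ i≢j = contradiction refl i≢j
  f-hub zero          (suc zero)    _ _   = a~b
  f-hub zero          (suc (suc j)) _ _   = a~ j
  f-hub (suc zero)    zero          _ _   = Adj-sym G a~b
  f-hub (suc zero)    (suc zero)    _ i≢j = contradiction refl i≢j
  f-hub (suc zero)    (suc (suc j)) _ _   = b~ j
  f-hub (suc (suc i)) j             (s≤s (s≤s ())) _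

↑ʳ≢↑ˡ : ∀ {k m} {j : Fin m} {i : Fin k} → k ↑ʳ j ≢ i ↑ˡ m
↑ʳ≢↑ˡ {k} {m} {j} {i} eq =
  contradiction (trans (sym (splitAt-↑ʳ k m j)) (trans (cong (splitAt k) eq) (splitAt-↑ˡ k i m))) λ ()

hub-only : ∀ {A B C : Set} {x y : A} → (B ⊎ C) ⊎ (x ∈ [] ⊎ y ∈ []) → B ⊎ C
hub-only (inj₁ big)       = big
hub-only (inj₂ (inj₁ ()))
hub-only (inj₂ (inj₂ ()))

module Core (k m : ℕ) where

  Outer : Fin (k + m) → Set
  Outer x = ∀ i → x ≢ i ↑ˡ m

  core : List (Fin (k + m))
  core = map (_↑ˡ m) (allFin k)

  ∣core∣ : length core ≡ k
  ∣core∣ = trans (length-map (_↑ˡ m) (allFin k)) (length-tabulate {n = k} id)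

  ∈core : ∀ i → i ↑ˡ m ∈ core
  ∈core i = ∈-map⁺ (_↑ˡ m) (∈-allFin i)

  ∉core⇒Outer : ∀ {x} → x ∉ core → Outer x
  ∉core⇒Outer x∉ i refl = x∉ (∈core i)

  Outer⇒↑ʳ : ∀ {x} → Outer x → ∃ λ j → x ≡ k ↑ʳ j
  Outer⇒↑ʳ {x} x∉ with place k x
  ... | inner i = contradiction refl (x∉ i)
  ... | outer j = j , refl

  pad-free : ∀ H {x} → Outer x → ∀ q → ¬ Adj (pad H m) x q
  pad-free H x∉ q x~q with Outer⇒↑ʳ x∉
  ... | j , refl = pad-outer H m j q x~q

  ↑ˡ-≢ : ∀ {i j : Fin k} → i ≢ j → i ↑ˡ m ≢ j ↑ˡ m
  ↑ˡ-≢ i≢j = i≢j ∘ ↑ˡ-injective m _ _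

  first : ∀ β → β ≤ k → List (Fin (k + m))
  first β β≤k = List.tabulate {n = β} λ b → inject≤ b β≤k ↑ˡ m

  ∣first∣ : ∀ β β≤k → length (first β β≤k) ≡ β
  ∣first∣ β β≤k = length-tabulate {n = β} _

  ∈first : ∀ {β} β≤k i → toℕ i < β → i ↑ˡ m ∈ first β β≤k
  ∈first {β} β≤k i i<β = subst (λ z → z ↑ˡ m ∈ first β β≤k)
    (toℕ-injective (trans (toℕ-inject≤ _ β≤k) (toℕ-fromℕ< i<β))) (∈-tabulate⁺ (fromℕ< i<β))

  module _ (G : Graph (k + m)) where

    -- The core contains i itself and its non-neighbour j, so at most k - 2 of the neighbours of i
    -- lie in it.
    outer-picks : ∀ c {i j} → i ≢ j → ¬ Adj G (i ↑ˡ m) (j ↑ˡ m) → k + c ≤ 2 + deg G (i ↑ˡ m) →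
      ∃ λ xs → length xs ≡ c × Unique xs × All (Adj G (i ↑ˡ m)) xs × All Outer xs
    outer-picks c {i} {j} i≢j i≁j bound =
      let xs , len , xs! , u~xs , xs∉ = picks G c (i ↑ˡ m) {core} {(i ↑ˡ m) ∷ (j ↑ˡ m) ∷ []} ((↑ˡ-≢ i≢j ∷ []) ∷ [] ∷ [])
            ((∈core i , λ i~i → Adj⇒≢ G i~i refl) ∷ (∈core j , i≁j) ∷ [])
            (≤-trans (≤-reflexive (cong (_+ c) ∣core∣)) (≤-trans bound (≤-reflexive (+-comm 2 _))))
      in xs , len , xs! , u~xs , All.map ∉core⇒Outer xs∉

    outer-pick : ∀ {i} → k ≤ deg G (i ↑ˡ m) → ∃ λ x → Adj G (i ↑ˡ m) x × Outer x
    outer-pick {i} bound =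
      let x , u~x , x∉ = pick G (i ↑ˡ m) {core} {(i ↑ˡ m) ∷ []} ([] ∷ []) ((∈core i , λ i~i → Adj⇒≢ G i~i refl) ∷ [])
            (≤-trans (s≤s (≤-trans (≤-reflexive ∣core∣) bound)) (≤-reflexive (+-comm 1 _)))
      in x , u~x , ∉core⇒Outer x∉

-- The β largest vertices are to be joined to the whole core. For an edge missing at one of them, c
-- + e of its neighbours outside the core and c neighbours of the other end are what `dense` turns
-- into K_c joined to 2 + e independent vertices. The values of (β, c, e) are (3, 4, 1), (2, 3, 0),
-- (2, 2, 0), (1, 2, 0) for k = 7, 5, 4, 3.
module Fill {k m : ℕ} (β c e : ℕ) (β≤k : β ≤ k) (β≤2+e : β ≤ 2 + e) (G : Graph (k + m))
  (big-deg : ∀ i → toℕ i < β → k + (c + e) ≤ 2 + deg G (i ↑ˡ m))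
  (outer-deg : ∀ j i → deg G (k ↑ʳ j) ≤ deg G (i ↑ˡ m)) where

  open Core k m

  Big : Fin k → Set
  Big i = toℕ i < β

  target : Graph (k + m)
  target = pad (hub k β []) m

  bigs : List (Fin (k + m))
  bigs = first β β≤k

  big∈ : ∀ {i} → Big i → i ↑ˡ m ∈ bigs
  big∈ {i} = ∈first β≤k i

  Outcome : Set
  Outcome = Join G (λ _ → ⊤) c (2 + e) ⊎ Improve target G

  private
    all⊤ : {xs : List (Fin (k + m))} → All (λ _ → ⊤) xs
    all⊤ = All.tabulate λ _ → tt

    gained : ∀ {i j} → Big i → i ≢ j → ¬ Adj G (i ↑ˡ m) (j ↑ˡ m) → Gain target G (i ↑ˡ m) (j ↑ˡ m) → Outcome
    gained {i} {j} i-big i≢j i≁j gain = inj₂ (i ↑ˡ m , j ↑ˡ m , pad-adj (hub k β []) m (hub-adj k β [] i≢j i-big) , i≁j , gain)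

    small-free : ∀ {j y} → ¬ Big j → y ∉ bigs → ¬ Adj target (j ↑ˡ m) y
    small-free {j} {y} j-small y∉ j~y with place k y
    ... | outer y′ = pad-outer (hub k β []) m y′ _ (Adj-sym target j~y)
    ... | inner y′ = [ j-small , (λ y′-big → y∉ (big∈ y′-big)) ]′ (hub-only (hub-adj⁻ k β [] {j} {y′} (pad-adj⁻ (hub k β []) m j~y)))

  small-picks : ∀ b {j ws} → Unique ws → All (λ w → w ∈ bigs × ¬ Adj G (j ↑ˡ m) w) ws →
    β + b ≤ deg G (j ↑ˡ m) + length ws →
    ∃ λ ys → length ys ≡ b × Unique ys × All (Adj G (j ↑ˡ m)) ys × All (_∉ bigs) ys
  small-picks b {j} ws! inB bound =
    picks G b (j ↑ˡ m) ws! inB (≤-trans (≤-reflexive (cong (_+ b) (∣first∣ β β≤k))) bound)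

  -- Enough neighbours remain after removing the large ones; ws lists large vertices that are not adjacent.
  Roomy : Fin k → Set
  Roomy j = ∃ λ ws → Unique ws × All (λ w → w ∈ bigs × ¬ Adj G (j ↑ˡ m) w) ws × β + c ≤ deg G (j ↑ˡ m) + length ws

  roomy : ∀ {i j} → Big i → ¬ Adj G (i ↑ˡ m) (j ↑ˡ m) → β + c ≤ deg G (j ↑ˡ m) + 1 → Roomy j
  roomy {i} i-big i≁j enough = (i ↑ˡ m) ∷ [] , [] ∷ [] , (big∈ i-big , i≁j ∘ Adj-sym G) ∷ [] , enough

  fill : ∀ {i j} → Big i → i ≢ j → ¬ Adj G (i ↑ˡ m) (j ↑ˡ m) → Big j ⊎ Roomy j → Outcome
  fill {i} {j} i-big i≢j i≁j large =
    let xs , ∣xs∣ , xs! , u~xs , xs-out = outer-picks G (c + e) i≢j i≁j (big-deg i i-big)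
        ys , ∣ys∣ , ys! , v~ys , ys-free = partners
    in [ id , inj₁ ]′ (Dense.dense target G (↑ˡ-≢ i≢j) i≁j (gained i-big i≢j i≁j) c e ∣xs∣ ∣ys∣ xs! ys! u~xs v~ys
         (All.map (pad-free _) xs-out) ys-free tt tt all⊤ all⊤)
    where
    -- If j is large too, its partners are taken outside the core. Otherwise they have to avoid only
    -- the large vertices, as j has no other neighbours in the target.
    partners : ∃ λ ys → length ys ≡ c × Unique ys × All (Adj G (j ↑ˡ m)) ys × All (λ y → ¬ Adj target (j ↑ˡ m) y) ys
    partners with toℕ j <? β
    ... | yes j-big =
      let ys , len , ys! , v~ys , ys-out = outer-picks G c (≢-sym i≢j) (i≁j ∘ Adj-sym G)
            (≤-trans (+-monoʳ-≤ k (m≤m+n c e)) (big-deg j j-big))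
      in ys , len , ys! , v~ys , All.map (λ y-out → pad-free _ y-out _ ∘ Adj-sym target) ys-out
    ... | no j-small =
      let _ , ws! , inB , room = [ (λ j-big → contradiction j-big j-small) , id ]′ large
          ys , len , ys! , v~ys , ys∉ = small-picks c {j} ws! inB room
      in ys , len , ys! , v~ys , All.map (small-free j-small) ys∉

  full : ∀ i j → Big i → i ≢ j → Big j ⊎ β + c ≤ deg G (j ↑ˡ m) + 1 → Outcome ⊎ Adj G (i ↑ˡ m) (j ↑ˡ m)
  full i j i-big i≢j large with adj? G (i ↑ˡ m) (j ↑ˡ m)
  ... | yes i~j = inj₂ i~j
  ... | no i≁j  = inj₁ (fill i-big i≢j i≁j (Sum.map₂ (roomy i-big i≁j) large))

  enough : ∀ {j} → suc (c + e) ≤ deg G (j ↑ˡ m) → β + c ≤ deg G (j ↑ˡ m) + 1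
  enough {j} large = begin
    β + c                ≤⟨ +-monoˡ-≤ c β≤2+e ⟩
    2 + e + c            ≡⟨ cong (2 +_) (+-comm e c) ⟩
    1 + suc (c + e)      ≤⟨ s≤s large ⟩
    1 + deg G (j ↑ˡ m)   ≡⟨ +-comm 1 _ ⟩
    deg G (j ↑ˡ m) + 1   ∎
    where open ≤-Reasoning

  record Hub (xs : List (Fin (k + m))) (y : Fin (k + m)) : Set where
    field
      to-picks : All (Adj G y) xs
      to-bigs  : ∀ i → Big i → Adj G y (i ↑ˡ m)

  -- A neighbour of j outside the core would have degree at least 1 + c + e, and then so would j.
  hubs : ∀ {i j ys} → Big i → ¬ Big j → ¬ Adj G (i ↑ˡ m) (j ↑ˡ m) →
    Unique ys → All (Adj G (j ↑ˡ m)) ys → All (_∉ bigs) ys →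
    Outcome ⊎ ∃ λ xs → length xs ≡ c + e × All (Adj G (i ↑ˡ m)) xs × All Outer xs × AllPairs (Adj G) ys × All (Hub xs) ys
  hubs {i} {j} {ys} i-big j-small i≁j ys! v~ys ys∉ =
    Dense.complete-clique target G (↑ˡ-≢ i≢j) i≁j (gained i-big i≢j i≁j) xs! ys! u~xs v~ys
      (All.map (pad-free _) xs-out) (All.map (small-free j-small) ys∉) >>= λ where
      (complete , cl) →
        all-try ys (λ y∈ → is-hub complete y∈) >>= λ hubs →
        ys-clique cl hubs >>= λ clique →
        inj₂ (xs , ∣xs∣ , u~xs , xs-out , clique , All.map proj₁ hubs)
    where
    i≢j : i ≢ j
    i≢j refl = j-small i-big
    chosen = outer-picks G (c + e) i≢j i≁j (big-deg i i-big)
    xs = proj₁ chosen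
    ∣xs∣ = proj₁ (proj₂ chosen)
    xs! = proj₁ (proj₂ (proj₂ chosen))
    u~xs = proj₁ (proj₂ (proj₂ (proj₂ chosen)))
    xs-out = proj₂ (proj₂ (proj₂ (proj₂ chosen)))
    ↑ˡ∉xs : ∀ {p} → All (p ↑ˡ m ≢_) xs
    ↑ˡ∉xs = All.map (λ x-out eq → x-out _ (sym eq)) xs-out
    is-hub : Dense.Complete target G (↑ˡ-≢ i≢j) i≁j (gained i-big i≢j i≁j) xs ys → ∀ {y} → y ∈ ys → Outcome ⊎ (Hub xs y × y ∉ xs)
    is-hub complete {y} y∈ with place k y
    ... | outer y′ = inj₁ (fill i-big i≢j i≁j (inj₂ (roomy i-big i≁j (enough (≤-trans (≤-trans (s≤s (≤-reflexive (sym ∣xs∣))) crowded) (outer-deg y′ j))))))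
      where
      close : All (Near G y) xs
      close = All.tabulate λ x∈ → Sum.map id (Adj-sym G) (complete x∈ y∈)
      y~j : Near G y (j ↑ˡ m)
      y~j = inj₂ (Adj-sym G (All.lookup v~ys y∈))
      crowded : suc (length xs) ≤ deg G y
      crowded with y ∈? xs
      -- N[y] contains `xs` and j. One further vertex is i if y belongs to `xs`, and y itself if
      -- not.
      ... | yes y∈xs with s≤s le ← near-unique G y {(j ↑ˡ m) ∷ (i ↑ˡ m) ∷ xs} ((≢-sym (↑ˡ-≢ i≢j) ∷ ↑ˡ∉xs) ∷ ↑ˡ∉xs ∷ xs!)
                (y~j ∷ inj₂ (Adj-sym G (All.lookup u~xs y∈xs)) ∷ close) = le
      ... | no y∉xs with s≤s le ← near-unique G y {(j ↑ˡ m) ∷ y ∷ xs}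
                ((≢-sym ↑ʳ≢↑ˡ ∷ ↑ˡ∉xs) ∷ All.tabulate (λ x∈ y≡x → y∉xs (subst (_∈ xs) (sym y≡x) x∈)) ∷ xs!)
                (y~j ∷ inj₁ refl ∷ close) = le
    ... | inner q =
      -- An inner neighbour q is adjacent to j and to all of `xs`; its degree is then large enough
      -- for `full`, which joins it to every large vertex or ends the argument.
      all-bigs (λ p p-big → full p q p-big (λ { refl → q-small p-big }) (inj₂ (enough q-large))) >>= λ to-bigs →
      inj₂ (record { to-picks = y~xs ; to-bigs = λ p p-big → Adj-sym G (to-bigs p p-big) } , λ y∈xs → All.lookup ↑ˡ∉xs y∈xs refl)
      where
      q-small : ¬ Big q
      q-small q-big = All.lookup ys∉ y∈ (big∈ q-big)
      y~xs : All (Adj G (q ↑ˡ m)) xs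
      y~xs = All.tabulate λ x∈ → case complete x∈ y∈ of λ where
        (inj₁ refl) → contradiction refl (All.lookup ↑ˡ∉xs x∈)
        (inj₂ x~y)  → Adj-sym G x~y
      q-large : suc (c + e) ≤ deg G (q ↑ˡ m)
      q-large = ≤-trans (s≤s (≤-reflexive (sym ∣xs∣)))
        (unique⇒≤deg G (q ↑ˡ m) {(j ↑ˡ m) ∷ xs} (↑ˡ∉xs ∷ xs!) (Adj-sym G (All.lookup v~ys y∈) ∷ y~xs))
      all-bigs : {P : Fin k → Set} → (∀ p → Big p → Outcome ⊎ P p) → Outcome ⊎ (∀ p → Big p → P p)
      all-bigs {P} f = all-try {P = λ p → Big p → P p} (allFin k) (λ {p} _ → at p) >>= λ ps → inj₂ λ p → All.lookup ps (∈-allFin p)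
        where
        at : ∀ p → Outcome ⊎ (Big p → P p)
        at p with toℕ p <? β
        ... | yes p-big = f p p-big >>= λ holds → inj₂ λ _ → holds
        ... | no p-small = inj₂ λ p-big → contradiction p-big p-small
    ys-clique : AllPairs (Adj G) xs ⊎ AllPairs (Adj G) ys → All (λ y → Hub xs y × y ∉ xs) ys → Outcome ⊎ AllPairs (Adj G) ys
    ys-clique (inj₂ clique) _ = inj₂ clique
    ys-clique (inj₁ clique) [] = inj₂ []
    -- If `xs` is the clique, y is a second vertex besides i that is joined to all of it.
    ys-clique (inj₁ clique) ((hub-y , y∉xs) ∷ _) =
      inj₁ (inj₁ (clique-join c e ∣xs∣ xs! clique u~xs y∉xs (Adj⇒≢ G (Adj-sym G (Hub.to-bigs hub-y i i-big)))
        (Hub.to-picks hub-y) tt all⊤ tt))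

module _ {k m : ℕ} where
  open Core k m

  -- If a is adjacent to neither or only one of x and y, it still has a neighbour outside the core and
  -- away from y which can be used in a switch.
  attract : (H : Graph k) (G : Graph (k + m)) {R : Set} {r v a : Fin k} {x y : Fin (k + m)} → let ι = _↑ˡ m in
    (Gain (pad H m) G (ι r) (ι v) → R) → r ≢ v → ¬ Adj G (ι r) (ι v) →
    Adj G (ι r) x → ¬ Adj (pad H m) (ι r) x → Adj G (ι v) y → ¬ Adj (pad H m) (ι v) y →
    a ≢ r → a ≢ v → ι a ≢ x → k + deg G y < deg G (ι a) + 3 → R ⊎ Adj G x (ι a)
  attract H G {R} {r} {v} {a} {x} {y} gain r≢v r≁v r~x rx∉T v~y vy∉T a≢r a≢v a≢x bound
    with adj? G x (a ↑ˡ m) | near? G x y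
  ... | yes x~a | _ = inj₂ x~a
  ... | no _ | no x-y = inj₁ (gain (switch₂ (pad H m) G (↑ˡ-≢ r≢v) r≁v r~x rx∉T v~y vy∉T (x-y ∘ inj₁ ∘ sym) (x-y ∘ inj₂)))
  ... | no x≁a | yes x-y =
    let w , a~w , w∉core , y-w = escape G (a ↑ˡ m) y {core} {(a ↑ˡ m) ∷ []} {(v ↑ˡ m) ∷ e ∷ f ∷ []}
          ([] ∷ []) ((v≢e ∷ v≢f ∷ []) ∷ (e≢f ∷ []) ∷ [] ∷ [])
          ((∈core a , λ a~a → Adj⇒≢ G a~a refl) ∷ [])
          ((inj₂ (Adj-sym G v~y) , inj₂ (∈core v)) ∷ e-near ∷ f-near ∷ [])
          enough
    in inj₁ (gain (switch₃ (pad H m) G (↑ˡ-≢ r≢v) r≁v r~x rx∉T v~y vy∉T a~w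
         (pad-free H (∉core⇒Outer w∉core) _ ∘ Adj-sym (pad H m)) a≢x x≁a (y-w ∘ inj₁) (y-w ∘ inj₂)))
    where
    enough : length core + suc (deg G y) < deg G (a ↑ˡ m) + 4
    enough = begin-strict
      length core + suc (deg G y)   ≡⟨ cong (_+ suc (deg G y)) ∣core∣ ⟩
      k + suc (deg G y)             ≡⟨ +-suc k (deg G y) ⟩
      suc (k + deg G y)             <⟨ s≤s bound ⟩
      suc (deg G (a ↑ˡ m) + 3)      ≡⟨ +-suc (deg G (a ↑ˡ m)) 3 ⟨
      deg G (a ↑ˡ m) + 4            ∎
      where open ≤-Reasoning
    -- With v, the vertices e and f are three members of N[y] that are in the core or not adjacent
    -- to a: e is a itself if y ~ a, otherwise y; f is x if it differs from y, otherwise r.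
    e : Fin (k + m)
    e = if adj G y (a ↑ˡ m) then a ↑ˡ m else y
    e-near : Near G y e × (¬ Adj G (a ↑ˡ m) e ⊎ e ∈ core)
    e-near with adj G y (a ↑ˡ m) in eq
    ... | true  = inj₂ eq , inj₁ λ a~a → Adj⇒≢ G a~a refl
    ... | false = inj₁ refl , inj₁ λ a~y → contradiction (trans (sym (Adj-sym G a~y)) eq) λ ()
    v≢e : v ↑ˡ m ≢ e
    v≢e with adj G y (a ↑ˡ m)
    ... | true  = ↑ˡ-≢ (≢-sym a≢v)
    ... | false = Adj⇒≢ G v~y
    f : Fin (k + m)
    f = if does (y ≟ x) then r ↑ˡ m else x
    f-near : Near G y f × (¬ Adj G (a ↑ˡ m) f ⊎ f ∈ core)
    f-near with y ≟ x
    ... | yes refl = inj₂ (Adj-sym G r~x) , inj₂ (∈core r)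
    ... | no y≢x   = [ (λ y≡x → contradiction y≡x y≢x) , inj₂ ∘ Adj-sym G ]′ x-y , inj₁ (x≁a ∘ Adj-sym G)
    v≢f : v ↑ˡ m ≢ f
    v≢f with y ≟ x
    ... | yes _ = ↑ˡ-≢ (≢-sym r≢v)
    ... | no _  = λ { refl → r≁v r~x }
    e≢f : e ≢ f
    e≢f with adj G y (a ↑ˡ m) | y ≟ x
    ... | true  | yes _  = ↑ˡ-≢ a≢r
    ... | true  | no _   = a≢x
    ... | false | yes _  = λ { refl → r≁v (Adj-sym G v~y) }
    ... | false | no y≢x = y≢x

-- The vertices 0, ..., b are joined to the whole core, and r and v have no other neighbours in it.
-- For the argument of `Final`, `As` consists of 0, ..., b - 1, whose large degrees allow `attract`,
-- and c is vertex b, whose degree k already yields a neighbour outside the core.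
module FinalStep {k m : ℕ} (G : Graph (k + m)) (b D : ℕ)
  (full : ∀ i j → i ≢ j → toℕ i < suc b → Adj G (i ↑ˡ m) (j ↑ˡ m))
  (outer-deg : ∀ j i → deg G (k ↑ʳ j) ≤ deg G (i ↑ˡ m))
  (outer≤D : ∀ j → deg G (k ↑ʳ j) ≤ D)
  (big-deg : ∀ i → toℕ i < b → k + D < deg G (i ↑ˡ m) + 3)
  (c : Fin k) (c≡b : toℕ c ≡ b) (c-deg : k ≤ deg G (c ↑ˡ m)) where

  open Core k m

  private
    T = pad (complete k) m

    As : Fin (k + m) → Set
    As p = ∃ λ i → p ≡ i ↑ˡ m × toℕ i < b

  final-edge : ∀ r v → r ≢ v → ¬ toℕ r < suc b → ¬ toℕ v < suc b →
    suc b < deg G (r ↑ˡ m) → suc b < deg G (v ↑ˡ m) →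
    (∀ i → Adj G (r ↑ˡ m) (i ↑ˡ m) → toℕ i < suc b) → (∀ i → Adj G (v ↑ˡ m) (i ↑ˡ m) → toℕ i < suc b) →
    Gain T G (r ↑ˡ m) (v ↑ˡ m)
  final-edge r v r≢v r-small v-small dr dv r-iso v-iso =
    let x , r~x , x-out = partner r dr r-iso
        y , v~y , y-out = partner v dv v-iso
        w , c~w , w-out = outer-pick G c-deg
    in Final.final T G Outer As (pad-free (complete k)) (c ↑ˡ m) (λ c-out → c-out c refl)
         (↑ˡ-≢ r≢v) r≁v id (side r v r≢v r-small v-small r-iso id r≁v v~y y-out)
         (side v r (≢-sym r≢v) v-small r-small v-iso (gain-sym {T = T} {G}) (r≁v ∘ Adj-sym G) r~x x-out)
         x-out r~x y-out v~y w-out c~w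
    where
    r≁v : ¬ Adj G (r ↑ˡ m) (v ↑ˡ m)
    r≁v r~v = v-small (r-iso v r~v)
    R = Gain T G (r ↑ˡ m) (v ↑ˡ m)
    partner : ∀ r → suc b < deg G (r ↑ˡ m) → (∀ i → Adj G (r ↑ˡ m) (i ↑ˡ m) → toℕ i < suc b) →
      ∃ λ x → Adj G (r ↑ˡ m) x × Outer x
    partner r dr r-iso =
      let x , r~x , x∉ = pick G (r ↑ˡ m) {first (suc b) b<k} {[]} [] [] (≤-trans (s≤s (≤-reflexive (∣first∣ (suc b) b<k)))
            (≤-trans dr (≤-reflexive (sym (+-identityʳ _)))))
      in x , r~x , λ i x≡i → x∉ (subst (_∈ first (suc b) b<k) (sym x≡i)
           (∈first b<k i (r-iso i (subst (Adj G (r ↑ˡ m)) x≡i r~x))))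
      where
      b<k : suc b ≤ k
      b<k = subst (_< k) c≡b (toℕ<n c)
    side : ∀ r v → r ≢ v → ¬ toℕ r < suc b → ¬ toℕ v < suc b → (∀ i → Adj G (r ↑ˡ m) (i ↑ˡ m) → toℕ i < suc b) →
      (Gain T G (r ↑ˡ m) (v ↑ˡ m) → R) → ¬ Adj G (r ↑ˡ m) (v ↑ˡ m) →
      ∀ {y} → Adj G (v ↑ˡ m) y → Outer y →
      Final.Side T G {R} Outer As (pad-free (complete k)) (c ↑ˡ m) (λ c-out → c-out c refl) (r ↑ˡ m)
    side r v r≢v r-small v-small r-iso gain r≁v {y} v~y y-out = record
      { r∉Out  = λ r-out → r-out r refl
      ; r~c    = Adj-sym G (full c r (λ { refl → r-small (s≤s (≤-reflexive c≡b)) }) (s≤s (≤-reflexive c≡b)))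
      ; split  = split
      ; small  = λ x x-out → case Outer⇒↑ʳ x-out of λ { (j , refl) → outer-deg j r }
      ; As-adj = λ { x _ x-out r~x (a , refl , a<b) →
          attract (complete k) G gain r≢v r≁v r~x (pad-free (complete k) x-out _ ∘ Adj-sym T)
            v~y (pad-free (complete k) y-out _ ∘ Adj-sym T)
            (λ { refl → r-small (≤-trans a<b (n≤1+n b)) }) (λ { refl → v-small (≤-trans a<b (n≤1+n b)) })
            (λ a≡x → x-out a (sym a≡x))
            (≤-<-trans (+-monoʳ-≤ k (case Outer⇒↑ʳ y-out of λ { (j , refl) → outer≤D j })) (big-deg a a<b)) }
      }
      where
      split : ∀ p → Adj G (r ↑ˡ m) p → (As p ⊎ p ≡ c ↑ˡ m) ⊎ Outer p
      split p r~p with place k p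
      ... | outer j = inj₂ λ i → ↑ʳ≢↑ˡ
      ... | inner i with r-iso i r~p
      ... | s≤s i≤b with toℕ i <? b
      ... | yes i<b = inj₁ (inj₁ (i , refl , i<b))
      ... | no i≮b  = inj₁ (inj₂ (cong (_↑ˡ m) (toℕ-injective (trans (≤-antisym i≤b (≮⇒≥ i≮b)) (sym c≡b)))))

-- Vertex 0 has very large degree. Whenever no switch applies, the vertices that obstruct adding an edge at
-- vertex 1 are all adjacent to vertex 0.
module Apex {c m : ℕ} (t : ℕ) (G : Graph (4 + c + m))
  (d₀ : 4 + c + t < deg G zero + 3) (d₁ : 4 + c + suc c ≤ 2 + deg G (suc zero))
  (inner-deg : ∀ i → 2 + suc c ≤ deg G (suc (suc i) ↑ˡ m) + 1)
  (rest-deg : ∀ p → deg G (suc p) ≤ t) where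

  open Core (4 + c) m

  private
    k : ℕ
    k = 4 + c
    H = hub k 2 []
    T = pad H m
    ι : Fin k → Fin (k + m)
    ι = _↑ˡ m
    bigs : List (Fin (k + m))
    bigs = zero ∷ suc zero ∷ []

    a₀ : Fin k
    a₀ = zero

  Outcome : Set
  Outcome = Join G (λ _ → ⊤) (2 + c) 2 ⊎ Improve T G

  private
    bound : ∀ {y} → y ≢ zero → k + deg G y < deg G zero + 3
    bound {zero}  y≢0 = contradiction refl y≢0
    bound {suc y} _   = ≤-<-trans (+-monoʳ-≤ k (rest-deg y)) d₀

    small-free : ∀ j {y} → y ∉ bigs → ¬ Adj T (ι (suc (suc j))) y
    small-free j {y} y∉ j~y with place k y
    ... | outer y′                 = pad-outer H m y′ _ (Adj-sym T j~y)
    ... | inner zero               = y∉ (here refl)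
    ... | inner (suc zero)         = y∉ (there (here refl))
    ... | inner (suc (suc y′))     = [ (λ { (s≤s (s≤s ())) }) , (λ { (s≤s (s≤s ())) }) ]′
            (hub-only (hub-adj⁻ k 2 [] {suc (suc j)} {suc (suc y′)} (pad-adj⁻ H m j~y)))

    outer-free : ∀ {y} → Outer y → ∀ q → ¬ Adj T q y
    outer-free y-out q = pad-free H y-out q ∘ Adj-sym T

    gained : ∀ {i j : Fin k} → i ≢ j → toℕ i < 2 → ¬ Adj G (ι i) (ι j) → Gain T G (ι i) (ι j) → Outcome
    gained i≢j i<2 i≁j gain = inj₂ (_ , _ , pad-adj H m (hub-adj k 2 [] i≢j i<2) , i≁j , gain)

    -- Vertex 0 has so many neighbours that one outside the core escapes from N[y], so the two-edge
    -- switch always succeeds. In the count v saves two: as a core vertex not adjacent to 0, and as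
    -- a core vertex in N[y].
    reach₀ : ∀ {v y} → a₀ ≢ v → ¬ Adj G zero (ι v) → Adj G (ι v) y → ¬ Adj T (ι v) y → Outcome
    reach₀ {v} {y} 0≢v 0≁v v~y vy∉T =
      let w , 0~w , w∉core , y-w = escape G zero y {core} {zero ∷ ι v ∷ []} {ι v ∷ e ∷ []}
            ((↑ˡ-≢ 0≢v ∷ []) ∷ [] ∷ []) ((v≢e ∷ []) ∷ [] ∷ [])
            ((∈core zero , λ 0~0 → Adj⇒≢ G 0~0 refl) ∷ (∈core v , 0≁v) ∷ [])
            ((inj₂ (Adj-sym G v~y) , inj₂ (∈core v)) ∷ e-near ∷ [])
            enough
          w-out = ∉core⇒Outer w∉core
      in gained 0≢v (s≤s z≤n) 0≁v (switch₂ T G (↑ˡ-≢ 0≢v) 0≁v 0~w (outer-free w-out _) v~y vy∉T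
           (y-w ∘ inj₁) (y-w ∘ inj₂ ∘ Adj-sym G))
      where
      y≢0 : y ≢ zero
      y≢0 refl = 0≁v (Adj-sym G v~y)
      enough : length core + suc (deg G y) < deg G zero + 4
      enough = ≤-<-trans (≤-reflexive (trans (cong (_+ suc (deg G y)) ∣core∣) (+-suc k (deg G y))))
        (<-≤-trans (s≤s (bound y≢0)) (≤-reflexive (sym (+-suc (deg G zero) 3))))
      e : Fin (k + m)
      e = if adj G y zero then zero else y
      e-near : Near G y e × (¬ Adj G zero e ⊎ e ∈ core)
      e-near with adj G y zero in eq
      ... | true  = inj₂ eq , inj₁ λ 0~0 → Adj⇒≢ G 0~0 refl
      ... | false = inj₁ refl , inj₁ λ 0~y → contradiction (trans (sym (Adj-sym G 0~y)) eq) λ ()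
      v≢e : ι v ≢ e
      v≢e = away (adj G y zero)
        where
        away : ∀ b → ι v ≢ (if b then zero else y)
        away true  = ↑ˡ-≢ {v} {a₀} (≢-sym 0≢v)
        away false = Adj⇒≢ G v~y

    some : ∀ {A : Set} {n : ℕ} {P : A → Set} {xs : List A} → length xs ≡ suc n → All P xs → ∃ λ x → x ∈ xs × P x
    some {xs = x ∷ _} _ (px ∷ _) = x , here refl , px

  at-0 : ∀ j → a₀ ≢ j → ¬ Adj G zero (ι j) → Outcome
  at-0 zero 0≢j _ = contradiction refl 0≢j
  at-0 (suc zero) 0≢1 0≁1 =
    let ys , ∣ys∣ , _ , 1~ys , ys-out = outer-picks G (suc c) {suc zero} {zero} (≢-sym 0≢1) (0≁1 ∘ Adj-sym G) d₁
        y , y∈ , 1~y = some ∣ys∣ 1~ys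
    in reach₀ 0≢1 0≁1 1~y (outer-free (All.lookup ys-out y∈) _)
  at-0 (suc (suc j)) 0≢j 0≁j =
    let y , j~y , y∉ = pick G (ι (suc (suc j))) {bigs} {zero ∷ []} ([] ∷ []) ((here refl , 0≁j ∘ Adj-sym G) ∷ [])
          (≤-trans (s≤s (s≤s (s≤s z≤n))) (inner-deg j))
    in reach₀ 0≢j 0≁j j~y (small-free j y∉)

  at-1 : ∀ j → ¬ Adj G (suc zero) (ι (suc (suc j))) → Outcome
  at-1 j 1≁j with adj? G zero (suc zero) | adj? G zero (ι (suc (suc j)))
  -- Edges at vertex 0 are repaired before those at 1, because the argument for 1 takes place inside
  -- the neighbourhood of 0.
  ... | no 0≁1 | _ = at-0 (suc zero) (λ ()) 0≁1
  ... | yes _ | no 0≁j = at-0 (suc (suc j)) (λ ()) 0≁j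
  ... | yes 0~1 | yes 0~j =
    let xs , ∣xs∣ , xs! , 1~xs , xs-out = outer-picks G (suc c) {suc zero} {suc (suc j)} 1≢j 1≁j d₁
        ys , ∣ys∣ , ys! , j~ys , ys∉ = picks G (suc c) (ι (suc (suc j))) {bigs} {suc zero ∷ []} ([] ∷ [])
          ((there (here refl) , 1≁j ∘ Adj-sym G) ∷ []) (inner-deg j)
        x₀ , x₀∈ , 1~x₀ = some ∣xs∣ 1~xs
        y₀ , y₀∈ , j~y₀ = some ∣ys∣ j~ys
        x₀-out = All.lookup xs-out x₀∈
    in [ id , id ]′ (
    all-try xs (λ {x} x∈ → attract H G {a = a₀} gain 1≢j 1≁j (All.lookup 1~xs x∈) (outer-free (All.lookup xs-out x∈) _)
      j~y₀ (small-free j (All.lookup ys∉ y₀∈)) (λ ()) (λ ()) (λ 0≡x → All.lookup xs-out x∈ zero (sym 0≡x))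
      (bound λ y≡0 → All.lookup ys∉ y₀∈ (here y≡0))) >>= λ xs~0 →
    all-try ys (λ {y} y∈ → attract H G {a = a₀} (λ g → gain (gain-sym {T = T} {G} g)) (≢-sym 1≢j) (1≁j ∘ Adj-sym G) (All.lookup j~ys y∈) (small-free j (All.lookup ys∉ y∈))
      1~x₀ (outer-free x₀-out _) (λ ()) (λ ()) (λ 0≡y → All.lookup ys∉ y∈ (here (sym 0≡y)))
      (bound (x₀-out zero))) >>= λ ys~0 →
    -- All vertices involved are adjacent to 0, so the join is found inside its neighbourhood and 0
    -- enlarges the centre by one.
    Dense.dense T G {suc zero} {ι (suc (suc j))} (↑ˡ-≢ 1≢j) 1≁j gain {Adj G zero} (suc c) 0
      (trans ∣xs∣ (sym (+-identityʳ _))) ∣ys∣ xs! ys! 1~xs j~ys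
      (All.map (pad-free H) xs-out) (All.map (small-free j) ys∉) 0~1 0~j (All.map (Adj-sym G) xs~0) (All.map (Adj-sym G) ys~0) >>= λ where
        (join centre rim ∣c∣ ∣r∣ clique rim! joined 0~centre 0~rim) →
          inj₂ (inj₁ (join (zero ∷ centre) rim (cong suc ∣c∣) ∣r∣ (0~centre ∷ clique) rim!
            (All.zipWith (λ { (r~0 , r~c) → r~0 ∷ r~c }) (All.map (Adj-sym G) 0~rim , joined))
            (All.tabulate λ _ → tt) (All.tabulate λ _ → tt))))
    where
    1≢j : _≢_ {A = Fin k} (suc zero) (suc (suc j))
    1≢j ()
    gain : Gain T G (suc zero) (ι (suc (suc j))) → Outcome
    gain = gained 1≢j (s≤s (s≤s z≤n)) 1≁j

  step : ∀ i j → toℕ i < 2 → i ≢ j → ¬ Adj G (ι i) (ι j) → Outcome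
  step zero          j             _ i≢j i≁j = at-0 j i≢j i≁j
  step (suc zero)    zero          _ i≢j i≁j = at-0 (suc zero) (λ ()) (i≁j ∘ Adj-sym G)
  step (suc zero)    (suc zero)    _ i≢j i≁j = contradiction refl i≢j
  step (suc zero)    (suc (suc j)) _ i≢j i≁j = at-1 j i≁j
  step (suc (suc i)) j             (s≤s (s≤s ()))

-- Degree bounds

deg≤ : ∀ {n} (G : Graph (suc n)) i → deg G i ≤ n
deg≤ {n} G i = ≤-trans (∑-mono at) (≤-reflexive (deg-complete n i))
  where
  at : ∀ j → ⟦ adj G i j ⟧ ≤ ⟦ not (does (i ≟ j)) ⟧
  at j with i ≟ j
  ... | yes refl rewrite irrefl G i = z≤n
  ... | no _ = ⟦⟧≤1 _

-- A weak Erdős-Gallai inequality with the outer degrees added on both sides: the pairs inside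
-- number at most (b + 1) b, and the edges leaving are counted by the outer degrees.
∑deg≤ : ∀ b m (G : Graph (suc b + m)) → ∑deg G ≤ suc b * b + 2 * ∑ (λ j → deg G (suc b ↑ʳ j))
∑deg≤ b m G = begin
  ∑deg G                                                        ≡⟨ ∑-split (suc b) (deg G) ⟩
  ∑ (λ i → deg G (i ↑ˡ m)) + ∑deg-outer
    ≡⟨ cong (_+ ∑deg-outer) (∑-cong λ i → ∑-split (suc b) (λ p → ⟦ adj G (i ↑ˡ m) p ⟧)) ⟩
  ∑ (λ i → ∑ (within i) + ∑ (across i)) + ∑deg-outer           ≡⟨ cong (_+ ∑deg-outer) (∑-distrib-+ (λ i → ∑ (within i)) (λ i → ∑ (across i))) ⟩
  ∑ (λ i → ∑ (within i)) + ∑ (λ i → ∑ (across i)) + ∑deg-outer  ≤⟨ +-monoˡ-≤ ∑deg-outer (+-mono-≤ inside outside) ⟩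
  suc b * b + ∑deg-outer + ∑deg-outer                           ≡⟨ double (suc b * b) ∑deg-outer ⟩
  suc b * b + 2 * ∑deg-outer                                    ∎
  where
  open ≤-Reasoning
  ∑deg-outer = ∑ (λ j → deg G (suc b ↑ʳ j))
  within : Fin (suc b) → Fin (suc b) → ℕ
  within i p = ⟦ adj G (i ↑ˡ m) (p ↑ˡ m) ⟧
  across : Fin (suc b) → Fin m → ℕ
  across i j = ⟦ adj G (i ↑ˡ m) (suc b ↑ʳ j) ⟧
  double : ∀ p q → p + q + q ≡ p + 2 * q
  double = solve-∀
  induced : Graph (suc b)
  induced = record
    { adj    = λ i p → adj G (i ↑ˡ m) (p ↑ˡ m)
    ; sym    = λ i p → adj-sym G (i ↑ˡ m) (p ↑ˡ m)
    ; irrefl = λ i → irrefl G (i ↑ˡ m)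
    }
  inside : ∑ (λ i → ∑ (within i)) ≤ suc b * b
  inside = ≤-trans (∑-mono (deg≤ induced)) (≤-reflexive (∑-const (suc b) b))
  outside : ∑ (λ i → ∑ (across i)) ≤ ∑deg-outer
  outside = ≤-trans (≤-reflexive (∑-comm across)) (∑-mono λ j → ≤-trans
    (≤-trans (≤-reflexive (∑-cong λ i → cong ⟦_⟧ (adj-sym G (i ↑ˡ m) (suc b ↑ʳ j)))) (m≤m+n _ _))
    (≤-reflexive (sym (∑-split (suc b) (λ p → ⟦ adj G (suc b ↑ʳ j) p ⟧)))))

Sorted : ∀ {n} → (Fin n → ℕ) → Set
Sorted d = ∀ i j → toℕ i ≤ toℕ j → d j ≤ d i

-- The first degree is at most n - 1 and accounts for the 1 in 1 + t. With t = k - 2 this secures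
-- the second hub of the host.
second-degree : ∀ {n} (G : Graph (2 + n)) → Sorted (deg G) → ∀ t → (1 + t) * suc n < ∑deg G → t < deg G (suc zero)
second-degree {n} G sorted t bound = ≰⇒> λ d₁≤t → contradiction bound (≤⇒≯ (begin
  deg G zero + ∑ (λ p → deg G (suc p))  ≤⟨ +-mono-≤ (deg≤ G zero) (∑-mono λ p → ≤-trans (sorted (suc zero) (suc p) (s≤s z≤n)) d₁≤t) ⟩
  suc n + ∑ {suc n} (λ _ → t)           ≡⟨ cong (suc n +_) (trans (∑-const (suc n) t) (*-comm (suc n) t)) ⟩
  (1 + t) * suc n                       ∎))
  where open ≤-Reasoning

-- If all degrees beyond the first b + 1 were at most t, `∑deg≤` would bound the sum by b + 1 times
-- one less than the number of vertices. With b + 1 = k - 1 the conclusion concerns the last core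
-- vertex, and t + 1 is the largest degree of the host outside its hubs.
core-degree : ∀ b {m} (G : Graph (suc b + suc m)) → Sorted (deg G) → ∀ t → 2 * t ≤ suc b →
  suc b * (b + suc m) < ∑deg G → t < deg G (suc b ↑ʳ zero)
core-degree b {m} G sorted t 2t≤ bound = ≰⇒> λ d≤t → contradiction bound (≤⇒≯ (begin
  ∑deg G                                               ≤⟨ ∑deg≤ b (suc m) G ⟩
  suc b * b + 2 * ∑ (λ j → deg G (suc b ↑ʳ j))         ≤⟨ +-monoʳ-≤ (suc b * b) (*-monoʳ-≤ 2 (∑-mono λ j →
                                                           ≤-trans (sorted (suc b ↑ʳ zero) (suc b ↑ʳ j) (order j)) d≤t)) ⟩
  suc b * b + 2 * ∑ {suc m} (λ _ → t)                  ≡⟨ cong (λ s → suc b * b + 2 * s) (∑-const (suc m) t) ⟩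
  suc b * b + 2 * (suc m * t)                          ≡⟨ cong (suc b * b +_) (assoc m t) ⟩
  suc b * b + 2 * t * suc m                            ≤⟨ +-monoʳ-≤ (suc b * b) (*-monoˡ-≤ (suc m) 2t≤) ⟩
  suc b * b + suc b * suc m                            ≡⟨ *-distribˡ-+ (suc b) b (suc m) ⟨
  suc b * (b + suc m)                                  ∎))
  where
  open ≤-Reasoning
  assoc : ∀ m t → 2 * (suc m * t) ≡ 2 * t * suc m
  assoc = solve-∀
  order : ∀ j → toℕ (suc b ↑ʳ zero {m}) ≤ toℕ (suc b ↑ʳ j)
  order j = ≤-trans (≤-reflexive (trans (toℕ-↑ʳ (suc b) zero) (+-identityʳ (suc b))))
    (≤-trans (m≤m+n (suc b) (toℕ j)) (≤-reflexive (sym (toℕ-↑ʳ (suc b) j))))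

module _ {k m : ℕ} {d : Fin (suc k + m) → ℕ} (sorted : Sorted d) where

  inner≤inner : ∀ {i j : Fin (suc k)} → toℕ i ≤ toℕ j → d (j ↑ˡ m) ≤ d (i ↑ˡ m)
  inner≤inner i≤j = sorted _ _ (≤-trans (≤-reflexive (toℕ-↑ˡ _ m)) (≤-trans i≤j (≤-reflexive (sym (toℕ-↑ˡ _ m)))))

  outer≤inner : ∀ (j : Fin m) (i : Fin (suc k)) → d (suc k ↑ʳ j) ≤ d (i ↑ˡ m)
  outer≤inner j i = sorted _ _ (≤-trans (≤-reflexive (toℕ-↑ˡ i m))
    (≤-trans (<⇒≤ (toℕ<n i)) (≤-trans (m≤m+n (suc k) (toℕ j)) (≤-reflexive (sym (toℕ-↑ʳ (suc k) j))))))

excess₂ : ∀ {n} (d : Fin (2 + n) → ℕ) t → (∀ p → d (suc (suc p)) ≤ t) →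
  ∑ (λ p → d p ∸ t) ≡ (d zero ∸ t) + (d (suc zero) ∸ t)
excess₂ d t small = cong (d zero ∸ t +_)
  (trans (cong (d (suc zero) ∸ t +_) (∑-zero λ p → m≤n⇒m∸n≡0 (small p))) (+-identityʳ _))

SameAs : ∀ {n} → (Fin n → ℕ) → Graph n → Set
SameAs d G = ∀ i → deg G i ≡ d i

same-deg : ∀ {n} {d : Fin n → ℕ} G → SameAs d G → ∀ {c} p → c ≤ d p → c ≤ deg G p
same-deg G real p c≤ = ≤-trans c≤ (≤-reflexive (sym (real p)))

outer-deg : ∀ k m {d : Fin (suc k + m) → ℕ} → Sorted d → ∀ G → SameAs d G → ∀ j i → deg G (suc k ↑ʳ j) ≤ deg G (i ↑ˡ m)
outer-deg k m sorted G real j i = subst₂ _≤_ (sym (real _)) (sym (real _)) (outer≤inner {k} {m} sorted j i)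

Potential : ∀ {n k} → (Fin n → ℕ) → Graph k → Set
Potential {n} d H = Σ (Graph n) λ G → SameAs d G × Contains G H

sparse-potential : ∀ {z m} es (d : Fin (2 + z + m) → ℕ) → Sorted d → ∀ t →
  (∀ i → deg (host z es) i ≤ d (i ↑ˡ m)) → (∀ p → d (suc (suc p)) ≤ t) →
  2 * (suc t * t + ((d zero ∸ t) + (d (suc zero) ∸ t))) + ∑deg (host z es) < 2 + ∑ d →
  ∀ G → SameAs d G → Potential d (host z es)
sparse-potential {z} {m} es d sorted t host≤d small bound =
  host-sparse (host z es) m d t host≤d inner-small (λ j → small (z ↑ʳ j))
    (subst (λ s → 2 * (suc t * t + s) + ∑deg (host z es) < 2 + ∑ d) (sym (excess₂ d t small)) bound)
  where
  es′ = map (λ (p , q) → suc (suc p) , suc (suc q)) es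
  hub-first : ∀ i j → i ≢ j → toℕ j < 2 → Adj (host z es) i j
  hub-first i j i≢j j<2 = Adj-sym (host z es) {j} {i} (hub-adj (2 + z) 2 es′ (≢-sym i≢j) j<2)
  inner-small : ∀ i j → i ≢ j → ¬ Adj (host z es) i j → d (j ↑ˡ m) ≤ t
  inner-small i zero          i≢j i≁j = contradiction (hub-first i zero i≢j (s≤s z≤n)) i≁j
  inner-small i (suc zero)    i≢j i≁j = contradiction (hub-first i (suc zero) i≢j (s≤s (s≤s z≤n))) i≁j
  inner-small i (suc (suc j)) _   _   = small (j ↑ˡ m)

-- k = 7

-- Two of the four centre vertices are the hubs; the other two separate the rim vertices along the
-- path z₁ c₃ z₂ c₄ z₃.
join⇒host₇ : ∀ {n} (G : Graph n) → Join G (λ _ → ⊤) 4 3 → Contains G host₇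
join⇒host₇ G (join (c₁ ∷ c₂ ∷ c₃ ∷ c₄ ∷ []) (z₁ ∷ z₂ ∷ z₃ ∷ []) refl refl
    ((c₁~c₂ ∷ c₁~c₃ ∷ c₁~c₄ ∷ []) ∷ (c₂~c₃ ∷ c₂~c₄ ∷ []) ∷ (c₃~c₄ ∷ []) ∷ [] ∷ [])
    ((z₁≢z₂ ∷ z₁≢z₃ ∷ []) ∷ (z₂≢z₃ ∷ []) ∷ [] ∷ [])
    ((z₁~c₁ ∷ z₁~c₂ ∷ z₁~c₃ ∷ z₁~c₄ ∷ []) ∷ (z₂~c₁ ∷ z₂~c₂ ∷ z₂~c₃ ∷ z₂~c₄ ∷ []) ∷ (z₃~c₁ ∷ z₃~c₂ ∷ z₃~c₃ ∷ z₃~c₄ ∷ []) ∷ []) _ _) =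
  host-embed G c₁ c₂ (z₁ ∷ c₃ ∷ z₂ ∷ c₄ ∷ z₃ ∷ []) path₅ c₁~c₂
    (flip z₁~c₁ ∷ c₁~c₃ ∷ flip z₂~c₁ ∷ c₁~c₄ ∷ flip z₃~c₁ ∷ [])
    (flip z₁~c₂ ∷ c₂~c₃ ∷ flip z₂~c₂ ∷ c₂~c₄ ∷ flip z₃~c₂ ∷ [])
    ((Adj⇒≢ G z₁~c₃ ∷ z₁≢z₂ ∷ Adj⇒≢ G z₁~c₄ ∷ z₁≢z₃ ∷ []) ∷ (Adj⇒≢ G (flip z₂~c₃) ∷ Adj⇒≢ G c₃~c₄ ∷ Adj⇒≢ G (flip z₃~c₃) ∷ [])
      ∷ (Adj⇒≢ G z₂~c₄ ∷ z₂≢z₃ ∷ []) ∷ (Adj⇒≢ G (flip z₃~c₄) ∷ []) ∷ [] ∷ [])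
    (z₁~c₃ ∷ flip z₂~c₃ ∷ z₂~c₄ ∷ flip z₃~c₄ ∷ [])
  where
  flip : ∀ {i j} → Adj G i j → Adj G j i
  flip = Adj-sym G

module Fill₇ {m : ℕ} (G : Graph (7 + m)) (big-deg : ∀ i → toℕ i < 3 → 10 ≤ deg G (i ↑ˡ m))
  (low : ∀ i → 4 ≤ deg G (i ↑ˡ m)) (outer-deg : ∀ j i → deg G (7 ↑ʳ j) ≤ deg G (i ↑ˡ m)) where

  open Core 7 m
  open Fill 3 4 1 (s≤s (s≤s (s≤s z≤n))) ≤-refl G (λ i i<3 → s≤s (s≤s (big-deg i i<3))) outer-deg

  private
    ι : Fin 7 → Fin (7 + m)
    ι = _↑ˡ m

    sym-adj : ∀ {i j} → Adj G i j → Adj G j i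
    sym-adj = Adj-sym G

    Win : Set
    Win = Contains G host₇ ⊎ Improve target G

    win : Outcome → Win
    win = Sum.map₁ (join⇒host₇ G)

  record Others (i : Fin 7) : Set where
    field
      p q : Fin 7
      p-big : Big p
      q-big : Big q
      i≢p : i ≢ p
      i≢q : i ≢ q
      p≢q : p ≢ q

  others : ∀ i → Big i → Others i
  others zero             _ = record { p = # 1 ; q = # 2 ; p-big = s≤s (s≤s z≤n) ; q-big = s≤s (s≤s (s≤s z≤n)) ; i≢p = λ () ; i≢q = λ () ; p≢q = λ () }
  others (suc zero)       _ = record { p = # 0 ; q = # 2 ; p-big = s≤s z≤n ; q-big = s≤s (s≤s (s≤s z≤n)) ; i≢p = λ () ; i≢q = λ () ; p≢q = λ () }
  others (suc (suc zero)) _ = record { p = # 0 ; q = # 1 ; p-big = s≤s z≤n ; q-big = s≤s (s≤s z≤n) ; i≢p = λ () ; i≢q = λ () ; p≢q = λ () }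
  others (suc (suc (suc i))) (s≤s (s≤s (s≤s ())))

  module _ {i j : Fin 7} (i-big : Big i) (j-small : ¬ Big j) (i≁j : ¬ Adj G (ι i) (ι j)) where

    private
      apart : ∀ {p} → Big p → ι j ≢ ι p
      apart p-big = ↑ˡ-≢ λ { refl → j-small p-big }

    -- Only two neighbours y₁, y₂ of j besides the large ones are guaranteed. By `hubs` they are
    -- adjacent to each other, to the large vertices and to the chosen outer neighbours of i: they
    -- become the K₂ of the host, with path j p q i x.
    two-bigs : ∀ p q → Big p → Big q → i ≢ p → i ≢ q → p ≢ q → Adj G (ι j) (ι p) → Adj G (ι j) (ι q) → Outcome ⊎ Contains G host₇
    two-bigs p q p-big q-big i≢p i≢q p≢q j~p j~q =
      let ys , ∣ys∣ , ys! , j~ys , ys∉ = small-picks 2 {j} {ι i ∷ []} ([] ∷ []) ((big∈ i-big , i≁j ∘ sym-adj) ∷ [])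
            (≤-trans (s≤s (low j)) (≤-reflexive (+-comm 1 _)))
      in
      hubs i-big j-small i≁j ys! j~ys ys∉ >>= λ (xs , ∣xs∣ , i~xs , xs-out , clique , ys-hub) →
      full p q p-big p≢q (inj₁ q-big) >>= λ p~q →
      full i q i-big i≢q (inj₁ q-big) >>= λ i~q →
      inj₂ (embed ∣ys∣ j~ys ∣xs∣ i~xs xs-out clique ys-hub p~q i~q)
      where
      embed : ∀ {ys xs} → length ys ≡ 2 → All (Adj G (ι j)) ys → length xs ≡ 5 → All (Adj G (ι i)) xs → All Outer xs →
        AllPairs (Adj G) ys → All (Hub xs) ys → Adj G (ι p) (ι q) → Adj G (ι i) (ι q) → Contains G host₇
      embed {y₁ ∷ y₂ ∷ []} {x ∷ _} refl (j~y₁ ∷ j~y₂ ∷ []) _ (i~x ∷ _) (x-out ∷ _) ((y₁~y₂ ∷ []) ∷ _) (h₁ ∷ h₂ ∷ []) p~q i~q =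
        host-embed G y₁ y₂ (ι j ∷ ι p ∷ ι q ∷ ι i ∷ x ∷ []) path₅ y₁~y₂ (spoke j~y₁ h₁) (spoke j~y₂ h₂)
          ((apart p-big ∷ apart q-big ∷ apart i-big ∷ ≢-sym (x-out j) ∷ []) ∷
           (↑ˡ-≢ p≢q ∷ ↑ˡ-≢ (≢-sym i≢p) ∷ ≢-sym (x-out p) ∷ []) ∷
           (↑ˡ-≢ (≢-sym i≢q) ∷ ≢-sym (x-out q) ∷ []) ∷ (≢-sym (x-out i) ∷ []) ∷ [] ∷ [])
          (j~p ∷ p~q ∷ sym-adj i~q ∷ i~x ∷ [])
        where
        spoke : ∀ {y xs} → Adj G (ι j) y → Hub (x ∷ xs) y → All (Adj G y) (ι j ∷ ι p ∷ ι q ∷ ι i ∷ x ∷ [])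
        spoke j~y h = sym-adj j~y ∷ Hub.to-bigs h p p-big ∷ Hub.to-bigs h q q-big ∷ Hub.to-bigs h i i-big ∷ All.head (Hub.to-picks h) ∷ []

    -- Here j has a third partner y₃, which replaces q on the path: j p y₃ i x.
    one-big : ∀ p q → Big p → Big q → i ≢ p → i ≢ q → Adj G (ι j) (ι p) → ¬ Adj G (ι j) (ι q) → Outcome ⊎ Contains G host₇
    one-big p q p-big q-big i≢p i≢q j~p j≁q =
      let ys , ∣ys∣ , ys! , j~ys , ys∉ = small-picks 3 {j} {ι i ∷ ι q ∷ []} ((↑ˡ-≢ i≢q ∷ []) ∷ [] ∷ [])
            ((big∈ i-big , i≁j ∘ sym-adj) ∷ (big∈ q-big , j≁q) ∷ [])
            (≤-trans (s≤s (s≤s (low j))) (≤-reflexive (+-comm 2 _)))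
      in
      hubs i-big j-small i≁j ys! j~ys ys∉ >>= λ (xs , ∣xs∣ , i~xs , xs-out , clique , ys-hub) →
      inj₂ (embed ∣ys∣ j~ys ∣xs∣ i~xs xs-out clique ys-hub)
      where
      embed : ∀ {ys xs} → length ys ≡ 3 → All (Adj G (ι j)) ys → length xs ≡ 5 → All (Adj G (ι i)) xs → All Outer xs →
        AllPairs (Adj G) ys → All (Hub xs) ys → Contains G host₇
      embed {y₁ ∷ y₂ ∷ y₃ ∷ []} {x ∷ _} refl (j~y₁ ∷ j~y₂ ∷ j~y₃ ∷ []) _ (i~x ∷ _) (x-out ∷ _)
        ((y₁~y₂ ∷ y₁~y₃ ∷ []) ∷ (y₂~y₃ ∷ []) ∷ _) (h₁ ∷ h₂ ∷ h₃ ∷ []) =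
        host-embed G y₁ y₂ (ι j ∷ ι p ∷ y₃ ∷ ι i ∷ x ∷ []) path₅ y₁~y₂ (spoke j~y₁ y₁~y₃ h₁) (spoke j~y₂ y₂~y₃ h₂)
          ((apart p-big ∷ Adj⇒≢ G j~y₃ ∷ apart i-big ∷ ≢-sym (x-out j) ∷ []) ∷
           (Adj⇒≢ G (sym-adj (Hub.to-bigs h₃ p p-big)) ∷ ↑ˡ-≢ (≢-sym i≢p) ∷ ≢-sym (x-out p) ∷ []) ∷
           (Adj⇒≢ G (Hub.to-bigs h₃ i i-big) ∷ Adj⇒≢ G (All.head (Hub.to-picks h₃)) ∷ []) ∷ (≢-sym (x-out i) ∷ []) ∷ [] ∷ [])
          (j~p ∷ sym-adj (Hub.to-bigs h₃ p p-big) ∷ Hub.to-bigs h₃ i i-big ∷ i~x ∷ [])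
        where
        spoke : ∀ {y xs} → Adj G (ι j) y → Adj G y y₃ → Hub (x ∷ xs) y → All (Adj G y) (ι j ∷ ι p ∷ y₃ ∷ ι i ∷ x ∷ [])
        spoke j~y y~y₃ h = sym-adj j~y ∷ Hub.to-bigs h p p-big ∷ y~y₃ ∷ Hub.to-bigs h i i-big ∷ All.head (Hub.to-picks h) ∷ []

  -- If a small j has a large neighbours, at least 4 - a others remain. For a = 0 these are the four
  -- that `fill` requires; for a = 1 and a = 2 the host is built around the remaining three or two.
  step : ∀ i j → Big i → i ≢ j → ¬ Adj G (ι i) (ι j) → Win
  step i j i-big i≢j i≁j with toℕ j <? 3
  ... | yes j-big = win (fill i-big i≢j i≁j (inj₁ j-big))
  ... | no j-small with others i i-big
  ... | record { p = p ; q = q ; p-big = p-big ; q-big = q-big ; i≢p = i≢p ; i≢q = i≢q ; p≢q = p≢q }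
    with adj? G (ι j) (ι p) | adj? G (ι j) (ι q)
  ... | yes j~p | yes j~q = [ win , inj₁ ]′ (two-bigs i-big j-small i≁j p q p-big q-big i≢p i≢q p≢q j~p j~q)
  ... | yes j~p | no j≁q  = [ win , inj₁ ]′ (one-big i-big j-small i≁j p q p-big q-big i≢p i≢q j~p j≁q)
  ... | no j≁p  | yes j~q = [ win , inj₁ ]′ (one-big i-big j-small i≁j q p q-big p-big i≢q i≢p j~q j≁p)
  ... | no j≁p  | no j≁q  = win (fill i-big i≢j i≁j (inj₂
      (ι i ∷ ι p ∷ ι q ∷ [] , (↑ˡ-≢ i≢p ∷ ↑ˡ-≢ i≢q ∷ []) ∷ (↑ˡ-≢ p≢q ∷ []) ∷ [] ∷ [] ,
       (big∈ i-big , i≁j ∘ sym-adj) ∷ (big∈ p-big , j≁p) ∷ (big∈ q-big , j≁q) ∷ [] , +-monoˡ-≤ 3 (low j))))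

≤-by : ∀ {a b} r → a + r ≡ b → a ≤ b
≤-by r eq = ≤-trans (m≤m+n _ r) (≤-reflexive eq)

complete-hub : ∀ {k m} β (d : Fin (k + m) → ℕ) {D : Set} →
  (∀ G → SameAs d G → ∀ i j → toℕ i < β → i ≢ j → ¬ Adj G (i ↑ˡ m) (j ↑ˡ m) → D ⊎ Improve (pad (hub k β []) m) G) →
  ∀ G → SameAs d G → D ⊎ Σ (Graph (k + m)) λ G′ → SameAs d G′ × (∀ i j → i ≢ j → toℕ i < β → Adj G′ (i ↑ˡ m) (j ↑ˡ m))
complete-hub {k} {m} β d {D} step G real = improve* T d step′ G real >>= λ (G′ , real′ , sub) →
  inj₂ (G′ , real′ , λ i j i≢j i<β → sub {i ↑ˡ m} {j ↑ˡ m} (pad-adj H m (hub-adj k β [] i≢j i<β)))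
  where
  H = hub k β []
  T = pad H m
  step′ : ∀ G → SameAs d G → ∀ u v → Adj T u v → ¬ Adj G u v → D ⊎ Improve T G
  step′ G real u v uv∈T u≁v with place k u | place k v
  ... | outer u′ | _        = contradiction uv∈T (pad-outer H m u′ v)
  ... | inner i  | outer v′ = contradiction (Adj-sym T uv∈T) (pad-outer H m v′ (i ↑ˡ m))
  ... | inner i  | inner j  with hub-only (hub-adj⁻ k β [] {i} {j} (pad-adj⁻ H m {i} {j} uv∈T))
  ... | inj₁ i<β = step G real i j i<β (Adj⇒≢ H {i} {j} (pad-adj⁻ H m {i} {j} uv∈T)) u≁v
  ... | inj₂ j<β = step G real j i j<β (≢-sym (Adj⇒≢ H {i} {j} (pad-adj⁻ H m {i} {j} uv∈T))) (u≁v ∘ Adj-sym G)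

module _ {k m : ℕ} where

  -- With the complete graph on the core as T, a switch preserves every core edge present so far, so
  -- edges can be added to the core one after the other.
  complete-kept : ∀ (G : Graph (k + m)) {u v} → ((G′ , _) : Gain (pad (complete k) m) G u v) →
    ∀ {i j} → Adj G (i ↑ˡ m) (j ↑ˡ m) → Adj G′ (i ↑ˡ m) (j ↑ˡ m)
  complete-kept G (G′ , _ , kept , _) {i} {j} i~j =
    kept {i ↑ˡ m} {j ↑ˡ m} (pad-adj (complete k) m (cong not (dec-false (i ≟ j) (λ { refl → Adj⇒≢ G i~j refl })))) i~j

  Isolated : ℕ → Graph (k + m) → Fin k → Set
  Isolated β G r = ∀ i → Adj G (r ↑ˡ m) (i ↑ˡ m) → toℕ i < β

  -- An isolated vertex has at most β neighbours in the core, so both lists for `dense` can be taken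
  -- outside it and hence away from T.
  dense-isolated : ∀ {β} c e → β ≤ k → (G : Graph (k + m)) → ∀ {r v : Fin k} → r ≢ v → ¬ Adj G (r ↑ˡ m) (v ↑ˡ m) →
    Isolated β G r → Isolated β G v → β + (c + e) ≤ deg G (r ↑ˡ m) → β + c ≤ deg G (v ↑ˡ m) →
    Gain (pad (complete k) m) G (r ↑ˡ m) (v ↑ˡ m) ⊎ Join G (λ _ → ⊤) c (2 + e)
  dense-isolated {β} c e β≤k G {r} {v} r≢v r≁v r-iso v-iso dr dv =
    let xs , ∣xs∣ , xs! , r~xs , xs-out = partners (c + e) r r-iso dr
        ys , ∣ys∣ , ys! , v~ys , ys-out = partners c v v-iso dv
    in Dense.dense T G (↑ˡ-≢ r≢v) r≁v id c e ∣xs∣ ∣ys∣ xs! ys! r~xs v~ys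
         (All.map (pad-free (complete k)) xs-out) (All.map (λ y-out → pad-free (complete k) y-out _ ∘ Adj-sym T) ys-out)
         tt tt (All.tabulate λ _ → tt) (All.tabulate λ _ → tt)
    where
    open Core k m
    T = pad (complete k) m
    partners : ∀ b r → Isolated β G r → β + b ≤ deg G (r ↑ˡ m) →
      ∃ λ xs → length xs ≡ b × Unique xs × All (Adj G (r ↑ˡ m)) xs × All Outer xs
    partners b r r-iso dr =
      let xs , ∣xs∣ , xs! , r~xs , xs∉ = picks G b (r ↑ˡ m) {first β β≤k} {[]} [] []
            (≤-trans (≤-reflexive (cong (_+ b) (∣first∣ β β≤k))) (≤-trans dr (≤-reflexive (sym (+-identityʳ _)))))
      in xs , ∣xs∣ , xs! , r~xs , All.tabulate λ x∈ i x≡i → All.lookup xs∉ x∈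
           (subst (_∈ first β β≤k) (sym x≡i) (∈first β≤k i (r-iso i (subst (Adj G (r ↑ˡ m)) x≡i (All.lookup r~xs x∈)))))

Quad : List (Fin 7) → Set
Quad xs = Unique xs × All (λ i → ¬ toℕ i < 3) xs × (∀ i → toℕ i < 3 ⊎ i ∈ xs)

quad? : ∀ xs → Dec (Quad xs)
quad? xs = AllPairs.allPairs? (λ i j → ¬? (i ≟ j)) xs ×-dec All.all? (λ i → ¬? (toℕ i <? 3)) xs
           ×-dec all? (λ i → (toℕ i <? 3) ⊎-dec (i ∈? xs))

-- With 0, 1, 2 joined to the core, 0 and 1 are the hubs and 2 links the pieces of the path. Any two
-- edges among the four other core vertices p, q, r, v complete it: v 2 p q r if they meet, p q 2 r
-- v if they are disjoint.
module Last₇ {m : ℕ} (d : Fin (7 + m) → ℕ) (sorted : Sorted d)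
  (big-deg : ∀ i → toℕ i < 2 → 12 ≤ d (i ↑ˡ m)) (d₂≥7 : 7 ≤ d (# 2)) (low : ∀ i → 4 ≤ d (i ↑ˡ m)) where

  open Core 7 m

  private
    ι : Fin 7 → Fin (7 + m)
    ι = _↑ˡ m

  Full : Graph (7 + m) → Set
  Full G = ∀ i j → i ≢ j → toℕ i < 3 → Adj G (ι i) (ι j)

  module _ (G : Graph (7 + m)) (real : SameAs d G) (full : Full G) where

    private
      sym-adj : ∀ {i j} → Adj G i j → Adj G j i
      sym-adj = Adj-sym G

      small≢ : ∀ {i p : Fin 7} → toℕ i < 3 → ¬ toℕ p < 3 → i ≢ p
      small≢ i<3 p≮3 refl = p≮3 i<3

      apex : ∀ (i : Fin 7) → toℕ i < 2 → ∀ {p q r v} → All (λ i → ¬ toℕ i < 3) (p ∷ q ∷ r ∷ v ∷ []) →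
        All (Adj G (ι i)) (ι (# 2) ∷ ι p ∷ ι q ∷ ι r ∷ ι v ∷ [])
      apex i i<2 far = full i (# 2) (λ { refl → contradiction i<2 (n≮n 2) }) i<3 ∷ AllP.map⁺ (All.map (λ {p} p≮3 → full i p (small≢ i<3 p≮3) i<3) far)
        where
        i<3 = ≤-trans i<2 (n≤1+n 2)

      third : ∀ {p} → ¬ toℕ p < 3 → Adj G (ι (# 2)) (ι p)
      third {p} p≮3 = full (# 2) p (small≢ ≤-refl p≮3) ≤-refl

    cherry : ∀ {p q r v} → Unique (p ∷ q ∷ r ∷ v ∷ []) → All (λ i → ¬ toℕ i < 3) (p ∷ q ∷ r ∷ v ∷ []) → Adj G (ι p) (ι q) → Adj G (ι q) (ι r) → Contains G host₇
    cherry {p} {q} {r} {v}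
      ((p≢q ∷ p≢r ∷ p≢v ∷ []) ∷ (q≢r ∷ q≢v ∷ []) ∷ (r≢v ∷ []) ∷ [] ∷ []) far@(p≮3 ∷ q≮3 ∷ r≮3 ∷ v≮3 ∷ []) p~q q~r
      with apex (# 0) (s≤s z≤n) far | apex (# 1) (s≤s (s≤s z≤n)) far
    ... | a₂ ∷ aₚ ∷ a-q ∷ aᵣ ∷ aᵥ ∷ [] | b₂ ∷ bₚ ∷ b-q ∷ bᵣ ∷ bᵥ ∷ [] =
      host-embed G (ι (# 0)) (ι (# 1)) (ι v ∷ ι (# 2) ∷ ι p ∷ ι q ∷ ι r ∷ []) path₅ (full (# 0) (# 1) (λ ()) (s≤s z≤n))
        (aᵥ ∷ a₂ ∷ aₚ ∷ a-q ∷ aᵣ ∷ []) (bᵥ ∷ b₂ ∷ bₚ ∷ b-q ∷ bᵣ ∷ [])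
        ((Adj⇒≢ G (sym-adj (third v≮3)) ∷ ↑ˡ-≢ (≢-sym p≢v) ∷ ↑ˡ-≢ (≢-sym q≢v) ∷ ↑ˡ-≢ (≢-sym r≢v) ∷ []) ∷
         (Adj⇒≢ G (third p≮3) ∷ Adj⇒≢ G (third q≮3) ∷ Adj⇒≢ G (third r≮3) ∷ []) ∷
         (↑ˡ-≢ p≢q ∷ ↑ˡ-≢ p≢r ∷ []) ∷ (↑ˡ-≢ q≢r ∷ []) ∷ [] ∷ [])
        (sym-adj (third v≮3) ∷ third p≮3 ∷ p~q ∷ q~r ∷ [])

    matching : ∀ {p q r v} → Unique (p ∷ q ∷ r ∷ v ∷ []) → All (λ i → ¬ toℕ i < 3) (p ∷ q ∷ r ∷ v ∷ []) → Adj G (ι p) (ι q) → Adj G (ι r) (ι v) → Contains G host₇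
    matching {p} {q} {r} {v}
      ((p≢q ∷ p≢r ∷ p≢v ∷ []) ∷ (q≢r ∷ q≢v ∷ []) ∷ (r≢v ∷ []) ∷ [] ∷ []) far@(p≮3 ∷ q≮3 ∷ r≮3 ∷ v≮3 ∷ []) p~q r~v
      with apex (# 0) (s≤s z≤n) far | apex (# 1) (s≤s (s≤s z≤n)) far
    ... | a₂ ∷ aₚ ∷ a-q ∷ aᵣ ∷ aᵥ ∷ [] | b₂ ∷ bₚ ∷ b-q ∷ bᵣ ∷ bᵥ ∷ [] =
      host-embed G (ι (# 0)) (ι (# 1)) (ι p ∷ ι q ∷ ι (# 2) ∷ ι r ∷ ι v ∷ []) path₅ (full (# 0) (# 1) (λ ()) (s≤s z≤n))
        (aₚ ∷ a-q ∷ a₂ ∷ aᵣ ∷ aᵥ ∷ []) (bₚ ∷ b-q ∷ b₂ ∷ bᵣ ∷ bᵥ ∷ [])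
        ((↑ˡ-≢ p≢q ∷ Adj⇒≢ G (sym-adj (third p≮3)) ∷ ↑ˡ-≢ p≢r ∷ ↑ˡ-≢ p≢v ∷ []) ∷
         (Adj⇒≢ G (sym-adj (third q≮3)) ∷ ↑ˡ-≢ q≢r ∷ ↑ˡ-≢ q≢v ∷ []) ∷
         (Adj⇒≢ G (third r≮3) ∷ Adj⇒≢ G (third v≮3) ∷ []) ∷ (↑ˡ-≢ r≢v ∷ []) ∷ [] ∷ [])
        (p~q ∷ sym-adj (third q≮3) ∷ third r≮3 ∷ r~v ∷ [])

    new-edge : ∀ r v → r ≢ v → ¬ toℕ r < 3 → ¬ toℕ v < 3 → Isolated 3 G r → Isolated 3 G v →
      Contains G host₇ ⊎ Gain (pad (complete 7) m) G (ι r) (ι v)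
    new-edge r v r≢v r≮3 v≮3 r-iso v-iso with 8 ≤? d (# 6)
    -- Eight is 3 + (4 + 1): three core neighbours at most, and the five outer ones needed for K₄ ∨
    -- 3 K₁. Below it all outer degrees are at most 7, and 12 is the least degree d with 7 + 7 < d +
    -- 3, as `FinalStep` asks of the vertices 0 and 1.
    ... | yes d₆≥8 = [ inj₂ , inj₁ ∘ join⇒host₇ G ]′ (dense-isolated 4 1 (s≤s (s≤s (s≤s z≤n))) G r≢v (v≮3 ∘ r-iso v) r-iso v-iso
            (≤-trans d₆≥8 (above r)) (≤-trans (≤-trans (n≤1+n 7) d₆≥8) (above v)))
      where
      above : ∀ i → d (# 6) ≤ deg G (ι i)
      above i = ≤-trans (inner≤inner {k = 6} sorted {i} {# 6} (s≤s⁻¹ (toℕ<n i))) (≤-reflexive (sym (real (ι i))))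
    ... | no d₆≱8 = inj₂ (FinalStep.final-edge G 2 7 full
            (outer-deg 6 m sorted G real)
            (λ j → ≤-trans (≤-reflexive (real _)) (≤-trans (outer≤inner {k = 6} sorted j (# 6)) (s≤s⁻¹ (≰⇒> d₆≱8))))
            (λ i i<2 → ≤-trans (≤-trans (+-monoʳ-≤ 3 (big-deg i i<2)) (≤-reflexive (+-comm 3 _))) (≤-reflexive (cong (_+ 3) (sym (real _)))))
            (# 2) refl (≤-trans d₂≥7 (≤-reflexive (sym (real _))))
            r v r≢v r≮3 v≮3 (≤-trans (low r) (≤-reflexive (sym (real _)))) (≤-trans (low v) (≤-reflexive (sym (real _)))) r-iso v-iso)

  transfer : ∀ G {u v} → SameAs d G → Full G → ((G′ , _) : Gain (pad (complete 7) m) G u v) → SameAs d G′ × Full G′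
  transfer G real full gain@(G′ , same , _) =
    (λ i → trans (same i) (real i)) , λ i j i≢j i<3 → complete-kept {7} {m} G gain {i} {j} (full i j i≢j i<3)

  self : ∀ G {i} → ¬ Adj G (ι i) (ι i)
  self G i~i = Adj⇒≢ G i~i refl

  isolated : ∀ {G r xs} → (∀ i → toℕ i < 3 ⊎ i ∈ xs) → All (λ p → ¬ Adj G (ι r) (ι p)) xs → Isolated 3 G r
  isolated cover apart i r~i = [ id , (λ i∈ → contradiction r~i (All.lookup apart i∈)) ]′ (cover i)

  second-edge : ∀ {p q r v} → Quad (p ∷ q ∷ r ∷ v ∷ []) → ∀ G → SameAs d G → Full G → Adj G (ι p) (ι q) → Potential d host₇
  second-edge {p} {q} {r} {v}
    (distinct@((p≢q ∷ p≢r ∷ p≢v ∷ []) ∷ (q≢r ∷ q≢v ∷ []) ∷ (r≢v ∷ []) ∷ [] ∷ []) , far@(p≮3 ∷ q≮3 ∷ r≮3 ∷ v≮3 ∷ []) , cover) G real full p~q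
    with adj? G (ι r) (ι p) | adj? G (ι v) (ι p) | adj? G (ι r) (ι q) | adj? G (ι v) (ι q) | adj? G (ι r) (ι v)
  ... | yes r~p | _ | _ | _ | _ = G , real , cherry G real full {q} {p} {r} {v}
    ((≢-sym p≢q ∷ q≢r ∷ q≢v ∷ []) ∷ (p≢r ∷ p≢v ∷ []) ∷ (r≢v ∷ []) ∷ [] ∷ []) (q≮3 ∷ p≮3 ∷ r≮3 ∷ v≮3 ∷ [])
    (Adj-sym G p~q) (Adj-sym G r~p)
  ... | no _ | yes v~p | _ | _ | _ = G , real , cherry G real full {q} {p} {v} {r}
    ((≢-sym p≢q ∷ q≢v ∷ q≢r ∷ []) ∷ (p≢v ∷ p≢r ∷ []) ∷ (≢-sym r≢v ∷ []) ∷ [] ∷ []) (q≮3 ∷ p≮3 ∷ v≮3 ∷ r≮3 ∷ [])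
    (Adj-sym G p~q) (Adj-sym G v~p)
  ... | no _ | no _ | yes r~q | _ | _ = G , real , cherry G real full distinct far p~q (Adj-sym G r~q)
  ... | no _ | no _ | no _ | yes v~q | _ = G , real , cherry G real full {p} {q} {v} {r}
    ((p≢q ∷ p≢v ∷ p≢r ∷ []) ∷ (q≢v ∷ q≢r ∷ []) ∷ (≢-sym r≢v ∷ []) ∷ [] ∷ []) (p≮3 ∷ q≮3 ∷ v≮3 ∷ r≮3 ∷ [])
    p~q (Adj-sym G v~q)
  ... | no _ | no _ | no _ | no _ | yes r~v = G , real , matching G real full distinct far p~q r~v
  ... | no r≁p | no v≁p | no r≁q | no v≁q | no r≁v
    with new-edge G real full r v r≢v r≮3 v≮3 r-iso v-iso
    where
    r-iso : Isolated 3 G r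
    r-iso = isolated {G = G} cover (r≁p ∷ r≁q ∷ self G ∷ r≁v ∷ [])
    v-iso : Isolated 3 G v
    v-iso = isolated {G = G} cover (v≁p ∷ v≁q ∷ r≁v ∘ Adj-sym G ∷ self G ∷ [])
  ... | inj₁ found = G , real , found
  ... | inj₂ gain@(G′ , _ , _ , r~v) =
    let real′ , full′ = transfer G real full gain
    in G′ , real′ , matching G′ real′ full′ distinct far (complete-kept {7} {m} G gain {p} {q} p~q) r~v

  last : ∀ G → SameAs d G → Full G → Potential d host₇
  last G real full
    with adj? G (ι (# 3)) (ι (# 4)) | adj? G (ι (# 3)) (ι (# 5)) | adj? G (ι (# 3)) (ι (# 6))
       | adj? G (ι (# 4)) (ι (# 5)) | adj? G (ι (# 4)) (ι (# 6))
  ... | yes e | _ | _ | _ | _ = second-edge {# 3} {# 4} {# 5} {# 6} (toWitness {a? = quad? _} tt) G real full e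
  ... | no _ | yes e | _ | _ | _ = second-edge {# 3} {# 5} {# 4} {# 6} (toWitness {a? = quad? _} tt) G real full e
  ... | no _ | no _ | yes e | _ | _ = second-edge {# 3} {# 6} {# 4} {# 5} (toWitness {a? = quad? _} tt) G real full e
  ... | no _ | no _ | no _ | yes e | _ = second-edge {# 4} {# 5} {# 3} {# 6} (toWitness {a? = quad? _} tt) G real full e
  ... | no _ | no _ | no _ | no _ | yes e = second-edge {# 4} {# 6} {# 3} {# 5} (toWitness {a? = quad? _} tt) G real full e
  -- Whether or not 5 and 6 are adjacent, the vertices 3 and 4 have no neighbour among 3, ..., 6, so
  -- they can be joined and then play p and q.
  ... | no e₃₄ | no e₃₅ | no e₃₆ | no e₄₅ | no e₄₆
    with new-edge G real full (# 3) (# 4) (λ ()) (λ { (s≤s (s≤s (s≤s ()))) }) (λ { (s≤s (s≤s (s≤s ()))) }) iso₃ iso₄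
    where
    cover = proj₂ (proj₂ (toWitness {a? = quad? (# 3 ∷ # 4 ∷ # 5 ∷ # 6 ∷ [])} tt))
    iso₃ : Isolated 3 G (# 3)
    iso₃ = isolated {G = G} cover (self G ∷ e₃₄ ∷ e₃₅ ∷ e₃₆ ∷ [])
    iso₄ : Isolated 3 G (# 4)
    iso₄ = isolated {G = G} cover (e₃₄ ∘ Adj-sym G ∷ self G ∷ e₄₅ ∷ e₄₆ ∷ [])
  ... | inj₁ found = G , real , found
  ... | inj₂ gain@(G′ , _ , _ , e) =
    let real′ , full′ = transfer G real full gain
    in second-edge {# 3} {# 4} {# 5} {# 6} (toWitness {a? = quad? _} tt) G′ real′ full′ e

-- The threshold 12 for `d (# 1)` comes from the final step, and 10 = 7 + 5 - 2 for `d (# 2)` from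
-- `Fill₇`. Below either one the count applies, with one or two unrestricted degrees; the second
-- case, about 4n against 6n, is what requires n of this order.
realize₇ : ∀ m (G : Graph (93 + m)) → Sorted (deg G) → 6 * (92 + m) < ∑deg G → Potential (deg G) host₇
realize₇ m G sorted bound = by-cases (d (# 1) ≤? 11) (d (# 2) ≤? 9)
  where
  open ≤-Reasoning
  d = deg G
  M = 86 + m
  d₁≥6 : 6 ≤ d (# 1)
  d₁≥6 = second-degree G sorted 5 bound
  low : ∀ i → 4 ≤ d (i ↑ˡ M)
  low i = ≤-trans (core-degree 5 {M} G sorted 3 ≤-refl bound) (inner≤inner {k = 6} {M} sorted {i} {# 6} (s≤s⁻¹ (toℕ<n i)))
  host≤ : ∀ i → deg host₇ i ≤ d (i ↑ˡ M)
  host≤ zero          = ≤-trans d₁≥6 (sorted (# 0) (# 1) z≤n)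
  host≤ (suc zero)    = d₁≥6
  host≤ (suc (suc i)) = ≤-trans (toWitness {a? = all? (λ i → deg host₇ (suc (suc i)) ≤? 4)} tt i) (low (suc (suc i)))
  -- 132 = 12 · 11 and 90 = 10 · 9 are (t + 1) t, the terms 81 + m and 83 + m are n - 1 - t, and 30
  -- is the degree sum of K₂ ∨ P₅.
  arith₁ : ∀ m → suc (2 * (132 + ((81 + m) + 0)) + 30) + (98 + 4 * m) ≡ 2 + suc (6 * (92 + m))
  arith₁ = solve-∀
  arith₂ : ∀ m → suc (2 * (90 + ((83 + m) + (83 + m))) + 30) + (12 + 2 * m) ≡ 2 + suc (6 * (92 + m))
  arith₂ = solve-∀
  by-cases : Dec (d (# 1) ≤ 11) → Dec (d (# 2) ≤ 9) → Potential d host₇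
  by-cases (yes d₁≤11) _ = sparse-potential path₅ d sorted 11 host≤
    (λ p → ≤-trans (sorted (# 1) (suc (suc p)) (s≤s z≤n)) d₁≤11)
    (begin-strict
      2 * (132 + ((d (# 0) ∸ 11) + (d (# 1) ∸ 11))) + 30
        ≤⟨ +-monoˡ-≤ 30 (*-monoʳ-≤ 2 (+-monoʳ-≤ 132 (+-mono-≤ (∸-monoˡ-≤ 11 (deg≤ G zero)) (≤-reflexive (m≤n⇒m∸n≡0 d₁≤11))))) ⟩
      2 * (132 + ((81 + m) + 0)) + 30   <⟨ ≤-by (98 + 4 * m) (arith₁ m) ⟩
      2 + suc (6 * (92 + m))            ≤⟨ +-monoʳ-≤ 2 bound ⟩
      2 + ∑deg G                        ∎)
    G (λ _ → refl)
  by-cases (no _) (yes d₂≤9) = sparse-potential path₅ d sorted 9 host≤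
    (λ p → ≤-trans (sorted (# 2) (suc (suc p)) (s≤s (s≤s z≤n))) d₂≤9)
    (begin-strict
      2 * (90 + ((d (# 0) ∸ 9) + (d (# 1) ∸ 9))) + 30
        ≤⟨ +-monoˡ-≤ 30 (*-monoʳ-≤ 2 (+-monoʳ-≤ 90 (+-mono-≤ (∸-monoˡ-≤ 9 (deg≤ G zero)) (∸-monoˡ-≤ 9 (deg≤ G (# 1)))))) ⟩
      2 * (90 + ((83 + m) + (83 + m))) + 30   <⟨ ≤-by (12 + 2 * m) (arith₂ m) ⟩
      2 + suc (6 * (92 + m))                  ≤⟨ +-monoʳ-≤ 2 bound ⟩
      2 + ∑deg G                              ∎)
    G (λ _ → refl)
  by-cases (no d₁≰11) (no d₂≰9) = case complete-hub {7} {M} 3 d step G (λ _ → refl) of λ where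
      (inj₁ done)                 → done
      (inj₂ (G′ , real′ , full′)) → Last₇.last d sorted big (≤-trans (s≤s (s≤s (s≤s (s≤s (s≤s (s≤s (s≤s z≤n))))))) (≰⇒> d₂≰9)) low G′ real′ full′
    where
    big : ∀ i → toℕ i < 2 → 12 ≤ d (i ↑ˡ M)
    big zero          _ = ≤-trans (≰⇒> d₁≰11) (sorted (# 0) (# 1) z≤n)
    big (suc zero)    _ = ≰⇒> d₁≰11
    big (suc (suc _)) (s≤s (s≤s ()))
    step : ∀ G′ → SameAs d G′ → ∀ i j → toℕ i < 3 → i ≢ j → ¬ Adj G′ (i ↑ˡ M) (j ↑ˡ M) →
      Potential d host₇ ⊎ Improve (pad (hub 7 3 []) M) G′
    step G′ real i j i<3 i≢j i≁j = Sum.map₁ (λ found → G′ , real , found)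
      (Fill₇.step {M} G′
        (λ i i<3 → same-deg G′ real (i ↑ˡ M) (≤-trans (≰⇒> d₂≰9) (inner≤inner {k = 6} {M} sorted {i} {# 2} (s≤s⁻¹ i<3))))
        (λ i → same-deg G′ real (i ↑ˡ M) (low i))
        (outer-deg 6 M sorted G′ real)
        i j i<3 i≢j i≁j)

-- k = 5

join⇒host₅ : ∀ {n} (G : Graph n) → Join G (λ _ → ⊤) 3 2 → Contains G host₅
join⇒host₅ G (join (c₁ ∷ c₂ ∷ c₃ ∷ []) (z₁ ∷ z₂ ∷ []) refl refl
    ((c₁~c₂ ∷ c₁~c₃ ∷ []) ∷ (c₂~c₃ ∷ []) ∷ [] ∷ []) ((z₁≢z₂ ∷ []) ∷ [] ∷ [])
    ((z₁~c₁ ∷ z₁~c₂ ∷ z₁~c₃ ∷ []) ∷ (z₂~c₁ ∷ z₂~c₂ ∷ z₂~c₃ ∷ []) ∷ []) _ _) =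
  host-embed G c₁ c₂ (c₃ ∷ z₁ ∷ z₂ ∷ []) _ c₁~c₂
    (c₁~c₃ ∷ flip z₁~c₁ ∷ flip z₂~c₁ ∷ []) (c₂~c₃ ∷ flip z₁~c₂ ∷ flip z₂~c₂ ∷ [])
    ((Adj⇒≢ G (flip z₁~c₃) ∷ Adj⇒≢ G (flip z₂~c₃) ∷ []) ∷ (z₁≢z₂ ∷ []) ∷ [] ∷ []) (flip z₁~c₃ ∷ [])
  where
  flip : ∀ {i j} → Adj G i j → Adj G j i
  flip = Adj-sym G

module Fill₅ {m : ℕ} (G : Graph (5 + m)) (big-deg : ∀ i → toℕ i < 2 → 6 ≤ deg G (i ↑ˡ m))
  (low : ∀ i → 3 ≤ deg G (i ↑ˡ m)) (outer-deg : ∀ j i → deg G (5 ↑ʳ j) ≤ deg G (i ↑ˡ m)) where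

  open Core 5 m
  open Fill 2 3 0 (s≤s (s≤s z≤n)) ≤-refl G (λ i i<2 → s≤s (s≤s (big-deg i i<2))) outer-deg

  private
    ι : Fin 5 → Fin (5 + m)
    ι = _↑ˡ m

  -- A small j of degree 3 that is not adjacent to i has at least two neighbours besides the large
  -- ones. They become the hubs, with i, x, j as the other vertices and i x as the additional edge.
  step : ∀ i j → Big i → i ≢ j → ¬ Adj G (ι i) (ι j) → Contains G host₅ ⊎ Improve target G
  step i j i-big i≢j i≁j = [ Sum.map₁ (join⇒host₅ G) , inj₁ ]′ (by-cases (toℕ j <? 2))
    where
    embed : ∀ {ys xs} → length ys ≡ 2 → All (Adj G (ι j)) ys → length xs ≡ 3 → All (Adj G (ι i)) xs → All Outer xs →
      AllPairs (Adj G) ys → All (Hub xs) ys → Contains G host₅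
    embed {y₁ ∷ y₂ ∷ []} {x ∷ _} refl (j~y₁ ∷ j~y₂ ∷ []) _ (i~x ∷ _) (x-out ∷ _) ((y₁~y₂ ∷ []) ∷ _) (h₁ ∷ h₂ ∷ []) =
      host-embed G y₁ y₂ (ι i ∷ x ∷ ι j ∷ []) _ y₁~y₂ (spoke j~y₁ h₁) (spoke j~y₂ h₂)
        ((Adj⇒≢ G i~x ∷ ↑ˡ-≢ i≢j ∷ []) ∷ (x-out j ∷ []) ∷ [] ∷ []) (i~x ∷ [])
      where
      spoke : ∀ {y xs} → Adj G (ι j) y → Hub (x ∷ xs) y → All (Adj G y) (ι i ∷ x ∷ ι j ∷ [])
      spoke j~y h = Hub.to-bigs h i i-big ∷ All.head (Hub.to-picks h) ∷ Adj-sym G j~y ∷ []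
    by-cases : Dec (Big j) → Outcome ⊎ Contains G host₅
    by-cases (yes j-big)  = inj₁ (fill i-big i≢j i≁j (inj₁ j-big))
    by-cases (no j-small) =
      let ys , ∣ys∣ , ys! , j~ys , ys∉ = small-picks 2 {j} {ι i ∷ []} ([] ∷ []) ((big∈ i-big , i≁j ∘ Adj-sym G) ∷ [])
            (≤-trans (s≤s (low j)) (≤-reflexive (+-comm 1 _)))
      in
      hubs i-big j-small i≁j ys! j~ys ys∉ >>= λ (xs , ∣xs∣ , i~xs , xs-out , clique , ys-hub) →
      inj₂ (embed ∣ys∣ j~ys ∣xs∣ i~xs xs-out clique ys-hub)

module Last₅ {m : ℕ} (d : Fin (24 + m) → ℕ) (sorted : Sorted d) (bound : 4 * (23 + m) < ∑ d)
  (d₁≥5 : 5 ≤ d (# 1)) (low : ∀ (i : Fin 5) → 3 ≤ d (i ↑ˡ (19 + m))) where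

  open Core 5 (19 + m)

  private
    M : ℕ
    M = 19 + m
    ι : Fin 5 → Fin (5 + M)
    ι = _↑ˡ M

    ≮2 : ∀ {i} → ¬ suc (suc i) < 2
    ≮2 (s≤s (s≤s ()))

  Full : Graph (24 + m) → Set
  Full G = ∀ i j → i ≢ j → toℕ i < 2 → Adj G (ι i) (ι j)

  module _ (G : Graph (24 + m)) (real : SameAs d G) (full : Full G) where

    private
      r v : Fin 5
      r = # 2
      v = # 3

    with-edge : ∀ p q s → p ≢ q → p ≢ s → q ≢ s → ¬ toℕ p < 2 → ¬ toℕ q < 2 → ¬ toℕ s < 2 → Adj G (ι p) (ι q) → Contains G host₅
    with-edge p q s p≢q p≢s q≢s p≮2 q≮2 s≮2 p~q =
      host-embed G (ι (# 0)) (ι (# 1)) (ι p ∷ ι q ∷ ι s ∷ []) _ (full (# 0) (# 1) (λ ()) (s≤s z≤n))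
        (spokes (# 0) (s≤s z≤n)) (spokes (# 1) (s≤s (s≤s z≤n)))
        ((↑ˡ-≢ p≢q ∷ ↑ˡ-≢ p≢s ∷ []) ∷ (↑ˡ-≢ q≢s ∷ []) ∷ [] ∷ []) (p~q ∷ [])
      where
      spokes : ∀ i → toℕ i < 2 → All (Adj G (ι i)) (ι p ∷ ι q ∷ ι s ∷ [])
      spokes i i<2 = full i p (λ { refl → p≮2 i<2 }) i<2 ∷ full i q (λ { refl → q≮2 i<2 }) i<2 ∷ full i s (λ { refl → s≮2 i<2 }) i<2 ∷ []

    -- For `d (# 3)` at least 5 = 2 + 3 the dense argument applies. Otherwise the outer degrees are
    -- at most 4, and `d (# 0)` ≥ 7 meets the condition 5 + 4 < 7 + 3 of `FinalStep`. In the
    -- remaining range all degrees are bounded and edges can be counted.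
    new-edge : ¬ Adj G (ι r) (ι v) → Isolated 2 G r → Isolated 2 G v → Contains G host₅ ⊎ Gain (pad (complete 5) M) G (ι r) (ι v)
    new-edge r≁v r-iso v-iso = by-cases (5 ≤? d (# 3)) (7 ≤? d (# 0))
      where
      up : ∀ {c} i → c ≤ d (ι i) → c ≤ deg G (ι i)
      up i c≤ = ≤-trans c≤ (≤-reflexive (sym (real (ι i))))
      outer-d : ∀ {D} → d (# 3) ≤ D → ∀ j → deg G (5 ↑ʳ j) ≤ D
      outer-d d₃≤ j = ≤-trans (≤-reflexive (real (5 ↑ʳ j))) (≤-trans (outer≤inner {k = 4} {M} sorted j (# 3)) d₃≤)
      sparse : d (# 3) ≤ 4 → d (# 0) ≤ 6 → Gain (pad (complete 5) M) G (ι r) (ι v)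
      sparse d₃≤4 d₀≤6 =
        let x , r~x , x-out = partner r r-iso
            y , v~y , y-out = partner v v-iso
        in sparse-switch (pad (complete 5) M) G 4 (pad-adj (complete 5) M {r} {v} refl) r≁v
             r~x (pad-free (complete 5) x-out (ι r) ∘ Adj-sym (pad (complete 5) M))
             v~y (pad-free (complete 5) y-out (ι v) ∘ Adj-sym (pad (complete 5) M)) (outer≤4 x-out) (outer≤4 y-out)
             (begin-strict
               2 * (20 + ∑ (λ z → deg G z ∸ 4)) + ∑deg (pad (complete 5) M)
                 ≡⟨ cong₂ (λ s t → 2 * (20 + s) + t) (∑-cong λ z → cong (_∸ 4) (real z)) (∑deg-pad (complete 5) M) ⟩
               2 * (20 + ∑ (λ z → d z ∸ 4)) + 20  ≤⟨ +-monoˡ-≤ 20 (*-monoʳ-≤ 2 (+-monoʳ-≤ 20 excess)) ⟩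
               72                                 <⟨ ≤-by (22 + 4 * m) (arith m) ⟩
               2 + suc (4 * (23 + m))             ≤⟨ +-monoʳ-≤ 2 bound ⟩
               2 + ∑ d                            ≡⟨ cong (2 +_) (∑-cong λ z → sym (real z)) ⟩
               2 + ∑deg G                         ∎)
        where
        open ≤-Reasoning
        arith : ∀ m → 73 + (22 + 4 * m) ≡ 2 + suc (4 * (23 + m))
        arith = solve-∀
        partner : ∀ r → Isolated 2 G r → ∃ λ x → Adj G (ι r) x × Outer x
        partner r r-iso =
          let x , r~x , x∉ = pick G (ι r) {zero ∷ suc zero ∷ []} {[]} [] [] (≤-trans (up r (low r)) (≤-reflexive (sym (+-identityʳ _))))
          in x , r~x , λ i x≡i → x∉ (subst (_∈ _) (sym x≡i) (hub-position i (r-iso i (subst (Adj G (ι r)) x≡i r~x))))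
          where
          hub-position : ∀ i → toℕ i < 2 → ι i ∈ zero ∷ suc zero ∷ []
          hub-position zero          _ = here refl
          hub-position (suc zero)    _ = there (here refl)
          hub-position (suc (suc i)) (s≤s (s≤s ()))
        outer≤4 : ∀ {x} → Outer x → deg G x ≤ 4
        outer≤4 x-out with Outer⇒↑ʳ x-out
        ... | j , refl = outer-d d₃≤4 j
        -- Only the vertices 0, 1 and 2 can exceed 4, each by at most 2. Of the two terms 20 in the
        -- count, one is 5 · 4 and the other the degree sum of K₅.
        excess : ∑ (λ z → d z ∸ 4) ≤ 6
        excess = +-mono-≤ {d zero ∸ 4} (∸-monoˡ-≤ 4 d₀≤6) (+-mono-≤ {d (# 1) ∸ 4} (∸-monoˡ-≤ 4 (≤-trans (sorted (# 0) (# 1) z≤n) d₀≤6))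
          (+-mono-≤ {d (# 2) ∸ 4} (∸-monoˡ-≤ 4 (≤-trans (sorted (# 0) (# 2) z≤n) d₀≤6))
            (≤-reflexive (∑-zero λ p → m≤n⇒m∸n≡0 (≤-trans (sorted (# 3) (suc (suc (suc p))) (s≤s (s≤s (s≤s z≤n)))) d₃≤4)))))
      by-cases : Dec (5 ≤ d (# 3)) → Dec (7 ≤ d (# 0)) → Contains G host₅ ⊎ Gain (pad (complete 5) M) G (ι r) (ι v)
      by-cases (yes d₃≥5) _ = [ inj₂ , inj₁ ∘ join⇒host₅ G ]′
        (dense-isolated {5} {M} 3 0 (s≤s (s≤s z≤n)) G {r} {v} (λ ()) r≁v r-iso v-iso
          (up r (≤-trans d₃≥5 (sorted (# 2) (# 3) (s≤s (s≤s z≤n))))) (up v d₃≥5))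
      by-cases (no d₃≱5) (yes d₀≥7) = inj₂ (FinalStep.final-edge {5} {M} G 1 4 full
        (outer-deg 4 M sorted G real)
        (outer-d (s≤s⁻¹ (≰⇒> d₃≱5)))
        (λ { zero _ → ≤-trans (+-monoʳ-≤ 3 (up zero d₀≥7)) (≤-reflexive (+-comm 3 _)) ; (suc _) (s≤s ()) })
        (# 1) refl (up (# 1) d₁≥5) r v (λ ()) (λ { (s≤s (s≤s ())) }) (λ { (s≤s (s≤s ())) }) (up r (low r)) (up v (low v)) r-iso v-iso)
      by-cases (no d₃≱5) (no d₀≱7) = inj₂ (sparse (s≤s⁻¹ (≰⇒> d₃≱5)) (s≤s⁻¹ (≰⇒> d₀≱7)))

  last : ∀ G → SameAs d G → Full G → Potential d host₅
  last G real full with adj? G (ι (# 2)) (ι (# 3)) | adj? G (ι (# 2)) (ι (# 4)) | adj? G (ι (# 3)) (ι (# 4))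
  ... | yes e | _ | _ = G , real , with-edge G real full (# 2) (# 3) (# 4) (λ ()) (λ ()) (λ ()) ≮2 ≮2 ≮2 e
  ... | no _ | yes e | _ = G , real , with-edge G real full (# 2) (# 4) (# 3) (λ ()) (λ ()) (λ ()) ≮2 ≮2 ≮2 e
  ... | no _ | no _ | yes e = G , real , with-edge G real full (# 3) (# 4) (# 2) (λ ()) (λ ()) (λ ()) ≮2 ≮2 ≮2 e
  ... | no e₂₃ | no e₂₄ | no e₃₄ with new-edge G real full e₂₃ iso₂ iso₃
    where
    iso₂ : Isolated 2 G (# 2)
    iso₂ zero                         _ = s≤s z≤n
    iso₂ (suc zero)                   _ = s≤s (s≤s z≤n)
    iso₂ (suc (suc zero))             e = contradiction refl (Adj⇒≢ G e)
    iso₂ (suc (suc (suc zero)))       e = contradiction e e₂₃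
    iso₂ (suc (suc (suc (suc zero)))) e = contradiction e e₂₄
    iso₃ : Isolated 2 G (# 3)
    iso₃ zero                         _ = s≤s z≤n
    iso₃ (suc zero)                   _ = s≤s (s≤s z≤n)
    iso₃ (suc (suc zero))             e = contradiction (Adj-sym G e) e₂₃
    iso₃ (suc (suc (suc zero)))       e = contradiction refl (Adj⇒≢ G e)
    iso₃ (suc (suc (suc (suc zero)))) e = contradiction e e₃₄
  ... | inj₁ found = G , real , found
  ... | inj₂ gain@(G′ , same , _ , e) = G′ , real′ , with-edge G′ real′ full′ (# 2) (# 3) (# 4) (λ ()) (λ ()) (λ ()) ≮2 ≮2 ≮2 e
    where
    real′ : SameAs d G′
    real′ i = trans (same i) (real i)
    full′ : Full G′
    full′ i j i≢j i<2 = complete-kept {5} {M} G gain {i} {j} (full i j i≢j i<2)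

-- With `d (# 1)` ≤ 4 the count leaves vertex 0 unrestricted and holds with nothing to spare at n =
-- 24. `Fill₅` needs `d (# 1)` ≥ 6 = 5 + 3 - 2. In between, `d (# 0)` ≤ 7 permits a count with t =
-- 5, and `d (# 0)` ≥ 8 permits `Apex`, since 5 + 5 < 8 + 3.
realize₅ : ∀ m (G : Graph (24 + m)) → Sorted (deg G) → 4 * (23 + m) < ∑deg G → Potential (deg G) host₅
realize₅ m G sorted bound = by-cases (d (# 1) ≤? 4) (d (# 1) ≤? 5) (d (# 0) ≤? 7)
  where
  open ≤-Reasoning
  d = deg G
  M = 19 + m
  d₁≥4 : 4 ≤ d (# 1)
  d₁≥4 = second-degree G sorted 3 bound
  low : ∀ i → 3 ≤ d (i ↑ˡ M)
  low i = ≤-trans (core-degree 3 {M} G sorted 2 ≤-refl bound) (inner≤inner {k = 4} {M} sorted {i} {# 4} (s≤s⁻¹ (toℕ<n i)))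
  host≤ : ∀ i → deg host₅ i ≤ d (i ↑ˡ M)
  host≤ zero          = ≤-trans d₁≥4 (sorted (# 0) (# 1) z≤n)
  host≤ (suc zero)    = d₁≥4
  host≤ (suc (suc i)) = ≤-trans (toWitness {a? = all? (λ i → deg host₅ (suc (suc i)) ≤? 3)} tt i) (low (suc (suc i)))
  arith₁ : ∀ m → suc (2 * (20 + ((19 + m) + 0)) + 16) + 2 * m ≡ 2 + suc (4 * (23 + m))
  arith₁ = solve-∀
  arith₂ : ∀ m → 81 + (14 + 4 * m) ≡ 2 + suc (4 * (23 + m))
  arith₂ = solve-∀
  Step : Set
  Step = ∀ G′ → SameAs d G′ → ∀ i j → toℕ i < 2 → i ≢ j → ¬ Adj G′ (i ↑ˡ M) (j ↑ˡ M) →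
    Potential d host₅ ⊎ Improve (pad (hub 5 2 []) M) G′
  finish : 5 ≤ d (# 1) → Step → Potential d host₅
  finish d₁≥5 step = case complete-hub {5} {M} 2 d step G (λ _ → refl) of λ where
    (inj₁ done)                 → done
    (inj₂ (G′ , real′ , full′)) → Last₅.last d sorted bound d₁≥5 low G′ real′ full′
  by-cases : Dec (d (# 1) ≤ 4) → Dec (d (# 1) ≤ 5) → Dec (d (# 0) ≤ 7) → Potential d host₅
  by-cases (yes d₁≤4) _ _ = sparse-potential ((# 0 , # 1) ∷ []) d sorted 4 host≤
    (λ p → ≤-trans (sorted (# 1) (suc (suc p)) (s≤s z≤n)) d₁≤4)
    (begin-strict
      2 * (20 + ((d (# 0) ∸ 4) + (d (# 1) ∸ 4))) + 16
        ≤⟨ +-monoˡ-≤ 16 (*-monoʳ-≤ 2 (+-monoʳ-≤ 20 (+-mono-≤ (∸-monoˡ-≤ 4 (deg≤ G zero)) (≤-reflexive (m≤n⇒m∸n≡0 d₁≤4))))) ⟩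
      2 * (20 + ((19 + m) + 0)) + 16   <⟨ ≤-by (2 * m) (arith₁ m) ⟩
      2 + suc (4 * (23 + m))           ≤⟨ +-monoʳ-≤ 2 bound ⟩
      2 + ∑deg G                       ∎)
    G (λ _ → refl)
  by-cases (no _) (yes d₁≤5) (yes d₀≤7) = sparse-potential ((# 0 , # 1) ∷ []) d sorted 5 host≤
    (λ p → ≤-trans (sorted (# 1) (suc (suc p)) (s≤s z≤n)) d₁≤5)
    (begin-strict
      2 * (30 + ((d (# 0) ∸ 5) + (d (# 1) ∸ 5))) + 16
        ≤⟨ +-monoˡ-≤ 16 (*-monoʳ-≤ 2 (+-monoʳ-≤ 30 (+-mono-≤ (∸-monoˡ-≤ 5 d₀≤7) (≤-reflexive (m≤n⇒m∸n≡0 d₁≤5))))) ⟩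
      80                               <⟨ ≤-by (14 + 4 * m) (arith₂ m) ⟩
      2 + suc (4 * (23 + m))           ≤⟨ +-monoʳ-≤ 2 bound ⟩
      2 + ∑deg G                       ∎)
    G (λ _ → refl)
  by-cases (no d₁≰4) (yes d₁≤5) (no d₀≰7) = finish (≰⇒> d₁≰4) λ G′ real i j i<2 i≢j i≁j →
      Sum.map₁ (λ J → G′ , real , join⇒host₅ G′ J) (A.step G′ real i j i<2 i≢j i≁j)
    where
    module A (G′ : Graph (24 + m)) (real : SameAs d G′) = Apex {1} {M} 5 G′
      (≤-trans (+-monoʳ-≤ 3 (same-deg G′ real zero (≰⇒> d₀≰7))) (≤-reflexive (+-comm 3 _)))
      (+-monoʳ-≤ 2 (same-deg G′ real (# 1) (≰⇒> d₁≰4)))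
      (λ i → ≤-trans (s≤s (same-deg G′ real _ (low (suc (suc i))))) (≤-reflexive (+-comm 1 _)))
      (λ p → ≤-trans (≤-reflexive (real (suc p))) (≤-trans (sorted (# 1) (suc p) (s≤s z≤n)) d₁≤5))
  by-cases (no _) (no d₁≰5) _ = finish (≤-trans (n≤1+n 5) (≰⇒> d₁≰5)) λ G′ real i j i<2 i≢j i≁j →
      Sum.map₁ (λ found → G′ , real , found) (Fill₅.step {M} G′
        (λ i i<2 → same-deg G′ real (i ↑ˡ M) (≤-trans (≰⇒> d₁≰5) (inner≤inner {k = 4} {M} sorted {i} {# 1} (s≤s⁻¹ i<2))))
        (λ i → same-deg G′ real (i ↑ˡ M) (low i))
        (outer-deg 4 M sorted G′ real)
        i j i<2 i≢j i≁j)

-- k = 4 and k = 3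

-- Peel off the first vertex: its edges are counted twice.
handshake : ∀ {n} (G : Graph n) → ∃ λ e → ∑deg G ≡ 2 * e
handshake {zero}  G = 0 , refl
handshake {suc n} G with handshake (delete G zero)
... | e , ∑≡ = deg₀ + e , (begin
  deg G zero + ∑ (λ i → deg G (suc i))
    ≡⟨ cong₂ _+_ (cong (λ b → ⟦ b ⟧ + deg₀) (irrefl G zero)) (∑-distrib-+ (λ i → ⟦ adj G (suc i) zero ⟧) (deg (delete G zero))) ⟩
  deg₀ + (∑ (λ i → ⟦ adj G (suc i) zero ⟧) + ∑deg (delete G zero))
    ≡⟨ cong₂ (λ a b → deg₀ + (a + b)) (∑-cong λ i → cong ⟦_⟧ (adj-sym G (suc i) zero)) ∑≡ ⟩
  deg₀ + (deg₀ + 2 * e)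
    ≡⟨ double deg₀ e ⟩
  2 * (deg₀ + e) ∎)
  where
  open ≡-Reasoning
  deg₀ : ℕ
  deg₀ = ∑ (λ i → ⟦ adj G zero (suc i) ⟧)
  double : ∀ a b → a + (a + 2 * b) ≡ 2 * (a + b)
  double = solve-∀

-- Havel–Hakimi on the degrees that remain after the edges of the host have been placed on the first
-- vertices. Nothing is proved about it; its results are checked.
module _ {n : ℕ} where

  private
    insert : Fin n × ℕ → List (Fin n × ℕ) → List (Fin n × ℕ)
    insert x []       = x ∷ []
    insert x (y ∷ ys) = if proj₂ y Nat.≤ᵇ proj₂ x then x ∷ y ∷ ys else y ∷ insert x ys

    sort : List (Fin n × ℕ) → List (Fin n × ℕ)
    sort = List.foldr insert []

    lower : List (Fin n × ℕ) → List (Fin n × ℕ)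
    lower = map λ (i , r) → i , r ∸ 1

    connect : ℕ → List (Fin n × ℕ) → List (Fin n × Fin n)
    connect zero       _              = []
    connect (suc fuel) []             = []
    connect (suc fuel) ((i , r) ∷ xs) = let ys = sort xs in
      map (λ (j , _) → i , j) (take r ys) ++ connect fuel (sort (lower (take r ys) ++ drop r ys))

    count : Fin n → List (Fin n × Fin n) → ℕ
    count i = sum ∘ map λ (p , q) → ⟦ does (i ≟ p) ⟧ + ⟦ does (i ≟ q) ⟧

  havel-hakimi : List (Fin n × Fin n) → (Fin n → ℕ) → Graph n
  havel-hakimi start d = hub n 0 (start ++ connect n (map (λ i → i , d i ∸ count i start) (allFin n)))

Descending : ∀ {n} → ℕ → Vec ℕ n → Set
Descending b []      = ⊤
Descending b (x ∷ π) = x ≤ b × Descending x π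

all-descending : ∀ n b {P : Vec ℕ n → Set} → (∀ π → Maybe (P π)) → Maybe (∀ π → Descending b π → P π)
all-descending zero    b f = Maybe.map (λ { p [] _ → p }) (f [])
all-descending (suc n) b {P} f =
  Maybe.map (λ { all (x ∷ π) (x≤b , desc) → at all x x≤b π desc })
    (all-maybe {suc b} λ x → all-descending n (toℕ x) λ π → f (toℕ x ∷ π))
  where
  at : (∀ (x : Fin (suc b)) π → Descending (toℕ x) π → P (toℕ x ∷ π)) → ∀ x → x ≤ b → ∀ π → Descending x π → P (x ∷ π)
  at all x x≤b π desc = subst (λ y → P (y ∷ π)) (toℕ-fromℕ< (s≤s x≤b))
    (all (fromℕ< (s≤s x≤b)) π (subst (λ y → Descending y π) (sym (toℕ-fromℕ< (s≤s x≤b))) desc))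

descending : ∀ {n b} (d : Fin n → ℕ) → Sorted d → (∀ i → d i ≤ b) → Descending b (Vec.tabulate d)
descending {zero}  d sorted d≤b = tt
descending {suc n} d sorted d≤b = d≤b zero ,
  descending (d ∘ suc) (λ i j i≤j → sorted (suc i) (suc j) (s≤s i≤j)) (λ i → sorted zero (suc i) z≤n)

Realizable : ∀ {k n} → Graph k → ℕ → ℕ → Vec ℕ (2 + n) → Set
Realizable H t s π = lookup π (# 1) ≤ t → s < Vec.sum π → (∃ λ e → Vec.sum π ≡ 2 * e) → Potential (lookup π) H

-- Sequences outside the range or with odd sum satisfy the claim vacuously; for each of the others
-- the constructed graph is tested for its degrees and for a copy of H.
realizable? : ∀ {k n} (H : Graph k) start t s (π : Vec ℕ (2 + n)) → Maybe (Realizable H t s π)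
realizable? {n = n} H start t s π with lookup π (# 1) ≤? t | s <? Vec.sum π | 2 ∣? Vec.sum π
... | no large | _        | _       = just λ small _ _ → contradiction small large
... | yes _    | no low   | _       = just λ _ high _ → contradiction high low
... | yes _    | yes _    | no odd  = just λ { _ _ (e , eq) → contradiction (divides e (trans eq (*-comm 2 e))) odd }
... | yes _    | yes _    | yes _   = attempt (havel-hakimi start (lookup π))
  where
  attempt : Graph (2 + n) → Maybe (Realizable H t s π)
  attempt G with all? (λ i → deg G i Nat.≟ lookup π i) | List.head (embeddings G H)
  ... | yes real | just G⊇H = just λ _ _ _ → G , real , G⊇H
  ... | _        | _        = nothing

potential-by-table : ∀ {k n b t s} (H : Graph k) → (∀ (π : Vec ℕ (2 + n)) → Descending b π → Realizable H t s π) →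
  (G : Graph (2 + n)) → Sorted (deg G) → deg G zero ≤ b → deg G (suc zero) ≤ t → s < ∑deg G → Potential (deg G) H
potential-by-table {b = b} {t} H table G sorted d₀≤b d₁≤t high =
  let G′ , real , G′⊇H = table π (descending (deg G) sorted (λ i → ≤-trans (sorted zero i z≤n) d₀≤b))
        (≤-trans (≤-reflexive (lookup∘tabulate (deg G) (# 1))) d₁≤t) high (handshake G)
  in G′ , (λ i → trans (real i) (lookup∘tabulate (deg G) i)) , G′⊇H
  where
  π = Vec.tabulate (deg G)

join⇒host₄ : ∀ {n} (G : Graph n) → Join G (λ _ → ⊤) 2 2 → Contains G host₄
join⇒host₄ G (join (c₁ ∷ c₂ ∷ []) (z₁ ∷ z₂ ∷ []) refl refl
    ((c₁~c₂ ∷ []) ∷ [] ∷ []) ((z₁≢z₂ ∷ []) ∷ [] ∷ []) ((z₁~c₁ ∷ z₁~c₂ ∷ []) ∷ (z₂~c₁ ∷ z₂~c₂ ∷ []) ∷ []) _ _) =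
  host-embed G c₁ c₂ (z₁ ∷ z₂ ∷ []) [] c₁~c₂ (Adj-sym G z₁~c₁ ∷ Adj-sym G z₂~c₁ ∷ [])
    (Adj-sym G z₁~c₂ ∷ Adj-sym G z₂~c₂ ∷ []) ((z₁≢z₂ ∷ []) ∷ [] ∷ []) []

join⇒host₃ : ∀ {n} (G : Graph n) → Join G (λ _ → ⊤) 2 2 → Contains G host₃
join⇒host₃ G (join (c₁ ∷ c₂ ∷ []) (z₁ ∷ z₂ ∷ []) refl refl
    ((c₁~c₂ ∷ []) ∷ [] ∷ []) _ ((z₁~c₁ ∷ z₁~c₂ ∷ []) ∷ _ ∷ []) _ _) =
  host-embed G c₁ c₂ (z₁ ∷ []) [] c₁~c₂ (Adj-sym G z₁~c₁ ∷ []) (Adj-sym G z₁~c₂ ∷ []) ([] ∷ []) []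

module Fill₄ {m : ℕ} (G : Graph (4 + m)) (big-deg : ∀ i → toℕ i < 2 → 4 ≤ deg G (i ↑ˡ m))
  (low : ∀ i → 2 ≤ deg G (i ↑ˡ m)) (outer-deg : ∀ j i → deg G (4 ↑ʳ j) ≤ deg G (i ↑ˡ m)) where

  open Core 4 m
  open Fill 2 2 0 (s≤s (s≤s z≤n)) ≤-refl G (λ i i<2 → s≤s (s≤s (big-deg i i<2))) outer-deg

  private
    ι : Fin 4 → Fin (4 + m)
    ι = _↑ˡ m

    other : ∀ i → Big i → ∃ λ p → Big p × i ≢ p
    other zero          _ = # 1 , s≤s (s≤s z≤n) , λ ()
    other (suc zero)    _ = # 0 , s≤s z≤n , λ ()
    other (suc (suc i)) (s≤s (s≤s ()))

  -- Let p be the other large vertex. If a small j is not adjacent to p, its two neighbours suffice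
  -- for `fill`. Otherwise one further neighbour y is guaranteed, and p y is the edge of K₄ - e
  -- common to its two triangles, with i and j at the tips.
  step : ∀ i j → Big i → i ≢ j → ¬ Adj G (ι i) (ι j) → Contains G host₄ ⊎ Improve target G
  step i j i-big i≢j i≁j = [ Sum.map₁ (join⇒host₄ G) , inj₁ ]′ (by-cases (toℕ j <? 2) (other i i-big))
    where
    one : ∀ {ys xs p} → Big p → length ys ≡ 1 → All (Adj G (ι j)) ys → All (Hub xs) ys → Adj G (ι p) (ι i) → Adj G (ι j) (ι p) →
      Contains G host₄
    one {y ∷ []} {p = p} p-big refl (j~y ∷ []) (h ∷ []) p~i j~p =
      host-embed G (ι p) y (ι j ∷ ι i ∷ []) [] (Adj-sym G (Hub.to-bigs h p p-big)) (Adj-sym G j~p ∷ p~i ∷ [])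
        (Adj-sym G j~y ∷ Hub.to-bigs h i i-big ∷ []) ((↑ˡ-≢ (≢-sym i≢j) ∷ []) ∷ [] ∷ []) []
    small : ¬ Big j → ∀ p → Big p → i ≢ p → Dec (Adj G (ι j) (ι p)) → Outcome ⊎ Contains G host₄
    small j-small p p-big i≢p (yes j~p) =
      let ys , ∣ys∣ , ys! , j~ys , ys∉ = small-picks 1 {j} {ι i ∷ []} ([] ∷ []) ((big∈ i-big , i≁j ∘ Adj-sym G) ∷ [])
            (≤-trans (s≤s (low j)) (≤-reflexive (+-comm 1 _)))
      in
      hubs i-big j-small i≁j ys! j~ys ys∉ >>= λ (xs , _ , _ , _ , _ , ys-hub) →
      full p i p-big (≢-sym i≢p) (inj₁ i-big) >>= λ p~i →
      inj₂ (one p-big ∣ys∣ j~ys ys-hub p~i j~p)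
    small j-small p p-big i≢p (no j≁p) = inj₁ (fill i-big i≢j i≁j (inj₂
      (ι i ∷ ι p ∷ [] , (↑ˡ-≢ i≢p ∷ []) ∷ [] ∷ [] , (big∈ i-big , i≁j ∘ Adj-sym G) ∷ (big∈ p-big , j≁p) ∷ [] , +-monoˡ-≤ 2 (low j))))
    by-cases : Dec (Big j) → ∃ (λ p → Big p × i ≢ p) → Outcome ⊎ Contains G host₄
    by-cases (yes j-big)  _                   = inj₁ (fill i-big i≢j i≁j (inj₁ j-big))
    by-cases (no j-small) (p , p-big , i≢p) = small j-small p p-big i≢p (adj? G (ι j) (ι p))

module _ where

  private
    start : ∀ {n} → List (Fin (4 + n) × Fin (4 + n))
    start = (# 0 , # 1) ∷ (# 0 , # 2) ∷ (# 0 , # 3) ∷ (# 1 , # 2) ∷ (# 1 , # 3) ∷ []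

    table : ∀ n → Maybe (∀ (π : Vec ℕ (4 + n)) → Descending 4 π → Realizable host₄ 3 (3 * (3 + n)) π)
    table n = all-descending (4 + n) 4 (realizable? host₄ start 3 (3 * (3 + n)))

  -- The lengths 7 to 12; from 13 on the count 36 < 2 + σ applies. At length 6 the sequence with all
  -- entries 3 is realized only by K₃,₃ and the prism, and neither contains K₄ - e.
  small-host₄ : ∀ m → m < 6 → (G : Graph (7 + m)) → Sorted (deg G) → deg G zero ≤ 4 → deg G (suc zero) ≤ 3 →
    3 * (6 + m) < ∑deg G → Potential (deg G) host₄
  small-host₄ 0 _ = potential-by-table {b = 4} {3} {18} host₄ (from-just (table 3))
  small-host₄ 1 _ = potential-by-table {b = 4} {3} {21} host₄ (from-just (table 4))
  small-host₄ 2 _ = potential-by-table {b = 4} {3} {24} host₄ (from-just (table 5))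
  small-host₄ 3 _ = potential-by-table {b = 4} {3} {27} host₄ (from-just (table 6))
  small-host₄ 4 _ = potential-by-table {b = 4} {3} {30} host₄ (from-just (table 7))
  small-host₄ 5 _ = potential-by-table {b = 4} {3} {33} host₄ (from-just (table 8))
  small-host₄ (suc (suc (suc (suc (suc (suc m)))))) (s≤s (s≤s (s≤s (s≤s (s≤s (s≤s ()))))))

module _ where

  private
    start : ∀ {n} → List (Fin (3 + n) × Fin (3 + n))
    start = (# 0 , # 1) ∷ (# 0 , # 2) ∷ (# 1 , # 2) ∷ []

    table : ∀ n → Maybe (∀ (π : Vec ℕ (3 + n)) → Descending 2 π → Realizable host₃ 2 (2 * (2 + n)) π)
    table n = all-descending (3 + n) 2 (realizable? host₃ start 2 (2 * (2 + n)))

  -- With degrees at most 2 and sum above 2(n - 1), parity leaves only the constant sequence 2. For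
  -- n = 4 and n = 5 its only realization is a cycle; from n = 6 on a triangle can be split off.
  -- From n = 9 on the count applies.
  small-host₃ : ∀ m → m < 3 → (G : Graph (6 + m)) → Sorted (deg G) → deg G zero ≤ 2 → deg G (suc zero) ≤ 2 →
    2 * (5 + m) < ∑deg G → Potential (deg G) host₃
  small-host₃ 0 _ = potential-by-table {b = 2} {2} {10} host₃ (from-just (table 3))
  small-host₃ 1 _ = potential-by-table {b = 2} {2} {12} host₃ (from-just (table 4))
  small-host₃ 2 _ = potential-by-table {b = 2} {2} {14} host₃ (from-just (table 5))
  small-host₃ (suc (suc (suc m))) (s≤s (s≤s (s≤s ())))

-- `Fill₄` needs `d (# 1)` ≥ 4 = 4 + 2 - 2. For `d (# 1)` ≤ 3, vertex 0 is large enough for `Apex`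
-- from degree 5 on, since 4 + 3 < 5 + 3; bounding its degree by 4 keeps the count valid from n =
-- 13, and hence the table short.
realize₄ : ∀ m (G : Graph (7 + m)) → Sorted (deg G) → 3 * (6 + m) < ∑deg G → Potential (deg G) host₄
realize₄ m G sorted bound = by-cases (d (# 1) ≤? 3) (d (# 0) ≤? 4) (m <? 6)
  where
  open ≤-Reasoning
  d = deg G
  M = 3 + m
  d₁≥3 : 3 ≤ d (# 1)
  d₁≥3 = second-degree G sorted 2 bound
  low : ∀ i → 2 ≤ d (i ↑ˡ M)
  low i = ≤-trans (core-degree 2 {M} G sorted 1 (n≤1+n 2) bound) (inner≤inner {k = 3} {M} sorted {i} {# 3} (s≤s⁻¹ (toℕ<n i)))
  host≤ : ∀ i → deg host₄ i ≤ d (i ↑ˡ M)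
  host≤ zero          = ≤-trans d₁≥3 (sorted (# 0) (# 1) z≤n)
  host≤ (suc zero)    = d₁≥3
  host≤ (suc (suc i)) = ≤-trans (toWitness {a? = all? (λ i → deg host₄ (suc (suc i)) ≤? 2)} tt i) (low (suc (suc i)))
  Step : Set
  Step = ∀ G′ → SameAs d G′ → ∀ i j → toℕ i < 2 → i ≢ j → ¬ Adj G′ (i ↑ˡ M) (j ↑ˡ M) →
    Potential d host₄ ⊎ Improve (pad (hub 4 2 []) M) G′
  finish : Step → Potential d host₄
  finish step = case complete-hub {4} {M} 2 d step G (λ _ → refl) of λ where
    (inj₁ done)                → done
    (inj₂ (G′ , real′ , full)) → G′ , real′ , hub-embed G′ 2 [] (_↑ˡ M) (λ {i} {j} → ↑ˡ-injective M i j)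
      (λ i j i<2 i≢j → full i j i≢j i<2) []
  by-cases : Dec (d (# 1) ≤ 3) → Dec (d (# 0) ≤ 4) → Dec (m < 6) → Potential d host₄
  by-cases (no d₁≰3) _ _ = finish λ G′ real i j i<2 i≢j i≁j →
    Sum.map₁ (λ found → G′ , real , found) (Fill₄.step {M} G′
      (λ i i<2 → same-deg G′ real (i ↑ˡ M) (≤-trans (≰⇒> d₁≰3) (inner≤inner {k = 3} {M} sorted {i} {# 1} (s≤s⁻¹ i<2))))
      (λ i → same-deg G′ real (i ↑ˡ M) (low i))
      (outer-deg 3 M sorted G′ real)
      i j i<2 i≢j i≁j)
  by-cases (yes d₁≤3) (no d₀≰4) _ = finish λ G′ real i j i<2 i≢j i≁j →
      Sum.map₁ (λ J → G′ , real , join⇒host₄ G′ J) (A.step G′ real i j i<2 i≢j i≁j)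
    where
    module A (G′ : Graph (7 + m)) (real : SameAs d G′) = Apex {0} {M} 3 G′
      (≤-trans (+-monoʳ-≤ 3 (same-deg G′ real zero (≰⇒> d₀≰4))) (≤-reflexive (+-comm 3 _)))
      (+-monoʳ-≤ 2 (same-deg G′ real (# 1) d₁≥3))
      (λ i → ≤-trans (s≤s (same-deg G′ real _ (low (suc (suc i))))) (≤-reflexive (+-comm 1 _)))
      (λ p → ≤-trans (≤-reflexive (real (suc p))) (≤-trans (sorted (# 1) (suc p) (s≤s z≤n)) d₁≤3))
  by-cases (yes d₁≤3) (yes d₀≤4) (yes m<6) = small-host₄ m m<6 G sorted d₀≤4 d₁≤3 bound
  by-cases (yes d₁≤3) (yes d₀≤4) (no m≮6) = sparse-potential [] d sorted 3 host≤
    (λ p → ≤-trans (sorted (# 1) (suc (suc p)) (s≤s z≤n)) d₁≤3)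
    (begin-strict
      2 * (12 + ((d (# 0) ∸ 3) + (d (# 1) ∸ 3))) + 10
        ≤⟨ +-monoˡ-≤ 10 (*-monoʳ-≤ 2 (+-monoʳ-≤ 12 (+-mono-≤ (∸-monoˡ-≤ 3 d₀≤4) (≤-reflexive (m≤n⇒m∸n≡0 d₁≤3))))) ⟩
      36                               <⟨ +-monoʳ-≤ 3 (≤-trans (n≤1+n 34) (n≤1+n 35)) ⟩
      2 + suc (3 * (6 + 6))            ≤⟨ +-monoʳ-≤ 3 (*-monoʳ-≤ 3 (+-monoʳ-≤ 6 (≮⇒≥ m≮6))) ⟩
      2 + suc (3 * (6 + m))            ≤⟨ +-monoʳ-≤ 2 bound ⟩
      2 + ∑deg G                       ∎)
    G (λ _ → refl)

realize₃ : ∀ m (G : Graph (6 + m)) → Sorted (deg G) → 2 * (5 + m) < ∑deg G → Potential (deg G) host₃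
realize₃ m G sorted bound = by-cases (d (# 0) ≤? 2) (m <? 3)
  where
  open ≤-Reasoning
  d = deg G
  M = 3 + m
  low : ∀ i → 2 ≤ d (i ↑ˡ M)
  low i = ≤-trans (core-degree 1 {M} G sorted 1 ≤-refl bound) (inner≤inner {k = 2} {M} sorted {i} {# 2} (s≤s⁻¹ (toℕ<n i)))
  Full : Graph (6 + m) → Set
  Full G = ∀ i j → i ≢ j → toℕ i < 1 → Adj G (i ↑ˡ M) (j ↑ˡ M)
  triangle-at : ∀ G → Full G → Adj G (# 1) (# 2) → Contains G host₃
  triangle-at G full 1~2 = host-embed G (# 0) (# 1) ((# 2) ∷ []) [] (full (# 0) (# 1) (λ ()) (s≤s z≤n))
    (full (# 0) (# 2) (λ ()) (s≤s z≤n) ∷ []) (1~2 ∷ []) ([] ∷ []) []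
  step : 3 ≤ d (# 0) → ∀ G′ → SameAs d G′ → ∀ i j → toℕ i < 1 → i ≢ j → ¬ Adj G′ (i ↑ˡ M) (j ↑ˡ M) →
    Potential d host₃ ⊎ Improve (pad (hub 3 1 []) M) G′
  step d₀≥3 G′ real i j i<1 i≢j i≁j = Sum.map₁ (λ J → G′ , real , join⇒host₃ G′ J)
    (F.fill {i} {j} i<1 i≢j i≁j (inj₂ (F.roomy {i} {j} i<1 i≁j
      (≤-trans (s≤s (same-deg G′ real (j ↑ˡ M) (low j))) (≤-reflexive (+-comm 1 _))))))
    where
    big-deg : ∀ i → toℕ i < 1 → 5 ≤ 2 + deg G′ (i ↑ˡ M)
    big-deg zero    _ = s≤s (s≤s (same-deg G′ real zero d₀≥3))
    big-deg (suc _) (s≤s ())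
    module F = Fill {3} {M} 1 2 0 (s≤s z≤n) (s≤s z≤n) G′ big-deg (outer-deg 2 M sorted G′ real)
  last : 3 ≤ d (# 0) → ∀ G′ → SameAs d G′ → Full G′ → Dec (Adj G′ (# 1) (# 2)) → Potential d host₃
  last d₀≥3 G′ real full (yes 1~2) = G′ , real , triangle-at G′ full 1~2
  last d₀≥3 G′ real full (no 1≁2) =
    -- With b = 0 the set `As` is empty and vertex 0 itself plays c; D is simply the largest degree.
    let gain = FinalStep.final-edge {3} {M} G′ 0 (d (# 0)) full
          (outer-deg 2 M sorted G′ real)
          (λ j → ≤-trans (≤-reflexive (real _)) (sorted zero _ z≤n))
          (λ _ ()) zero refl (same-deg G′ real zero d₀≥3) (# 1) (# 2) (λ ()) (λ { (s≤s ()) }) (λ { (s≤s ()) })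
          (same-deg G′ real (# 1) (low (# 1))) (same-deg G′ real (# 2) (low (# 2))) iso₁ iso₂
        G″ , same , _ , 1~2 = gain
    in G″ , (λ i → trans (same i) (real i)) ,
       triangle-at G″ (λ i j i≢j i<1 → complete-kept {3} {M} G′ gain {i} {j} (full i j i≢j i<1)) 1~2
    where
    iso₁ : Isolated {3} {M} 1 G′ (# 1)
    iso₁ zero             _ = s≤s z≤n
    iso₁ (suc zero)       e = contradiction refl (Adj⇒≢ G′ e)
    iso₁ (suc (suc zero)) e = contradiction e 1≁2
    iso₂ : Isolated {3} {M} 1 G′ (# 2)
    iso₂ zero             _ = s≤s z≤n
    iso₂ (suc zero)       e = contradiction (Adj-sym G′ e) 1≁2
    iso₂ (suc (suc zero)) e = contradiction refl (Adj⇒≢ G′ e)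
  by-cases : Dec (d (# 0) ≤ 2) → Dec (m < 3) → Potential d host₃
  by-cases (no d₀≰2) _ = case complete-hub {3} {M} 1 d (step (≰⇒> d₀≰2)) G (λ _ → refl) of λ where
    (inj₁ done)                → done
    (inj₂ (G′ , real′ , full)) → last (≰⇒> d₀≰2) G′ real′ full (adj? G′ (# 1) (# 2))
  by-cases (yes d₀≤2) (yes m<3) = small-host₃ m m<3 G sorted d₀≤2 (≤-trans (sorted (# 0) (# 1) z≤n) d₀≤2) bound
  by-cases (yes d₀≤2) (no m≮3) = sparse-potential [] d sorted 2
    (λ i → ≤-trans (toWitness {a? = all? (λ i → deg host₃ i ≤? 2)} tt i) (low i))
    (λ p → ≤-trans (sorted (# 0) (suc (suc p)) z≤n) d₀≤2)
    (begin-strict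
      2 * (6 + ((d (# 0) ∸ 2) + (d (# 1) ∸ 2))) + 6
        ≡⟨ cong₂ (λ a b → 2 * (6 + (a + b)) + 6) (m≤n⇒m∸n≡0 d₀≤2) (m≤n⇒m∸n≡0 (≤-trans (sorted (# 0) (# 1) z≤n) d₀≤2)) ⟩
      18                               <⟨ ≤-refl ⟩
      2 + suc (2 * (5 + 3))            ≤⟨ +-monoʳ-≤ 3 (*-monoʳ-≤ 2 (+-monoʳ-≤ 5 (≮⇒≥ m≮3))) ⟩
      2 + suc (2 * (5 + m))            ≤⟨ +-monoʳ-≤ 2 bound ⟩
      2 + ∑deg G                       ∎)
    G (λ _ → refl)

-- From hosts to all 2-trees

Forces : ℕ → ℕ → Set
Forces k N = (n : ℕ) → n ≥ N → (π : Vec ℕ n) → Graphic π → σ π > (k ∸ 1) * (n ∸ 1) →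
  Σ (Graph n) λ G → Realizes G π × ContainsAllTwoTrees k G

forces : ∀ {k N} (H : Graph k) → ContainsAllTwoTrees k H →
  (∀ m (G : Graph (N + m)) → Sorted (deg G) → (k ∸ 1) * (N + m ∸ 1) < ∑deg G → Potential (deg G) H) → Forces k N
forces {k} {N} H all realize n n≥N π (nonInc , G , real) σ> with m≤n⇒∃[o]m+o≡n n≥N
... | m , refl =
  let G′ , same , G′⊇H = realize m G
        (λ i j i≤j → subst₂ _≤_ (sym (real j)) (sym (real i)) (nonInc i j i≤j))
        (≤-trans σ> (≤-reflexive (sym (trans (∑-cong real) (cong Vec.sum (tabulate∘lookup π))))))
  in G′ , (λ i → trans (same i) (real i)) , λ T tree → Contains-trans G′ H T G′⊇H (all T tree)

theorem1p4 : (k N : ℕ) → KN k N →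
    ((n : ℕ) → n ≥ N → (π : Vec ℕ n) → Graphic π → σ π > (k ∸ 1) * (n ∸ 1) →
    Σ (Graph n) λ G → Realizes G π × ContainsAllTwoTrees k G)
    × ((n₀ : ℕ) → Σ ℕ λ n → n ≥ n₀ × Σ (Vec ℕ n) λ π →
    Graphic π × σ π ≡ (k ∸ 1) * (n ∸ 1) ×
    ((G : Graph n) → Realizes G π → ¬ ContainsAllTwoTrees k G))
theorem1p4 _ _ k3 = forces {3} {6} host₃ all-in-host₃ realize₃ , sharpness 0
theorem1p4 _ _ k4 = forces {4} {7} host₄ all-in-host₄ realize₄ , sharpness 1
theorem1p4 _ _ k5 = forces {5} {24} host₅ all-in-host₅ realize₅ , sharpness 2
theorem1p4 _ _ k7 = forces {7} {93} host₇ all-in-host₇ realize₇ , sharpness 4
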